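{- Let $\alpha,\beta,\gamma>0$ satisfy the strict triangle inequalities $\alpha<\beta+\gamma$, $\beta<\alpha+\gamma$, $\gamma<\alpha+\beta$. As $n\to\infty$ through values with $a=\alpha n$, $b=\beta n$, $c=\gamma n$ nonnegative integers, $$E(a,b,c)\sim\frac{2^{a+b+c+1}}{\pi\sqrt{2ab+2ac+2bc-a^2-b^2-c^2}}\cdot\frac{a!\,b!\,c!}{(a+b-c)!\,(a-b+c)!\,(b-a+c)!}.$$
   Context: For nonnegative integers $n_1,\dots,n_S$, $E(n_1,\dots,n_S)$ denotes the number of block derangements: $S$ players hold $n_1,\dots,n_S$ distinct cards respectively; all $N=n_1+\dots+n_S$ cards are redealt so that player $j$ again receives exactly $n_j$ cards (only which cards each player gets matters); $E$ counts the deals in which no player receives any card he originally held. Equivalently, $E(n_1,\dots,n_S)$ is the coefficient of $x_1^{n_1}\cdots x_S^{n_S}$ in $\prod_{j=1}^S(x_1+\dots+x_S-x_j)^{n_j}$. -}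

module Defs where

open import Data.Fin.Base using (Fin; zero; suc)
import Data.Fin.Properties as Fin
open import Data.Integer.Base as ℤ using (ℤ; +_)
import Data.Integer.Properties as ℤ
open import Data.List.Base as List using (List; []; _∷_)
open import Data.Nat.Base as ℕ using (ℕ; zero; suc; z≤n; s≤s; _!)
import Data.Nat.Properties as ℕ
open import Data.Nat.Tactic.RingSolver using (solve-∀)
open import Data.Product.Base using (∃; ∃-syntax; Σ-syntax; _×_; _,_; proj₁; proj₂)
open import Data.Rational.Base as ℚ using (ℚ; 0ℚ; ½)
import Data.Rational.Base
import Data.Rational.Properties as ℚ
open import Data.Rational.Solver using (module +-*-Solver)
import Data.Rational.Unnormalised.Base as ℚᵘ
import Data.Rational.Unnormalised.Properties as ℚᵘ
open import Data.Sum.Base using (inj₁; inj₂)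
open import Data.Vec.Base as Vec using (Vec; []; _∷_)
open import Data.Vec.Relation.Binary.Pointwise.Inductive as Pointwise using (Pointwise)
open import Relation.Binary.PropositionalEquality
open import Relation.Nullary.Decidable using (Dec; yes; no; _×-dec_; ¬?)
open import Relation.Nullary.Negation using (contradiction)

-- The original owner of each of the N = n₁ + ⋯ + n_S cards, the cards being
-- listed player by player.
owners : ∀ {S} (n : Vec ℕ S) → Vec (Fin S) (Vec.sum n)
owners []      = []
owners (m ∷ n) = Vec.replicate m zero Vec.++ Vec.map suc (owners n)

-- A deal is recorded by the player who receives each card, so that only
-- which cards each player gets matters.
IsBlockDerangement : ∀ {S} (n : Vec ℕ S) → Vec (Fin S) (Vec.sum n) → Set
IsBlockDerangement n deal =
  (∀ j → Vec.count (Fin._≟ j) deal ≡ Vec.lookup n j) × Pointwise _≢_ deal (owners n)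

isBlockDerangement? : ∀ {S} (n : Vec ℕ S) deal → Dec (IsBlockDerangement n deal)
isBlockDerangement? n deal =
  Fin.all? (λ j → Vec.count (Fin._≟ j) deal ℕ.≟ Vec.lookup n j)
    ×-dec Pointwise.decidable (λ i j → ¬? (i Fin.≟ j)) deal (owners n)

-- Every vector over Fin S of the given length, each exactly once.
allVecs : ∀ S N → List (Vec (Fin S) N)
allVecs S zero    = List.[ [] ]
allVecs S (suc N) = List.cartesianProductWith _∷_ (List.allFin S) (allVecs S N)

E : ∀ {S} → Vec ℕ S → ℕ
E {S} n = List.length (List.filter (isBlockDerangement? n) (allVecs S (Vec.sum n)))

module _ where
    open Data.Rational.Base
    open ℚ.≤-Reasoning

    half+half : ∀ ε → ½ * ε + ½ * ε ≡ ε
    half+half = solve 1 (λ x → con ½ :* x :+ con ½ :* x := x) refl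
      where open +-*-Solver

    *-pos : ∀ {p q} → 0ℚ < p → 0ℚ < q → 0ℚ < p * q
    *-pos {p} {q} 0<p 0<q =
      ℚ.positive⁻¹ (p * q) {{ℚ.pos*pos⇒pos p {{positive 0<p}} q {{positive 0<q}}}}

    half-pos : ∀ {ε} → 0ℚ < ε → 0ℚ < ½ * ε
    half-pos = *-pos (ℚ.positive⁻¹ ½)

    <⇒-< : ∀ {p q ε} → p < q + ε → p - q < ε
    <⇒-< {p} {q} {ε} lt = begin-strict
      p - q         <⟨ ℚ.+-monoˡ-< (- q) lt ⟩
      (q + ε) - q   ≡⟨ solve 2 (λ q ε → (q :+ ε) :- q := ε) refl q ε ⟩
      ε             ∎
      where open +-*-Solver

    -<⇒< : ∀ {p q ε} → p - q < ε → p < q + ε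
    -<⇒< {p} {q} {ε} lt = begin-strict
      p             ≡⟨ solve 2 (λ p q → p := q :+ (p :- q)) refl p q ⟩
      q + (p - q)   <⟨ ℚ.+-monoʳ-< q lt ⟩
      q + ε         ∎
      where open +-*-Solver

    neg-sub : ∀ p q → - (p - q) ≡ q - p
    neg-sub = solve 2 (λ p q → :- (p :- q) := q :- p) refl
      where open +-*-Solver

    ∣-∣-sym : ∀ p q → ∣ p - q ∣ ≡ ∣ q - p ∣
    ∣-∣-sym p q = trans (sym (ℚ.∣-p∣≡∣p∣ (p - q))) (cong ∣_∣ (neg-sub p q))

    ∣-∣< : ∀ {p q ε} → p < q + ε → q < p + ε → ∣ p - q ∣ < ε
    ∣-∣< {p} {q} {ε} lt₁ lt₂ with ℚ.∣p∣≡p∨∣p∣≡-p (p - q)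
    ... | inj₁ eq = subst (_< ε) (sym eq) (<⇒-< {p} {q} lt₁)
    ... | inj₂ eq = subst (_< ε) (sym (trans eq (neg-sub p q))) (<⇒-< {q} {p} lt₂)

    p≤∣p∣ : ∀ p → p ≤ ∣ p ∣
    p≤∣p∣ p with ℚ.≤-total 0ℚ p
    ... | inj₁ 0≤p = ℚ.≤-reflexive (sym (ℚ.0≤p⇒∣p∣≡p 0≤p))
    ... | inj₂ p≤0 = ℚ.≤-trans p≤0 (ℚ.0≤∣p∣ p)

    ∣-∣<⇒< : ∀ {p q ε} → ∣ p - q ∣ < ε → p < q + ε
    ∣-∣<⇒< {p} {q} lt = -<⇒< {p} {q} (ℚ.≤-<-trans (p≤∣p∣ (p - q)) lt)

    ∣-∣<⇒>  : ∀ {p q ε} → ∣ p - q ∣ < ε → q < p + ε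
    ∣-∣<⇒> {p} {q} {ε} lt = ∣-∣<⇒< {q} {p} (subst (_< ε) (∣-∣-sym p q) lt)

    ∣∣-∣∣≤ : ∀ p q → ∣ p ∣ ≤ ∣ q ∣ + ∣ p - q ∣
    ∣∣-∣∣≤ p q = begin
      ∣ p ∣               ≡⟨ cong ∣_∣ (solve 2 (λ p q → p := q :+ (p :- q)) refl p q) ⟩
      ∣ q + (p - q) ∣     ≤⟨ ℚ.∣p+q∣≤∣p∣+∣q∣ q (p - q) ⟩
      ∣ q ∣ + ∣ p - q ∣   ∎
      where open +-*-Solver

    +-<-halves : ∀ {p q ε} → p < ½ * ε → q < ½ * ε → p + q < ε
    +-<-halves {ε = ε} lt₁ lt₂ = subst (_ <_) (half+half ε) (ℚ.+-mono-< lt₁ lt₂)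

    *-mono-nonNeg : ∀ {p q r s} → 0ℚ ≤ p → 0ℚ ≤ s → p ≤ q → r ≤ s → p * r ≤ q * s
    *-mono-nonNeg {p} {q} {r} {s} 0≤p 0≤s p≤q r≤s = begin
      p * r   ≤⟨ ℚ.*-monoˡ-≤-nonNeg p {{nonNegative 0≤p}} r≤s ⟩
      p * s   ≤⟨ ℚ.*-monoʳ-≤-nonNeg s {{nonNegative 0≤s}} p≤q ⟩
      q * s   ∎

    /-cross-≤ : ∀ a b c d → a ℕ.* suc d ℕ.≤ c ℕ.* suc b → (+ a) / suc b ≤ (+ c) / suc d
    /-cross-≤ a b c d le = ℚ.toℚᵘ-cancel-≤
      (ℚᵘ.≤-respˡ-≃ (ℚᵘ.≃-sym (ℚ.toℚᵘ-fromℚᵘ (ℚᵘ.mkℚᵘ (+ a) b)))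
      (ℚᵘ.≤-respʳ-≃ (ℚᵘ.≃-sym (ℚ.toℚᵘ-fromℚᵘ (ℚᵘ.mkℚᵘ (+ c) d)))
      (ℚᵘ.*≤* (subst₂ ℤ._≤_ (ℤ.pos-* a (suc d)) (ℤ.pos-* c (suc b)) (ℤ.+≤+ le)))))

    /-cancel-< : ∀ a b → (+ a) / 1 < (+ b) / 1 → a ℕ.< b
    /-cancel-< a b lt with ℚᵘ.<-respˡ-≃ (ℚ.toℚᵘ-fromℚᵘ (ℚᵘ.mkℚᵘ (+ a) 0))
                         (ℚᵘ.<-respʳ-≃ (ℚ.toℚᵘ-fromℚᵘ (ℚᵘ.mkℚᵘ (+ b) 0)) (ℚ.toℚᵘ-mono-< lt))
    ... | ℚᵘ.*<* lt′ = ℤ.drop‿+<+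
      (subst₂ ℤ._<_ (ℤ.*-identityʳ (+ a)) (ℤ.*-identityʳ (+ b)) lt′)

    /-+ : ∀ a b d → (+ (a ℕ.+ b)) / suc d ≡ (+ a) / suc d + (+ b) / suc d
    /-+ a b d = ℚ.toℚᵘ-injective
      (ℚᵘ.≃-trans (ℚ.toℚᵘ-fromℚᵘ (ℚᵘ.mkℚᵘ (+ (a ℕ.+ b)) d))
      (ℚᵘ.≃-trans (ℚᵘ.*≡* eq)
      (ℚᵘ.≃-sym (ℚᵘ.≃-trans (ℚ.toℚᵘ-homo-+ ((+ a) / suc d) ((+ b) / suc d))
        (ℚᵘ.+-cong (ℚ.toℚᵘ-fromℚᵘ (ℚᵘ.mkℚᵘ (+ a) d)) (ℚ.toℚᵘ-fromℚᵘ (ℚᵘ.mkℚᵘ (+ b) d)))))))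
      where
      D = + suc d
      nat-eq : ∀ a b d → (a ℕ.+ b) ℕ.* (d ℕ.* d) ≡ (a ℕ.* d ℕ.+ b ℕ.* d) ℕ.* d
      nat-eq = solve-∀
      eq : + (a ℕ.+ b) ℤ.* + (suc d ℕ.* suc d) ≡ (+ a ℤ.* D ℤ.+ + b ℤ.* D) ℤ.* D
      eq = trans (sym (ℤ.pos-* (a ℕ.+ b) (suc d ℕ.* suc d)))
           (trans (cong +_ (nat-eq a b (suc d)))
           (trans (ℤ.pos-* (a ℕ.* suc d ℕ.+ b ℕ.* suc d) (suc d))
             (cong (ℤ._* D) (trans (ℤ.pos-+ (a ℕ.* suc d) (b ℕ.* suc d))
               (cong₂ ℤ._+_ (ℤ.pos-* a (suc d)) (ℤ.pos-* b (suc d)))))))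

    archimedean : ∀ C {ε} → 0ℚ < ε → ∃[ N ] ∀ m → N ℕ.≤ m → (+ C) / suc m < ε
    archimedean C {mkℚ (+ zero) d _}  0<ε = contradiction (positive 0<ε) λ ()
    archimedean C {mkℚ ℤ.-[1+ _ ] d _} 0<ε = contradiction (positive 0<ε) λ ()
    archimedean C {ε@(mkℚ (+ suc p) d _)} 0<ε = C ℕ.* suc d , λ m le → ℚ.toℚᵘ-cancel-<
      (ℚᵘ.<-respˡ-≃ (ℚᵘ.≃-sym (ℚ.toℚᵘ-fromℚᵘ (ℚᵘ.mkℚᵘ (+ C) m)))
      (ℚᵘ.*<* (subst₂ ℤ._<_ (ℤ.pos-* C (suc d)) (ℤ.pos-* (suc p) (suc m))
        (ℤ.+<+ (ℕ.≤-trans (s≤s le) (ℕ.m≤m+n (suc m) (p ℕ.* suc m)))))))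

IsCauchy : (ℕ → ℚ) → Set
IsCauchy s = ∀ ε → 0ℚ ℚ.< ε → ∃[ N ] ∀ m n → N ℕ.≤ m → N ℕ.≤ n → ℚ.∣ s m ℚ.- s n ∣ ℚ.< ε

record ℝ : Set where
  constructor mkℝ
  field
    seq    : ℕ → ℚ
    cauchy : IsCauchy seq

open ℝ public

infix 4 _≃ᴿ_ _≤ᴿ_ _<ᴿ_

_≃ᴿ_ : ℝ → ℝ → Set
x ≃ᴿ y = ∀ ε → 0ℚ ℚ.< ε → ∃[ N ] ∀ n → N ℕ.≤ n → ℚ.∣ seq x n ℚ.- seq y n ∣ ℚ.< ε

_≤ᴿ_ : ℝ → ℝ → Set
x ≤ᴿ y = ∀ ε → 0ℚ ℚ.< ε → ∃[ N ] ∀ n → N ℕ.≤ n → seq x n ℚ.≤ seq y n ℚ.+ ε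

_<ᴿ_ : ℝ → ℝ → Set
x <ᴿ y = ∃[ ε ] 0ℚ ℚ.< ε × ∃[ N ] ∀ n → N ℕ.≤ n → seq x n ℚ.+ ε ℚ.≤ seq y n

fromℚ : ℚ → ℝ
fromℚ q = mkℝ (λ _ → q) λ ε 0<ε → 0 , λ _ _ _ _ →
  subst (λ p → ℚ.∣ p ∣ ℚ.< ε) (sym (ℚ.+-inverseʳ q)) 0<ε

fromℕ : ℕ → ℝ
fromℕ n = fromℚ (+ n ℚ./ 1)

0ᴿ : ℝ
0ᴿ = fromℚ 0ℚ

infixl 6 _+ᴿ_ _-ᴿ_
infixl 7 _*ᴿ_
infix  8 -ᴿ_

_+ᴿ_ : ℝ → ℝ → ℝ
mkℝ x cx +ᴿ mkℝ y cy = mkℝ (λ n → x n + y n) λ ε 0<ε →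
  let (Nx , hx) = cx (½ * ε) (half-pos 0<ε)
      (Ny , hy) = cy (½ * ε) (half-pos 0<ε)
  in Nx ℕ.⊔ Ny , λ m n le₁ le₂ → begin-strict
    ∣ (x m + y m) - (x n + y n) ∣         ≡⟨ cong ∣_∣ (rearrange (x m) (y m) (x n) (y n)) ⟩
    ∣ (x m - x n) + (y m - y n) ∣         ≤⟨ ℚ.∣p+q∣≤∣p∣+∣q∣ (x m - x n) (y m - y n) ⟩
    ∣ x m - x n ∣ + ∣ y m - y n ∣         <⟨ +-<-halves
      (hx m n (ℕ.m⊔n≤o⇒m≤o Nx Ny le₁) (ℕ.m⊔n≤o⇒m≤o Nx Ny le₂))
      (hy m n (ℕ.m⊔n≤o⇒n≤o Nx Ny le₁) (ℕ.m⊔n≤o⇒n≤o Nx Ny le₂)) ⟩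
    ε                                     ∎
  where
  open Data.Rational.Base
  open ℚ.≤-Reasoning
  rearrange : ∀ a b c d → (a + b) - (c + d) ≡ (a - c) + (b - d)
  rearrange = solve 4 (λ a b c d → (a :+ b) :- (c :+ d) := (a :- c) :+ (b :- d)) refl
    where open +-*-Solver

-ᴿ_ : ℝ → ℝ
-ᴿ mkℝ x cx = mkℝ (λ n → - x n) λ ε 0<ε →
  let (N , h) = cx ε 0<ε
  in N , λ m n le₁ le₂ → subst (_< ε)
       (trans (sym (ℚ.∣-p∣≡∣p∣ (x m - x n))) (cong ∣_∣ (ℚ.neg-distrib-+ (x m) (- x n))))
       (h m n le₁ le₂)
  where open Data.Rational.Base

_-ᴿ_ : ℝ → ℝ → ℝ
x -ᴿ y = x +ᴿ -ᴿ y

∣_∣ᴿ : ℝ → ℝ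
∣ mkℝ x cx ∣ᴿ = mkℝ (λ n → ∣ x n ∣) λ ε 0<ε →
  let (N , h) = cx ε 0<ε
  in N , λ m n le₁ le₂ →
    ∣-∣< {∣ x m ∣} {∣ x n ∣}
      (ℚ.≤-<-trans (∣∣-∣∣≤ (x m) (x n)) (ℚ.+-monoʳ-< ∣ x n ∣ (h m n le₁ le₂)))
      (ℚ.≤-<-trans (∣∣-∣∣≤ (x n) (x m)) (ℚ.+-monoʳ-< ∣ x m ∣ (h n m le₂ le₁)))
  where open Data.Rational.Base

module _ where
  eventually-bounded : ∀ s → IsCauchy s →
    ∃[ B ] 0ℚ ℚ.< B × ∃[ N ] ∀ n → N ℕ.≤ n → ℚ.∣ s n ∣ ℚ.≤ B
  eventually-bounded s c with c ℚ.1ℚ (ℚ.positive⁻¹ ℚ.1ℚ)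
  ... | N , h = ∣ s N ∣ + 1ℚ
      , ℚ.≤-<-trans (ℚ.0≤∣p∣ (s N)) (subst (_< ∣ s N ∣ + 1ℚ) (ℚ.+-identityʳ ∣ s N ∣)
          (ℚ.+-monoʳ-< ∣ s N ∣ (ℚ.positive⁻¹ 1ℚ)))
      , N , λ n le → ℚ.≤-trans (∣∣-∣∣≤ (s n) (s N))
          (ℚ.+-monoʳ-≤ ∣ s N ∣ (ℚ.<⇒≤ (h n N le ℕ.≤-refl)))
    where open Data.Rational.Base

_*ᴿ_ : ℝ → ℝ → ℝ
mkℝ x cx *ᴿ mkℝ y cy = mkℝ (λ n → x n * y n) λ ε 0<ε →
  let (Bx , 0<Bx , Mx , bx) = eventually-bounded x cx
      (By , 0<By , My , by) = eventually-bounded y cy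
      ex = inv By 0<By * (½ * ε)
      ey = inv Bx 0<Bx * (½ * ε)
      (Nx , hx) = cx ex (*-pos (inv-pos By 0<By) (half-pos 0<ε))
      (Ny , hy) = cy ey (*-pos (inv-pos Bx 0<Bx) (half-pos 0<ε))
      N₁ = Mx ℕ.⊔ My
      N₂ = Nx ℕ.⊔ Ny
  in N₁ ℕ.⊔ N₂ , λ m n le₁ le₂ →
    let le₁₁ = ℕ.m⊔n≤o⇒m≤o N₁ N₂ le₁
        le₁₂ = ℕ.m⊔n≤o⇒n≤o N₁ N₂ le₁
        le₂₁ = ℕ.m⊔n≤o⇒m≤o N₁ N₂ le₂
        le₂₂ = ℕ.m⊔n≤o⇒n≤o N₁ N₂ le₂
        dx = hx m n (ℕ.m⊔n≤o⇒m≤o Nx Ny le₁₂) (ℕ.m⊔n≤o⇒m≤o Nx Ny le₂₂)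
        dy = hy m n (ℕ.m⊔n≤o⇒n≤o Nx Ny le₁₂) (ℕ.m⊔n≤o⇒n≤o Nx Ny le₂₂)
    in begin-strict
    ∣ x m * y m - x n * y n ∣                         ≡⟨ cong ∣_∣ (split (x m) (y m) (x n) (y n)) ⟩
    ∣ x m * (y m - y n) + y n * (x m - x n) ∣         ≤⟨ ℚ.∣p+q∣≤∣p∣+∣q∣ (x m * (y m - y n)) (y n * (x m - x n)) ⟩
    ∣ x m * (y m - y n) ∣ + ∣ y n * (x m - x n) ∣     <⟨ +-<-halves
      (scale Bx 0<Bx (x m) (y m - y n) (bx m (ℕ.m⊔n≤o⇒m≤o Mx My le₁₁)) dy)
      (scale By 0<By (y n) (x m - x n) (by n (ℕ.m⊔n≤o⇒n≤o Mx My le₂₁)) dx) ⟩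
    ε                                                 ∎
  where
  open Data.Rational.Base
  open ℚ.≤-Reasoning
  inv : ∀ p → 0ℚ < p → ℚ
  inv p 0<p = (1/ p) {{>-nonZero 0<p}}
  inv-pos : ∀ p 0<p → 0ℚ < inv p 0<p
  inv-pos p 0<p = ℚ.positive⁻¹ (inv p 0<p) {{ℚ.1/pos⇒pos p {{positive 0<p}}}}
  split : ∀ a b c d → a * b - c * d ≡ a * (b - d) + d * (a - c)
  split = solve 4 (λ a b c d → a :* b :- c :* d := a :* (b :- d) :+ d :* (a :- c)) refl
    where open +-*-Solver
  scale : ∀ B (0<B : 0ℚ < B) u v {ε} → ∣ u ∣ ≤ B → ∣ v ∣ < inv B 0<B * ε → ∣ u * v ∣ < ε
  scale B 0<B u v {ε} u≤B v<ε = begin-strict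
    ∣ u * v ∣                 ≡⟨ ℚ.∣p*q∣≡∣p∣*∣q∣ u v ⟩
    ∣ u ∣ * ∣ v ∣             ≤⟨ ℚ.*-monoʳ-≤-nonNeg ∣ v ∣ {{nonNegative (ℚ.0≤∣p∣ v)}} u≤B ⟩
    B * ∣ v ∣                 <⟨ ℚ.*-monoʳ-<-pos B {{positive 0<B}} v<ε ⟩
    B * (inv B 0<B * ε)       ≡⟨ ℚ.*-assoc B (inv B 0<B) ε ⟨
    B * inv B 0<B * ε         ≡⟨ cong (_* ε) (ℚ.*-inverseʳ B {{>-nonZero 0<B}}) ⟩
    1ℚ * ε                    ≡⟨ ℚ.*-identityˡ ε ⟩
    ε                         ∎

module _ where
  ⊔-pos : ∀ p {q} → 0ℚ ℚ.< q → 0ℚ ℚ.< p ℚ.⊔ q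
  ⊔-pos p {q} 0<q = ℚ.<-≤-trans 0<q (ℚ.p≤q⊔p p q)

-- If seq x n ≥ δ > 0 for all large n, then taking the maximum with δ changes
-- only finitely many terms, and keeps every term invertible.
recip : ∀ x → 0ᴿ <ᴿ x → ℝ
recip (mkℝ x cx) (δ , 0<δ , N , δ≤x) = mkℝ r λ ε 0<ε →
  let (M , h) = cx (ε * (δ * δ)) (*-pos 0<ε (*-pos 0<δ 0<δ))
  in N ℕ.⊔ M , λ m n le₁ le₂ →
    let um = ℚ.p≤q⊔p (x m) δ
        un = ℚ.p≤q⊔p (x n) δ
        uu = *-mono-nonNeg (ℚ.<⇒≤ 0<δ) (ℚ.<⇒≤ (⊔-pos (x n) 0<δ)) um un
        pos = *-pos (⊔-pos (x m) 0<δ) (⊔-pos (x n) 0<δ)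
    in ℚ.*-cancelʳ-<-nonNeg (u m * u n) {{nonNegative (ℚ.<⇒≤ pos)}} (begin-strict
    ∣ r m - r n ∣ * (u m * u n)         ≡⟨ cong (∣ r m - r n ∣ *_) (ℚ.0≤p⇒∣p∣≡p (ℚ.<⇒≤ pos)) ⟨
    ∣ r m - r n ∣ * ∣ u m * u n ∣       ≡⟨ ℚ.∣p*q∣≡∣p∣*∣q∣ (r m - r n) (u m * u n) ⟨
    ∣ (r m - r n) * (u m * u n) ∣       ≡⟨ cong ∣_∣ (clear m n) ⟩
    ∣ u n - u m ∣                       ≡⟨ cong₂ (λ p q → ∣ p - q ∣)
                                            (u≡x n (ℕ.m⊔n≤o⇒m≤o N M le₂)) (u≡x m (ℕ.m⊔n≤o⇒m≤o N M le₁)) ⟩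
    ∣ x n - x m ∣                       <⟨ h n m (ℕ.m⊔n≤o⇒n≤o N M le₂) (ℕ.m⊔n≤o⇒n≤o N M le₁) ⟩
    ε * (δ * δ)                         ≤⟨ ℚ.*-monoˡ-≤-nonNeg ε {{nonNegative (ℚ.<⇒≤ 0<ε)}} uu ⟩
    ε * (u m * u n)                     ∎)
  where
  open Data.Rational.Base
  open ℚ.≤-Reasoning
  u : ℕ → ℚ
  u n = x n ⊔ δ
  r : ℕ → ℚ
  r n = (1/ u n) {{>-nonZero (⊔-pos (x n) 0<δ)}}
  u≡x : ∀ n → N ℕ.≤ n → u n ≡ x n
  u≡x n le = ℚ.p≥q⇒p⊔q≡p (subst (_≤ x n) (ℚ.+-identityˡ δ) (δ≤x n le))
  clear : ∀ m n → (r m - r n) * (u m * u n) ≡ u n - u m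
  clear m n = trans
    (solve 4 (λ a b c d → (a :- b) :* (c :* d) := (a :* c) :* d :- (b :* d) :* c) refl (r m) (r n) (u m) (u n))
    (cong₂ _-_
      (trans (cong (_* u n) (ℚ.*-inverseˡ (u m) {{>-nonZero (⊔-pos (x m) 0<δ)}})) (ℚ.*-identityˡ (u n)))
      (trans (cong (_* u m) (ℚ.*-inverseˡ (u n) {{>-nonZero (⊔-pos (x n) 0<δ)}})) (ℚ.*-identityˡ (u m))))
    where open +-*-Solver

infixl 7 _÷ᴿ_[_]

_÷ᴿ_[_] : ℝ → (y : ℝ) → 0ᴿ <ᴿ y → ℝ
x ÷ᴿ y [ 0<y ] = x *ᴿ recip y 0<y

*ᴿ-pos : ∀ x y → 0ᴿ <ᴿ x → 0ᴿ <ᴿ y → 0ᴿ <ᴿ x *ᴿ y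
*ᴿ-pos (mkℝ x _) (mkℝ y _) (δ , 0<δ , M , hx) (η , 0<η , N , hy) =
  δ * η , *-pos 0<δ 0<η , M ℕ.⊔ N , λ n le →
    let dx = subst (_≤ x n) (ℚ.+-identityˡ δ) (hx n (ℕ.m⊔n≤o⇒m≤o M N le))
        dy = subst (_≤ y n) (ℚ.+-identityˡ η) (hy n (ℕ.m⊔n≤o⇒n≤o M N le))
    in subst (_≤ x n * y n) (sym (ℚ.+-identityˡ (δ * η)))
         (*-mono-nonNeg (ℚ.<⇒≤ 0<δ) (ℚ.≤-trans (ℚ.<⇒≤ 0<η) dy) dx dy)
  where open Data.Rational.Base

module _ where
  -- Both π and √ are given by sequences s satisfying the hypothesis below.
  module OneSided (s : ℕ → ℚ) (C : ℕ)
    (bound : ∀ k m → s k ℚ.≤ s m ℚ.+ (+ C) ℚ./ suc m) where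

    isCauchy : IsCauchy s
    isCauchy ε 0<ε with archimedean C 0<ε
    ... | N , small = N , λ m n le₁ le₂ → ∣-∣< {s m} {s n}
      (ℚ.≤-<-trans (bound m n) (ℚ.+-monoʳ-< (s n) (small n le₂)))
      (ℚ.≤-<-trans (bound n m) (ℚ.+-monoʳ-< (s m) (small m le₁)))

    isPositive : ∀ k → 0ℚ ℚ.< s k → 0ᴿ <ᴿ mkℝ s isCauchy
    isPositive k 0<sk with archimedean C (half-pos 0<sk)
    ... | N , small = ½ ℚ.* s k , half-pos 0<sk , N , λ n le → begin
      0ℚ + ½ * s k
        ≡⟨ solve 1 (λ x → con 0ℚ :+ con ½ :* x := x :- con ½ :* x) refl (s k) ⟩
      s k - ½ * s k
        ≤⟨ ℚ.+-monoˡ-≤ (- (½ * s k)) (ℚ.≤-trans (bound k n) (ℚ.+-monoʳ-≤ (s n) (ℚ.<⇒≤ (small n le)))) ⟩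
      (s n + ½ * s k) - ½ * s k
        ≡⟨ solve 2 (λ x y → (x :+ y) :- y := x) refl (s n) (½ * s k) ⟩
      s n ∎
      where
      open Data.Rational.Base
      open ℚ.≤-Reasoning
      open +-*-Solver

⌊√⌋-step : ℕ → ℕ → ℕ
⌊√⌋-step r m with suc r ℕ.* suc r ℕ.≤? m
... | yes _ = suc r
... | no  _ = r

-- The largest r with r * r ≤ m.
⌊√_⌋ : ℕ → ℕ
⌊√ zero ⌋  = 0
⌊√ suc m ⌋ = ⌊√⌋-step ⌊√ m ⌋ (suc m)

⌊√⌋-lower : ∀ m → ⌊√ m ⌋ ℕ.* ⌊√ m ⌋ ℕ.≤ m
⌊√⌋-lower zero = z≤n
⌊√⌋-lower (suc m) with suc ⌊√ m ⌋ ℕ.* suc ⌊√ m ⌋ ℕ.≤? suc m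
... | yes le = le
... | no  _  = ℕ.m≤n⇒m≤1+n (⌊√⌋-lower m)

⌊√⌋-upper : ∀ m → m ℕ.< suc ⌊√ m ⌋ ℕ.* suc ⌊√ m ⌋
⌊√⌋-upper zero = s≤s z≤n
⌊√⌋-upper (suc m) with suc ⌊√ m ⌋ ℕ.* suc ⌊√ m ⌋ ℕ.≤? suc m
... | yes _  = let r = suc ⌊√ m ⌋ in
  ℕ.≤-<-trans (⌊√⌋-upper m) (ℕ.*-mono-< {r} {suc r} {r} {suc r} (ℕ.n<1+n r) (ℕ.n<1+n r))
... | no  ¬p = ℕ.≰⇒> ¬p

-- √ D is the limit of ⌊n √D⌋ / n.
√-seq : ℕ → ℕ → ℚ
√-seq D k = + ⌊√ D ℕ.* (suc k ℕ.* suc k) ⌋ ℚ./ suc k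

module _ where
  square-cancel-< : ∀ {m n} → m ℕ.* m ℕ.< n ℕ.* n → m ℕ.< n
  square-cancel-< {m} {n} lt with m ℕ.<? n
  ... | yes p = p
  ... | no ¬p = contradiction lt (ℕ.≤⇒≯ (ℕ.*-mono-≤ (ℕ.≮⇒≥ ¬p) (ℕ.≮⇒≥ ¬p)))

  √-bound : ∀ D k m → √-seq D k ℚ.≤ √-seq D m ℚ.+ (+ 1) ℚ./ suc m
  √-bound D k m = subst (√-seq D k ℚ.≤_) (/-+ t 1 m)
    (/-cross-≤ r k (t ℕ.+ 1) m (ℕ.<⇒≤ (square-cancel-< (begin-strict
      (r ℕ.* m′) ℕ.* (r ℕ.* m′)                       ≡⟨ sq r m′ ⟩
      (r ℕ.* r) ℕ.* (m′ ℕ.* m′)                       ≤⟨ ℕ.*-monoˡ-≤ (m′ ℕ.* m′) (⌊√⌋-lower (D ℕ.* (k′ ℕ.* k′))) ⟩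
      D ℕ.* (k′ ℕ.* k′) ℕ.* (m′ ℕ.* m′)               ≡⟨ swap D (k′ ℕ.* k′) (m′ ℕ.* m′) ⟩
      D ℕ.* (m′ ℕ.* m′) ℕ.* (k′ ℕ.* k′)               <⟨ ℕ.*-monoˡ-< (k′ ℕ.* k′) (⌊√⌋-upper (D ℕ.* (m′ ℕ.* m′))) ⟩
      (suc t ℕ.* suc t) ℕ.* (k′ ℕ.* k′)               ≡⟨ sq (suc t) k′ ⟨
      (suc t ℕ.* k′) ℕ.* (suc t ℕ.* k′)               ≡⟨ cong (λ s → (s ℕ.* k′) ℕ.* (s ℕ.* k′)) (ℕ.+-comm 1 t) ⟩
      ((t ℕ.+ 1) ℕ.* k′) ℕ.* ((t ℕ.+ 1) ℕ.* k′)       ∎))))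
    where
    open ℕ.≤-Reasoning
    k′ = suc k
    m′ = suc m
    r = ⌊√ D ℕ.* (k′ ℕ.* k′) ⌋
    t = ⌊√ D ℕ.* (m′ ℕ.* m′) ⌋
    sq : ∀ a b → (a ℕ.* b) ℕ.* (a ℕ.* b) ≡ (a ℕ.* a) ℕ.* (b ℕ.* b)
    sq = solve-∀
    swap : ∀ a b c → a ℕ.* b ℕ.* c ≡ a ℕ.* c ℕ.* b
    swap = solve-∀

√ : ℕ → ℝ
√ D = mkℝ (√-seq D) (OneSided.isCauchy (√-seq D) 1 (√-bound D))

√-pos : ∀ D → 0 ℕ.< D → 0ᴿ <ᴿ √ D
√-pos D 0<D = OneSided.isPositive (√-seq D) 1 (√-bound D) 0
  (ℚ.<-≤-trans (ℚ.positive⁻¹ ℚ.1ℚ)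
    (/-cross-≤ 1 0 ⌊√ D ℕ.* 1 ⌋ 0 (subst (1 ℕ.≤_) (sym (ℕ.*-identityʳ _)) root≥1)))
  where
  root≥1 : 1 ℕ.≤ ⌊√ D ℕ.* 1 ⌋
  root≥1 with ⌊√ D ℕ.* 1 ⌋ in eq
  ... | suc _ = s≤s z≤n
  ... | zero  = contradiction
    (subst (λ r → D ℕ.* 1 ℕ.< suc r ℕ.* suc r) eq (⌊√⌋-upper (D ℕ.* 1)))
    (ℕ.≤⇒≯ (subst (1 ℕ.≤_) (sym (ℕ.*-identityʳ D)) 0<D))

∑< : ℕ → (ℕ → ℕ) → ℕ
∑< zero    f = 0
∑< (suc n) f = ∑< n f ℕ.+ f n

inDisc : ℕ → ℕ → ℕ → ℕ
inDisc n i j with i ℕ.* i ℕ.+ j ℕ.* j ℕ.≤? n ℕ.* n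
... | yes _ = 1
... | no  _ = 0

-- The number of cells [i,i+1] × [j,j+1] with i, j < n that lie in the quarter
-- disc x² + y² ≤ n², x, y ≥ 0.
quarterCount : ℕ → ℕ
quarterCount n = ∑< n λ i → ∑< n λ j → inDisc n (suc i) (suc j)

-- π is the area of the unit disc, the limit of 4 * quarterCount n / n².
π-seq : ℕ → ℚ
π-seq k = + (4 ℕ.* quarterCount (suc k)) ℚ./ (suc k ℕ.* suc k)

module _ where
  ∑-mono : ∀ n {f g} → (∀ i → i ℕ.< n → f i ℕ.≤ g i) → ∑< n f ℕ.≤ ∑< n g
  ∑-mono zero    le = z≤n
  ∑-mono (suc n) le = ℕ.+-mono-≤ (∑-mono n (λ i i<n → le i (ℕ.m<n⇒m<1+n i<n))) (le n ℕ.≤-refl)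

  ∑-const : ∀ n c → ∑< n (λ _ → c) ≡ n ℕ.* c
  ∑-const zero    c = refl
  ∑-const (suc n) c = trans (cong (ℕ._+ c) (∑-const n c)) (ℕ.+-comm (n ℕ.* c) c)

  ∑-*ʳ : ∀ n f c → ∑< n (λ i → f i ℕ.* c) ≡ ∑< n f ℕ.* c
  ∑-*ʳ zero    f c = refl
  ∑-*ʳ (suc n) f c = trans (cong (ℕ._+ f n ℕ.* c) (∑-*ʳ n f c)) (sym (ℕ.*-distribʳ-+ c (∑< n f) (f n)))

  ∑-+ : ∀ n f g → ∑< n (λ i → f i ℕ.+ g i) ≡ ∑< n f ℕ.+ ∑< n g
  ∑-+ zero    f g = refl
  ∑-+ (suc n) f g = trans (cong (ℕ._+ (f n ℕ.+ g n)) (∑-+ n f g)) (re (∑< n f) (∑< n g) (f n) (g n))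
    where
    re : ∀ a b c d → a ℕ.+ b ℕ.+ (c ℕ.+ d) ≡ a ℕ.+ c ℕ.+ (b ℕ.+ d)
    re = solve-∀

  ∑-cong : ∀ n {f g} → (∀ i → f i ≡ g i) → ∑< n f ≡ ∑< n g
  ∑-cong zero    eq = refl
  ∑-cong (suc n) eq = cong₂ ℕ._+_ (∑-cong n eq) (eq n)

  ∑-shift : ∀ n f → ∑< (suc n) f ≡ f 0 ℕ.+ ∑< n (λ i → f (suc i))
  ∑-shift zero    f = ℕ.+-comm 0 (f 0)
  ∑-shift (suc n) f = trans (cong (ℕ._+ f (suc n)) (∑-shift n f)) (ℕ.+-assoc (f 0) _ (f (suc n)))

  ∑-append : ∀ m n f → ∑< (m ℕ.+ n) f ≡ ∑< m f ℕ.+ ∑< n (λ i → f (m ℕ.+ i))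
  ∑-append m zero    f = trans (cong (λ k → ∑< k f) (ℕ.+-identityʳ m)) (sym (ℕ.+-identityʳ _))
  ∑-append m (suc n) f = trans (cong (λ k → ∑< k f) (ℕ.+-suc m n))
    (trans (cong (ℕ._+ f (m ℕ.+ n)) (∑-append m n f)) (ℕ.+-assoc (∑< m f) _ _))

  ∑-block : ∀ k m f → ∑< (k ℕ.* m) f ≡ ∑< k (λ i → ∑< m (λ p → f (i ℕ.* m ℕ.+ p)))
  ∑-block zero    m f = refl
  ∑-block (suc k) m f = trans (cong (λ l → ∑< l f) (ℕ.+-comm m (k ℕ.* m)))
    (trans (∑-append (k ℕ.* m) m f) (cong (ℕ._+ ∑< m (λ p → f (k ℕ.* m ℕ.+ p))) (∑-block k m f)))

  ∑-block₂ : ∀ k m (f : ℕ → ℕ → ℕ) →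
    ∑< (k ℕ.* m) (λ u → ∑< (k ℕ.* m) (f u)) ≡
    ∑< k (λ i → ∑< k (λ j → ∑< m (λ p → ∑< m (λ q → f (i ℕ.* m ℕ.+ p) (j ℕ.* m ℕ.+ q)))))
  ∑-block₂ k m f = trans (∑-block k m _) (∑-cong k λ i →
    trans (∑-cong m λ p → ∑-block k m (f (i ℕ.* m ℕ.+ p)))
      (swap m k λ p j → ∑< m (λ q → f (i ℕ.* m ℕ.+ p) (j ℕ.* m ℕ.+ q))))
    where
    swap : ∀ m k (g : ℕ → ℕ → ℕ) → ∑< m (λ p → ∑< k (g p)) ≡ ∑< k (λ j → ∑< m (λ p → g p j))
    swap zero    k g = sym (trans (∑-const k 0) (ℕ.*-zeroʳ k))
    swap (suc m) k g = trans (cong (ℕ._+ ∑< k (g m)) (swap m k g)) (sym (∑-+ k _ (g m)))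

  ∑-const₂ : ∀ m c → ∑< m (λ _ → ∑< m (λ _ → c)) ≡ c ℕ.* (m ℕ.* m)
  ∑-const₂ m c = trans (∑-cong m λ _ → ∑-const m c) (trans (∑-const m (m ℕ.* c)) (re m c))
    where
    re : ∀ m c → m ℕ.* (m ℕ.* c) ≡ c ℕ.* (m ℕ.* m)
    re = solve-∀

  ∑-*ʳ₂ : ∀ k (f : ℕ → ℕ → ℕ) c →
    ∑< k (λ i → ∑< k (λ j → f i j ℕ.* c)) ≡ ∑< k (λ i → ∑< k (f i)) ℕ.* c
  ∑-*ʳ₂ k f c = trans (∑-cong k λ i → ∑-*ʳ k (f i) c) (∑-*ʳ k _ c)

  inDisc≤1 : ∀ n i j → inDisc n i j ℕ.≤ 1
  inDisc≤1 n i j with i ℕ.* i ℕ.+ j ℕ.* j ℕ.≤? n ℕ.* n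
  ... | yes _ = ℕ.≤-refl
  ... | no  _ = z≤n

  inDisc-mono : ∀ n i j n′ i′ j′ →
    (i ℕ.* i ℕ.+ j ℕ.* j ℕ.≤ n ℕ.* n → i′ ℕ.* i′ ℕ.+ j′ ℕ.* j′ ℕ.≤ n′ ℕ.* n′) →
    inDisc n i j ℕ.≤ inDisc n′ i′ j′
  inDisc-mono n i j n′ i′ j′ f
    with i ℕ.* i ℕ.+ j ℕ.* j ℕ.≤? n ℕ.* n | i′ ℕ.* i′ ℕ.+ j′ ℕ.* j′ ℕ.≤? n′ ℕ.* n′
  ... | no  _ | _      = z≤n
  ... | yes _ | yes _  = ℕ.≤-refl
  ... | yes p | no ¬p′ = contradiction (f p) ¬p′

  -- The number of cells as above, i, j < n, that meet the quarter disc.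
  outerCount : ℕ → ℕ
  outerCount n = ∑< n λ i → ∑< n λ j → inDisc n i j

  quarter≤outer : ∀ n → quarterCount n ℕ.≤ outerCount n
  quarter≤outer n = ∑-mono n λ i _ → ∑-mono n λ j _ →
    inDisc-mono n (suc i) (suc j) n i j λ le →
      ℕ.≤-trans (ℕ.+-mono-≤ (ℕ.*-mono-≤ (ℕ.n≤1+n i) (ℕ.n≤1+n i)) (ℕ.*-mono-≤ (ℕ.n≤1+n j) (ℕ.n≤1+n j))) le

  scale-sq : ∀ i j m → (i ℕ.* m) ℕ.* (i ℕ.* m) ℕ.+ (j ℕ.* m) ℕ.* (j ℕ.* m)
                     ≡ (i ℕ.* i ℕ.+ j ℕ.* j) ℕ.* (m ℕ.* m)
  scale-sq = solve-∀

  scale-sq₁ : ∀ i m → (i ℕ.* m) ℕ.* (i ℕ.* m) ≡ (i ℕ.* i) ℕ.* (m ℕ.* m)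
  scale-sq₁ = solve-∀

  quarter-refine : ∀ k m → quarterCount k ℕ.* (m ℕ.* m) ℕ.≤ quarterCount (k ℕ.* m)
  quarter-refine k m = begin
    quarterCount k ℕ.* (m ℕ.* m)
      ≡⟨ ∑-*ʳ₂ k _ (m ℕ.* m) ⟨
    ∑< k (λ i → ∑< k (λ j → inDisc k (suc i) (suc j) ℕ.* (m ℕ.* m)))
      ≡⟨ (∑-cong k λ i → ∑-cong k λ j → ∑-const₂ m (inDisc k (suc i) (suc j))) ⟨
    ∑< k (λ i → ∑< k (λ j → ∑< m (λ p → ∑< m (λ q → inDisc k (suc i) (suc j)))))
      ≤⟨ (∑-mono k λ i _ → ∑-mono k λ j _ → ∑-mono m λ p p<m → ∑-mono m λ q q<m →
            inDisc-mono k (suc i) (suc j) (k ℕ.* m) _ _ λ le → begin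
              (suc (i ℕ.* m ℕ.+ p)) ℕ.* (suc (i ℕ.* m ℕ.+ p)) ℕ.+ (suc (j ℕ.* m ℕ.+ q)) ℕ.* (suc (j ℕ.* m ℕ.+ q))
                ≤⟨ ℕ.+-mono-≤ (ℕ.*-mono-≤ (corner i p p<m) (corner i p p<m)) (ℕ.*-mono-≤ (corner j q q<m) (corner j q q<m)) ⟩
              (suc i ℕ.* m) ℕ.* (suc i ℕ.* m) ℕ.+ (suc j ℕ.* m) ℕ.* (suc j ℕ.* m)
                ≡⟨ scale-sq (suc i) (suc j) m ⟩
              (suc i ℕ.* suc i ℕ.+ suc j ℕ.* suc j) ℕ.* (m ℕ.* m)
                ≤⟨ ℕ.*-monoˡ-≤ (m ℕ.* m) le ⟩
              (k ℕ.* k) ℕ.* (m ℕ.* m)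
                ≡⟨ scale-sq₁ k m ⟨
              (k ℕ.* m) ℕ.* (k ℕ.* m) ∎) ⟩
    ∑< k (λ i → ∑< k (λ j → ∑< m (λ p → ∑< m (λ q →
      inDisc (k ℕ.* m) (suc (i ℕ.* m ℕ.+ p)) (suc (j ℕ.* m ℕ.+ q))))))
      ≡⟨ ∑-block₂ k m (λ u v → inDisc (k ℕ.* m) (suc u) (suc v)) ⟨
    quarterCount (k ℕ.* m) ∎
    where
    open ℕ.≤-Reasoning
    corner : ∀ i p → p ℕ.< m → suc (i ℕ.* m ℕ.+ p) ℕ.≤ suc i ℕ.* m
    corner i p p<m = begin
      suc (i ℕ.* m ℕ.+ p)   ≡⟨ ℕ.+-suc (i ℕ.* m) p ⟨
      i ℕ.* m ℕ.+ suc p     ≤⟨ ℕ.+-monoʳ-≤ (i ℕ.* m) p<m ⟩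
      i ℕ.* m ℕ.+ m         ≡⟨ ℕ.+-comm (i ℕ.* m) m ⟩
      suc i ℕ.* m           ∎

  outer-refine : ∀ k m → outerCount (m ℕ.* suc k) ℕ.≤ outerCount m ℕ.* (suc k ℕ.* suc k)
  outer-refine k m = begin
    outerCount (m ℕ.* k′)
      ≡⟨ ∑-block₂ m k′ (inDisc (m ℕ.* k′)) ⟩
    ∑< m (λ i → ∑< m (λ j → ∑< k′ (λ p → ∑< k′ (λ q →
      inDisc (m ℕ.* k′) (i ℕ.* k′ ℕ.+ p) (j ℕ.* k′ ℕ.+ q)))))
      ≤⟨ (∑-mono m λ i _ → ∑-mono m λ j _ → ∑-mono k′ λ p _ → ∑-mono k′ λ q _ →
            inDisc-mono (m ℕ.* k′) (i ℕ.* k′ ℕ.+ p) (j ℕ.* k′ ℕ.+ q) m i j λ le →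
            ℕ.*-cancelʳ-≤ (i ℕ.* i ℕ.+ j ℕ.* j) (m ℕ.* m) (k′ ℕ.* k′) (begin
              (i ℕ.* i ℕ.+ j ℕ.* j) ℕ.* (k′ ℕ.* k′)
                ≡⟨ scale-sq i j k′ ⟨
              (i ℕ.* k′) ℕ.* (i ℕ.* k′) ℕ.+ (j ℕ.* k′) ℕ.* (j ℕ.* k′)
                ≤⟨ ℕ.+-mono-≤ (ℕ.*-mono-≤ (ℕ.m≤m+n (i ℕ.* k′) p) (ℕ.m≤m+n (i ℕ.* k′) p))
                              (ℕ.*-mono-≤ (ℕ.m≤m+n (j ℕ.* k′) q) (ℕ.m≤m+n (j ℕ.* k′) q)) ⟩
              (i ℕ.* k′ ℕ.+ p) ℕ.* (i ℕ.* k′ ℕ.+ p) ℕ.+ (j ℕ.* k′ ℕ.+ q) ℕ.* (j ℕ.* k′ ℕ.+ q)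
                ≤⟨ le ⟩
              (m ℕ.* k′) ℕ.* (m ℕ.* k′)
                ≡⟨ scale-sq₁ m k′ ⟩
              (m ℕ.* m) ℕ.* (k′ ℕ.* k′) ∎)) ⟩
    ∑< m (λ i → ∑< m (λ j → ∑< k′ (λ p → ∑< k′ (λ q → inDisc m i j))))
      ≡⟨ (∑-cong m λ i → ∑-cong m λ j → ∑-const₂ k′ (inDisc m i j)) ⟩
    ∑< m (λ i → ∑< m (λ j → inDisc m i j ℕ.* (k′ ℕ.* k′)))
      ≡⟨ ∑-*ʳ₂ m _ (k′ ℕ.* k′) ⟩
    outerCount m ℕ.* (k′ ℕ.* k′) ∎
    where
    open ℕ.≤-Reasoning
    k′ = suc k

  outer≤quarter : ∀ n → outerCount (suc n) ℕ.≤ quarterCount (suc n) ℕ.+ 2 ℕ.* suc n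
  outer≤quarter n = begin
    outerCount n′
      ≡⟨ ∑-shift n _ ⟩
    ∑< n′ (inDisc n′ 0) ℕ.+ ∑< n (λ i → ∑< n′ (inDisc n′ (suc i)))
      ≤⟨ ℕ.+-mono-≤ (edge 0) (∑-mono n λ i _ → row i) ⟩
    n′ ℕ.+ ∑< n (λ i → 1 ℕ.+ ∑< n′ (λ j → inDisc n′ (suc i) (suc j)))
      ≡⟨ cong (n′ ℕ.+_) (trans (∑-+ n (λ _ → 1) rest) (cong (ℕ._+ ∑< n rest) (trans (∑-const n 1) (ℕ.*-identityʳ n)))) ⟩
    n′ ℕ.+ (n ℕ.+ ∑< n (λ i → ∑< n′ (λ j → inDisc n′ (suc i) (suc j))))
      ≤⟨ ℕ.+-monoʳ-≤ n′ (ℕ.+-mono-≤ (ℕ.n≤1+n n) (ℕ.m≤m+n _ _)) ⟩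
    n′ ℕ.+ (n′ ℕ.+ quarterCount n′)
      ≡⟨ re n′ (quarterCount n′) ⟩
    quarterCount n′ ℕ.+ 2 ℕ.* n′ ∎
    where
    open ℕ.≤-Reasoning
    n′ = suc n
    rest = λ i → ∑< n′ (λ j → inDisc n′ (suc i) (suc j))
    re : ∀ a b → a ℕ.+ (a ℕ.+ b) ≡ b ℕ.+ 2 ℕ.* a
    re = solve-∀
    edge : ∀ i → ∑< n′ (inDisc n′ i) ℕ.≤ n′
    edge i = ℕ.≤-trans (∑-mono n′ λ j _ → inDisc≤1 n′ i j)
      (ℕ.≤-reflexive (trans (∑-const n′ 1) (ℕ.*-identityʳ n′)))
    row : ∀ i → ∑< n′ (inDisc n′ (suc i)) ℕ.≤ 1 ℕ.+ ∑< n′ (λ j → inDisc n′ (suc i) (suc j))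
    row i = begin
      ∑< n′ (inDisc n′ (suc i))
        ≡⟨ ∑-shift n _ ⟩
      inDisc n′ (suc i) 0 ℕ.+ ∑< n (λ j → inDisc n′ (suc i) (suc j))
        ≤⟨ ℕ.+-mono-≤ (inDisc≤1 n′ (suc i) 0) (ℕ.m≤m+n _ _) ⟩
      1 ℕ.+ ∑< n′ (λ j → inDisc n′ (suc i) (suc j)) ∎

  quarter-compare : ∀ k m →
    quarterCount (suc k) ℕ.* (suc m ℕ.* suc m) ℕ.≤
    (quarterCount (suc m) ℕ.+ 2 ℕ.* suc m) ℕ.* (suc k ℕ.* suc k)
  quarter-compare k m = begin
    quarterCount k′ ℕ.* (m′ ℕ.* m′)   ≤⟨ quarter-refine k′ m′ ⟩
    quarterCount (k′ ℕ.* m′)          ≤⟨ quarter≤outer (k′ ℕ.* m′) ⟩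
    outerCount (k′ ℕ.* m′)            ≡⟨ cong outerCount (ℕ.*-comm k′ m′) ⟩
    outerCount (m′ ℕ.* k′)            ≤⟨ outer-refine k m′ ⟩
    outerCount m′ ℕ.* (k′ ℕ.* k′)     ≤⟨ ℕ.*-monoˡ-≤ (k′ ℕ.* k′) (outer≤quarter m) ⟩
    (quarterCount m′ ℕ.+ 2 ℕ.* m′) ℕ.* (k′ ℕ.* k′) ∎
    where
    open ℕ.≤-Reasoning
    k′ = suc k
    m′ = suc m

  π-bound : ∀ k m → π-seq k ℚ.≤ π-seq m ℚ.+ (+ 8) ℚ./ suc m
  π-bound k m = begin
    π-seq k
      ≤⟨ /-cross-≤ (4 ℕ.* A) (k ℕ.+ k ℕ.* k′) (4 ℕ.* B ℕ.+ 8 ℕ.* m′) (m ℕ.+ m ℕ.* m′) step ⟩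
    + (4 ℕ.* B ℕ.+ 8 ℕ.* m′) / (m′ ℕ.* m′)
      ≡⟨ /-+ (4 ℕ.* B) (8 ℕ.* m′) (m ℕ.+ m ℕ.* m′) ⟩
    π-seq m + (+ (8 ℕ.* m′)) / (m′ ℕ.* m′)
      ≤⟨ ℚ.+-monoʳ-≤ (π-seq m) (/-cross-≤ (8 ℕ.* m′) (m ℕ.+ m ℕ.* m′) 8 m
           (ℕ.≤-reflexive (ℕ.*-assoc 8 m′ m′))) ⟩
    π-seq m + (+ 8) / suc m ∎
    where
    open Data.Rational.Base
    open ℚ.≤-Reasoning
    k′ = suc k
    m′ = suc m
    A = quarterCount k′
    B = quarterCount m′
    re : ∀ b m k → 4 ℕ.* ((b ℕ.+ 2 ℕ.* m) ℕ.* (k ℕ.* k)) ≡ (4 ℕ.* b ℕ.+ 8 ℕ.* m) ℕ.* (k ℕ.* k)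
    re = solve-∀
    step : 4 ℕ.* A ℕ.* (m′ ℕ.* m′) ℕ.≤ (4 ℕ.* B ℕ.+ 8 ℕ.* m′) ℕ.* (k′ ℕ.* k′)
    step = subst₂ ℕ._≤_ (sym (ℕ.*-assoc 4 A (m′ ℕ.* m′))) (re B m′ k′)
      (ℕ.*-monoʳ-≤ 4 (quarter-compare k m))

π : ℝ
π = mkℝ π-seq (OneSided.isCauchy π-seq 8 π-bound)

π-pos : 0ᴿ <ᴿ π
π-pos = OneSided.isPositive π-seq 8 π-bound 1 (ℚ.positive⁻¹ (π-seq 1))

record Triangle (a b c : ℕ) : Set where
  constructor triangle
  field
    a<b+c : a ℕ.< b ℕ.+ c
    b<a+c : b ℕ.< a ℕ.+ c
    c<a+b : c ℕ.< a ℕ.+ b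

-- No truncation occurs for the sides of a triangle.
discriminant : ℕ → ℕ → ℕ → ℕ
discriminant a b c =
  (2 ℕ.* a ℕ.* b ℕ.+ 2 ℕ.* a ℕ.* c ℕ.+ 2 ℕ.* b ℕ.* c) ℕ.∸ (a ℕ.* a ℕ.+ b ℕ.* b ℕ.+ c ℕ.* c)

discriminant-pos : ∀ {a b c} → Triangle a b c → 0 ℕ.< discriminant a b c
discriminant-pos {zero} {b} {c} (triangle _ b<c c<b) = contradiction c<b (ℕ.<-asym b<c)
discriminant-pos {a@(suc _)} {b} {c} (triangle a<b+c b<a+c c<a+b) = ℕ.m<n⇒0<n∸m (begin-strict
  a ℕ.* a ℕ.+ b ℕ.* b ℕ.+ c ℕ.* c
    <⟨ ℕ.+-mono-<-≤ (ℕ.+-mono-<-≤ (ℕ.*-monoʳ-< a a<b+c) (ℕ.*-monoʳ-≤ b (ℕ.<⇒≤ b<a+c)))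
                    (ℕ.*-monoʳ-≤ c (ℕ.<⇒≤ c<a+b)) ⟩
  a ℕ.* (b ℕ.+ c) ℕ.+ b ℕ.* (a ℕ.+ c) ℕ.+ c ℕ.* (a ℕ.+ b)
    ≡⟨ re a b c ⟩
  2 ℕ.* a ℕ.* b ℕ.+ 2 ℕ.* a ℕ.* c ℕ.+ 2 ℕ.* b ℕ.* c ∎)
  where
  open ℕ.≤-Reasoning
  re : ∀ a b c → a ℕ.* (b ℕ.+ c) ℕ.+ b ℕ.* (a ℕ.+ c) ℕ.+ c ℕ.* (a ℕ.+ b)
               ≡ 2 ℕ.* a ℕ.* b ℕ.+ 2 ℕ.* a ℕ.* c ℕ.+ 2 ℕ.* b ℕ.* c
  re = solve-∀

-- a - b + c and b - a + c are written a + c ∸ b and b + c ∸ a so that the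
-- truncated subtraction is exact.
factorialRatio : ℕ → ℕ → ℕ → ℚ
factorialRatio a b c =
  (+ (a ! ℕ.* b ! ℕ.* c !) ℚ./ (x ℕ.* y ℕ.* z))
    {{ℕ.m*n≢0 (x ℕ.* y) z {{ℕ.m*n≢0 x y {{(a ℕ.+ b ℕ.∸ c) ℕ.!≢0}} {{(a ℕ.+ c ℕ.∸ b) ℕ.!≢0}}}} {{(b ℕ.+ c ℕ.∸ a) ℕ.!≢0}}}}
  where
  x = (a ℕ.+ b ℕ.∸ c) !
  y = (a ℕ.+ c ℕ.∸ b) !
  z = (b ℕ.+ c ℕ.∸ a) !

approximation : ∀ a b c → Triangle a b c → ℝ
approximation a b c t =
  (fromℕ (2 ℕ.^ (a ℕ.+ b ℕ.+ c ℕ.+ 1)) ÷ᴿ π *ᴿ √ (discriminant a b c)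
    [ *ᴿ-pos π (√ (discriminant a b c)) π-pos (√-pos (discriminant a b c) (discriminant-pos t)) ])
  *ᴿ fromℚ (factorialRatio a b c)

-- The values of n through which the limit is taken; these are real numbers, as
-- α, β and γ need not be rational.
record Admissible (α β γ : ℝ) : Set where
  field
    n     : ℝ
    n>0   : 0ᴿ <ᴿ n
    a b c : ℕ
    a≃αn  : fromℕ a ≃ᴿ α *ᴿ n
    b≃βn  : fromℕ b ≃ᴿ β *ᴿ n
    c≃γn  : fromℕ c ≃ᴿ γ *ᴿ n

module _ where
  scaled-< : ∀ α β γ n a b c → 0ᴿ <ᴿ n → α <ᴿ β +ᴿ γ →
    fromℕ a ≃ᴿ α *ᴿ n → fromℕ b ≃ᴿ β *ᴿ n → fromℕ c ≃ᴿ γ *ᴿ n → a ℕ.< b ℕ.+ c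
  scaled-< (mkℝ α _) (mkℝ β _) (mkℝ γ _) (mkℝ n _) a b c (η , 0<η , N₁ , hn) (δ , 0<δ , N₂ , hδ) ha hb hc =
    /-cancel-< a (b ℕ.+ c) (subst (A <_) (sym (/-+ b c 0)) A<B+C)
    where
    open Data.Rational.Base
    A = (+ a) / 1
    B = (+ b) / 1
    C = (+ c) / 1
    e = ½ * (½ * (δ * η))
    0<e = half-pos (half-pos (*-pos 0<δ 0<η))
    Na = proj₁ (ha e 0<e)
    Nb = proj₁ (hb e 0<e)
    Nc = proj₁ (hc e 0<e)
    k = N₁ ℕ.+ N₂ ℕ.+ Na ℕ.+ Nb ℕ.+ Nc
    le₄ : N₁ ℕ.+ N₂ ℕ.+ Na ℕ.+ Nb ℕ.≤ k
    le₄ = ℕ.m≤m+n _ Nc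
    le₃ : N₁ ℕ.+ N₂ ℕ.+ Na ℕ.≤ k
    le₃ = ℕ.≤-trans (ℕ.m≤m+n _ Nb) le₄
    le₂ : N₁ ℕ.+ N₂ ℕ.≤ k
    le₂ = ℕ.≤-trans (ℕ.m≤m+n _ Na) le₃
    a<  = ∣-∣<⇒< {A} {α k * n k} (proj₂ (ha e 0<e) k (ℕ.≤-trans (ℕ.m≤n+m Na _) le₃))
    b>  = ∣-∣<⇒> {B} {β k * n k} (proj₂ (hb e 0<e) k (ℕ.≤-trans (ℕ.m≤n+m Nb _) le₄))
    c>  = ∣-∣<⇒> {C} {γ k * n k} (proj₂ (hc e 0<e) k (ℕ.m≤n+m Nc _))
    η≤n : η ≤ n k
    η≤n = subst (_≤ n k) (ℚ.+-identityˡ η) (hn k (ℕ.≤-trans (ℕ.m≤m+n N₁ N₂) le₂))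
    0≤n : 0ℚ ≤ n k
    0≤n = ℚ.≤-trans (ℚ.<⇒≤ 0<η) η≤n
    δ-step : α k + δ ≤ β k + γ k
    δ-step = hδ k (ℕ.≤-trans (ℕ.m≤n+m N₂ N₁) le₂)
    open ℚ.≤-Reasoning
    open +-*-Solver
    A<B+C : A < B + C
    A<B+C = begin-strict
      A
        ≡⟨ solve 2 (λ a e → a := a :+ e :- e) refl A e ⟩
      A + e - e
        <⟨ ℚ.+-monoˡ-< (- e) (ℚ.+-monoˡ-< e a<) ⟩
      α k * n k + e + e - e
        ≡⟨ solve 3 (λ x δ η → x :+ con ½ :* (con ½ :* (δ :* η)) :+ con ½ :* (con ½ :* (δ :* η)) :- con ½ :* (con ½ :* (δ :* η))
             := x :+ δ :* η :- con ½ :* (con ½ :* (δ :* η)) :- con ½ :* (con ½ :* (δ :* η)) :- con ½ :* (con ½ :* (δ :* η))) refl (α k * n k) δ η ⟩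
      α k * n k + δ * η - e - e - e
        ≤⟨ drop₃ (ℚ.+-monoʳ-≤ (α k * n k) (ℚ.*-monoˡ-≤-nonNeg δ {{nonNegative (ℚ.<⇒≤ 0<δ)}} η≤n)) ⟩
      α k * n k + δ * n k - e - e - e
        ≡⟨ cong (λ x → x - e - e - e) (sym (ℚ.*-distribʳ-+ (n k) (α k) δ)) ⟩
      (α k + δ) * n k - e - e - e
        ≤⟨ drop₃ (ℚ.*-monoʳ-≤-nonNeg (n k) {{nonNegative 0≤n}} δ-step) ⟩
      (β k + γ k) * n k - e - e - e
        ≡⟨ cong (λ x → x - e - e - e) (ℚ.*-distribʳ-+ (n k) (β k) (γ k)) ⟩
      β k * n k + γ k * n k - e - e - e
        <⟨ ℚ.+-monoˡ-< (- e) (ℚ.+-monoˡ-< (- e) (ℚ.+-monoˡ-< (- e) (ℚ.+-mono-< b> c>))) ⟩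
      (B + e) + (C + e) - e - e - e
        ≡⟨ solve 3 (λ b c e → (b :+ e) :+ (c :+ e) :- e :- e :- e := (b :+ c) :- e) refl B C e ⟩
      (B + C) - e
        ≤⟨ ℚ.+-monoʳ-≤ (B + C) (ℚ.neg-antimono-≤ (ℚ.<⇒≤ 0<e)) ⟩
      (B + C) + (- 0ℚ)
        ≡⟨ ℚ.+-identityʳ (B + C) ⟩
      B + C ∎
      where
      drop₃ : ∀ {p q} → p ≤ q → p - e - e - e ≤ q - e - e - e
      drop₃ le = ℚ.+-monoˡ-≤ (- e) (ℚ.+-monoˡ-≤ (- e) (ℚ.+-monoˡ-≤ (- e) le))

admissible⇒triangle : ∀ {α β γ} → α <ᴿ β +ᴿ γ → β <ᴿ α +ᴿ γ → γ <ᴿ α +ᴿ β →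
  (i : Admissible α β γ) → let open Admissible i in Triangle a b c
admissible⇒triangle {α} {β} {γ} α<β+γ β<α+γ γ<α+β i = triangle
  (scaled-< α β γ n a b c n>0 α<β+γ a≃αn b≃βn c≃γn)
  (scaled-< β α γ n b a c n>0 β<α+γ b≃βn a≃αn c≃γn)
  (scaled-< γ α β n c a b n>0 γ<α+β c≃γn a≃αn b≃βn)
  where open Admissible i

-- f ∼ g as size → ∞, that is, f - g = o(g).
_∼_as_→∞ : {I : Set} → (I → ℝ) → (I → ℝ) → (I → ℝ) → Set
f ∼ g as size →∞ =
  ∀ ε → 0ℚ ℚ.< ε → ∃[ N ] ∀ i → N ≤ᴿ size i → ∣ f i -ᴿ g i ∣ᴿ ≤ᴿ fromℚ ε *ᴿ ∣ g i ∣ᴿ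

{-# OPTIONS --safe #-}
module Submission where

-- Put a = l + m + e, b = l + n + e, c = m + n + e with e ∈ {0,1}. Then
-- E(a,b,c) is a! b! c! / ((2l+e)! (2m+e)! (2n+e)!) times the sum over
-- j ∈ ℤ + e/2 of the products of the binomial coefficients of orders 2l+e,
-- 2m+e, 2n+e at distance j from their centres. In terms of X = 2l+e+1 etc., the
-- ratio of the terms at offsets (s ± 1)/2 is the product of three factors
-- (X-s)/(X+s), which for small s/X is close to (W-s)/(W+s) with
-- 1/W = 1/X + 1/Y + 1/Z. So the sum is compared with the full sum 2^(W-1) of the
-- binomial coefficients of order W - 1, and Wallis' formula for the four central
-- coefficients gives the asymptotics. Wallis' formula is obtained from the area
-- of the quarter disc by Wästlund's subdivision of the plane into rectangles
-- with sides C(2i,i)/4^i, whose antidiagonals all have area 1.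

-- The factorial quotient is exact, so only the symmetric sum S is estimated. A central coefficient
-- c of order X - 1 satisfies c² X π ≈ 2 * 4^(X-1). Hence three central coefficients times 2^(W-1),
-- divided by the central coefficient of order W - 1, have square about 4 * 4^(x+y+z) / (π² e₂),
-- where x = X - 1 etc. and e₂ = XY + YZ + ZX. With x, y, z in place of X, Y, Z, e₂ is exactly the
-- discriminant.
--
-- Two obstacles shape the proof. The W of the overview is rarely an integer of the right parity,
-- and the terms quadratic in s spoil the upper comparison for large s. So two orders are used: one
-- slightly too small, for which the comparison holds at every offset, and one too large by about a
-- factor 1 + 1/M, for which it holds while M s is at most X, Y and Z. The remaining tail is at most
-- M times the central term on each side, while S grows like a square root of the orders.
--
-- All estimates are in ℕ, each loss being a factor 1 + 1/M. π and the root are replaced by their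
-- k-th approximants; k may depend on the sides, whereas the size demanded of the sides depends on M
-- alone.

open import Defs
open import Data.Fin.Base using (Fin; zero; suc)
import Data.Fin.Properties as Fin
import Data.Integer.Base as ℤ
import Data.Integer.Properties as ℤ
open import Data.List.Base as List using (List; []; _∷_; length; filter; _++_)
open import Data.List.Properties using (filter-++; filter-≐; length-++)
open import Data.Nat.Base
open import Data.Nat.Combinatorics
  using (k![n∸k]!∣n!; nCk≡n!/k![n-k]!; k>n⇒nCk≡0; nCn≡1; nCk+nC[k+1]≡[n+1]C[k+1])
  renaming (_C_ to infixl 8 _C_)
open import Data.Nat.DivMod using (m/n*n≡m)
open import Data.Nat.Properties
open import Data.Nat.Tactic.RingSolver using (solve-∀)
open import Data.Product.Base using (∃-syntax; _×_; _,_; proj₁; proj₂)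
open import Data.Rational.Base as ℚ using (ℚ; 0ℚ; 1ℚ; ½)
import Data.Rational.Properties as ℚ
open import Data.Rational.Solver using (module +-*-Solver)
import Data.Rational.Unnormalised.Base as ℚᵘ
import Data.Rational.Unnormalised.Properties as ℚᵘ
open import Data.Sum.Base using (_⊎_; inj₁; inj₂)
open import Data.Vec.Base as Vec using (Vec; []; _∷_)
open import Data.Vec.Relation.Binary.Pointwise.Inductive as Pointwise using (Pointwise; []; _∷_)
open import Relation.Binary.PropositionalEquality
open import Relation.Nullary.Decidable using (yes; no; _×-dec_; ¬?)
open import Relation.Nullary.Negation using (¬_; contradiction)
open import Relation.Unary using (Decidable)

-- Finite sums

∑-cong-< : ∀ n {f g} → (∀ i → i < n → f i ≡ g i) → ∑< n f ≡ ∑< n g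
∑-cong-< zero    eq = refl
∑-cong-< (suc n) eq =
  cong₂ _+_ (∑-cong-< n λ i i<n → eq i (m<n⇒m<1+n i<n)) (eq n ≤-refl)

∑-*ˡ : ∀ n c f → ∑< n (λ i → c * f i) ≡ c * ∑< n f
∑-*ˡ n c f = trans (∑-cong n λ i → *-comm c (f i)) (trans (∑-*ʳ n f c) (*-comm (∑< n f) c))

∑-reverse : ∀ n f → ∑< n f ≡ ∑< n (λ i → f (n ∸ suc i))
∑-reverse zero    f = refl
∑-reverse (suc n) f = begin
  ∑< n f + f n                                   ≡⟨ cong (_+ f n) (∑-reverse n f) ⟩
  ∑< n (λ i → f (n ∸ suc i)) + f n               ≡⟨ +-comm _ (f n) ⟩
  f n + ∑< n (λ i → f (n ∸ suc i))               ≡⟨ ∑-shift n (λ i → f (n ∸ i)) ⟨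
  ∑< (suc n) (λ i → f (n ∸ i))                   ∎
  where open ≡-Reasoning

∑-extend : ∀ {m n} f → m ≤ n → ∑< m f ≤ ∑< n f
∑-extend {m} {n} f m≤n = begin
  ∑< m f                                   ≤⟨ m≤m+n _ _ ⟩
  ∑< m f + ∑< (n ∸ m) (λ i → f (m + i))    ≡⟨ ∑-append m (n ∸ m) f ⟨
  ∑< (m + (n ∸ m)) f                       ≡⟨ cong (λ k → ∑< k f) (m+[n∸m]≡n m≤n) ⟩
  ∑< n f                                   ∎
  where open ≤-Reasoning

∑-support : ∀ n N {f} → (∀ i → N ≤ i → f i ≡ 0) → ∑< n f ≤ ∑< N f
∑-support n N {f} vanish with ≤-total n N
... | inj₁ n≤N = ∑-extend f n≤N
... | inj₂ N≤n = begin
  ∑< n f                                   ≡⟨ cong (λ k → ∑< k f) (m+[n∸m]≡n N≤n) ⟨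
  ∑< (N + (n ∸ N)) f                       ≡⟨ ∑-append N (n ∸ N) f ⟩
  ∑< N f + ∑< (n ∸ N) (λ i → f (N + i))    ≡⟨ cong (∑< N f +_) (∑-cong (n ∸ N) λ i → vanish (N + i) (m≤m+n N i)) ⟩
  ∑< N f + ∑< (n ∸ N) (λ _ → 0)            ≡⟨ cong (∑< N f +_) (trans (∑-const (n ∸ N) 0) (*-zeroʳ (n ∸ N))) ⟩
  ∑< N f + 0                               ≡⟨ +-identityʳ _ ⟩
  ∑< N f                                   ∎
  where open ≤-Reasoning

-- Adding the sum to its reversal turns the weight `w i` into `w i + w (n ∸ i)`, which is constant
-- when `w` is affine.
∑-symmetrise : ∀ n (w f : ℕ → ℕ) → (∀ i → i ≤ n → f (n ∸ i) ≡ f i) →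
  2 * ∑< (suc n) (λ i → w i * f i) ≡ ∑< (suc n) (λ i → (w i + w (n ∸ i)) * f i)
∑-symmetrise n w f symm = begin
  2 * s                                                            ≡⟨ cong (s +_) (+-identityʳ s) ⟩
  s + s                                                            ≡⟨ cong (s +_) (∑-reverse (suc n) (λ i → w i * f i)) ⟩
  s + ∑< (suc n) (λ i → w (n ∸ i) * f (n ∸ i))                     ≡⟨ cong (s +_) (∑-cong-< (suc n) λ i i<n → cong (w (n ∸ i) *_) (symm i (s≤s⁻¹ i<n))) ⟩
  s + ∑< (suc n) (λ i → w (n ∸ i) * f i)                           ≡⟨ ∑-+ (suc n) _ _ ⟨
  ∑< (suc n) (λ i → w i * f i + w (n ∸ i) * f i)                   ≡⟨ ∑-cong (suc n) (λ i → *-distribʳ-+ (f i) (w i) (w (n ∸ i))) ⟨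
  ∑< (suc n) (λ i → (w i + w (n ∸ i)) * f i)                       ∎
  where
  open ≡-Reasoning
  s = ∑< (suc n) (λ i → w i * f i)

-- Both sides run over the products `f i * f j` with `i + j < N`: by rows on the left, by
-- antidiagonals on the right.
∑-triangle : ∀ N (f : ℕ → ℕ) →
  ∑< N (λ i → f i * ∑< (N ∸ i) f) ≡ ∑< N (λ t → ∑< (suc t) (λ i → f i * f (t ∸ i)))
∑-triangle zero    f = refl
∑-triangle (suc N) f = begin
  ∑< (suc N) (λ i → f i * ∑< (suc N ∸ i) f)
    ≡⟨ (∑-cong-< (suc N) λ i i<N → trans (cong (λ k → f i * ∑< k f) (+-∸-assoc 1 (s≤s⁻¹ i<N)))
         (*-distribˡ-+ (f i) (∑< (N ∸ i) f) (f (N ∸ i)))) ⟩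
  ∑< (suc N) (λ i → f i * ∑< (N ∸ i) f + f i * f (N ∸ i))
    ≡⟨ ∑-+ (suc N) _ _ ⟩
  ∑< N (λ i → f i * ∑< (N ∸ i) f) + f N * ∑< (N ∸ N) f + ∑< (suc N) (λ i → f i * f (N ∸ i))
    ≡⟨ cong (λ k → ∑< N (λ i → f i * ∑< (N ∸ i) f) + f N * ∑< k f + ∑< (suc N) (λ i → f i * f (N ∸ i))) (n∸n≡0 N) ⟩
  ∑< N (λ i → f i * ∑< (N ∸ i) f) + f N * 0 + ∑< (suc N) (λ i → f i * f (N ∸ i))
    ≡⟨ cong (_+ ∑< (suc N) (λ i → f i * f (N ∸ i))) (trans (cong (∑< N (λ i → f i * ∑< (N ∸ i) f) +_) (*-zeroʳ (f N))) (+-identityʳ _)) ⟩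
  ∑< N (λ i → f i * ∑< (N ∸ i) f) + ∑< (suc N) (λ i → f i * f (N ∸ i))
    ≡⟨ cong (_+ ∑< (suc N) (λ i → f i * f (N ∸ i))) (∑-triangle N f) ⟩
  ∑< (suc N) (λ t → ∑< (suc t) (λ i → f i * f (t ∸ i))) ∎
  where open ≡-Reasoning

-- Binomial coefficients

C-! : ∀ k l → (k + l) C k * (k ! * l !) ≡ (k + l) !
C-! k l = begin
  (k + l) C k * (k ! * l !)             ≡⟨ cong (λ r → (k + l) C k * (k ! * r !)) (m+n∸m≡n k l) ⟨
  (k + l) C k * (k ! * (k + l ∸ k) !)   ≡⟨ cong (_* (k ! * (k + l ∸ k) !)) (nCk≡n!/k![n-k]! (m≤m+n k l)) ⟩
  _                                     ≡⟨ m/n*n≡m {{k !* (k + l ∸ k) !≢0}} (k![n∸k]!∣n! (m≤m+n k l)) ⟩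
  (k + l) !                             ∎
  where open ≡-Reasoning

C-step : ∀ k l → (k + suc l) C suc k * suc k ≡ (k + suc l) C k * suc l
C-step k l = *-cancelʳ-≡ _ _ (k ! * l !) {{k !* l !≢0}} (begin
  (k + suc l) C suc k * suc k * (k ! * l !)       ≡⟨ re ((k + suc l) C suc k) (suc k) (k !) (l !) ⟩
  (k + suc l) C suc k * (suc k ! * l !)           ≡⟨ cong (λ n → n C suc k * (suc k ! * l !)) (+-suc k l) ⟩
  (suc k + l) C suc k * (suc k ! * l !)           ≡⟨ C-! (suc k) l ⟩
  (suc k + l) !                                   ≡⟨ cong _! (+-suc k l) ⟨
  (k + suc l) !                                   ≡⟨ C-! k (suc l) ⟨
  (k + suc l) C k * (k ! * suc l !)               ≡⟨ re′ ((k + suc l) C k) (suc l) (k !) (l !) ⟩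
  (k + suc l) C k * suc l * (k ! * l !)           ∎)
  where
  open ≡-Reasoning
  re : ∀ c s k l → c * s * (k * l) ≡ c * ((s * k) * l)
  re = solve-∀
  re′ : ∀ c s k l → c * (k * (s * l)) ≡ c * s * (k * l)
  re′ = solve-∀

C-sym : ∀ k l → (k + l) C k ≡ (k + l) C l
C-sym k l = *-cancelʳ-≡ _ _ (k ! * l !) {{k !* l !≢0}} (begin
  (k + l) C k * (k ! * l !)   ≡⟨ C-! k l ⟩
  (k + l) !                   ≡⟨ cong _! (+-comm k l) ⟩
  (l + k) !                   ≡⟨ C-! l k ⟨
  (l + k) C l * (l ! * k !)   ≡⟨ cong₂ (λ n r → n C l * r) (+-comm l k) (*-comm (l !) (k !)) ⟩
  (k + l) C l * (k ! * l !)   ∎)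
  where open ≡-Reasoning

C-pos : ∀ k l → 0 < (k + l) C k
C-pos k l with (k + l) C k in eq
... | suc _ = z<s
... | zero  = contradiction (trans (sym (C-! k l)) (cong (_* (k ! * l !)) eq)) (λ p → <⇒≢ (n≢0⇒n>0 (≢-nonZero⁻¹ _ {{(k + l) !≢0}})) (sym p))

C-sum : ∀ n → ∑< (suc n) (n C_) ≡ 2 ^ n
C-sum zero    = refl
C-sum (suc n) = begin
  ∑< (suc (suc n)) (suc n C_)
    ≡⟨ ∑-shift (suc n) _ ⟩
  suc n C 0 + ∑< (suc n) (λ k → suc n C suc k)
    ≡⟨ cong (suc n C 0 +_) (∑-cong (suc n) (nCk+nC[k+1]≡[n+1]C[k+1] n)) ⟨
  suc n C 0 + ∑< (suc n) (λ k → n C k + n C suc k)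
    ≡⟨ cong₂ _+_ (trans (C-sym 0 (suc n)) (nCn≡1 (suc n))) (∑-+ (suc n) _ _) ⟩
  1 + (∑< (suc n) (n C_) + (∑< n (λ k → n C suc k) + n C suc n))
    ≡⟨ cong (λ c → 1 + (∑< (suc n) (n C_) + (∑< n (λ k → n C suc k) + c))) (k>n⇒nCk≡0 (n<1+n n)) ⟩
  1 + (∑< (suc n) (n C_) + (∑< n (λ k → n C suc k) + 0))
    ≡⟨ re (∑< (suc n) (n C_)) (∑< n (λ k → n C suc k)) ⟩
  ∑< (suc n) (n C_) + (1 + ∑< n (λ k → n C suc k))
    ≡⟨ cong (λ c → ∑< (suc n) (n C_) + (c + ∑< n (λ k → n C suc k))) (trans (C-sym 0 n) (nCn≡1 n)) ⟨
  ∑< (suc n) (n C_) + (n C 0 + ∑< n (λ k → n C suc k))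
    ≡⟨ cong (∑< (suc n) (n C_) +_) (∑-shift n _) ⟨
  ∑< (suc n) (n C_) + ∑< (suc n) (n C_)
    ≡⟨ cong₂ _+_ (C-sum n) (trans (C-sum n) (sym (+-identityʳ _))) ⟩
  2 ^ suc n ∎
  where
  open ≡-Reasoning
  re : ∀ a b → 1 + (a + (b + 0)) ≡ a + (1 + b)
  re = solve-∀

-- Wallis' formula

centralBinomial : ℕ → ℕ
centralBinomial n = (n + n) C n

centralBinomial-suc : ∀ n → suc n * centralBinomial (suc n) ≡ 2 * (2 * n + 1) * centralBinomial n
centralBinomial-suc n = *-cancelʳ-≡ _ _ (suc n * (n ! * n !)) {{m*n≢0 (suc n) _ {{_}} {{n !* n !≢0}}}} (begin
  suc n * centralBinomial (suc n) * (suc n * (n ! * n !))       ≡⟨ re (suc n) (centralBinomial (suc n)) (n !) ⟩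
  centralBinomial (suc n) * (suc n ! * suc n !)                 ≡⟨ C-! (suc n) (suc n) ⟩
  (suc n + suc n) !                               ≡⟨ cong _! (cong suc (+-suc n n)) ⟩
  suc (suc (n + n)) * (suc (n + n) * (n + n) !)   ≡⟨ cong (λ f → suc (suc (n + n)) * (suc (n + n) * f)) (C-! n n) ⟨
  suc (suc (n + n)) * (suc (n + n) * (centralBinomial n * (n ! * n !)))  ≡⟨ re′ n (centralBinomial n) (n ! * n !) ⟩
  2 * (2 * n + 1) * centralBinomial n * (suc n * (n ! * n !))   ∎)
  where
  open ≡-Reasoning
  re : ∀ s b f → s * b * (s * (f * f)) ≡ b * ((s * f) * (s * f))
  re = solve-∀
  re′ : ∀ n b f → (2 + (n + n)) * ((1 + (n + n)) * (b * f)) ≡ 2 * (2 * n + 1) * b * ((1 + n) * f)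
  re′ = solve-∀

centralBinomial-pos : ∀ n → 0 < centralBinomial n
centralBinomial-pos n = C-pos n n

-- This is the square of the power series of (1 - 4x)^(-1/2), proved by induction. After
-- multiplication by `suc n`, the constant weight is split as `i + (suc n ∸ i)` and symmetrised to
-- `2 * i`; the recurrence of the central coefficients lowers the index with the new weight
-- `2 * i + 1`, and a second symmetrisation makes that weight constant.
centralBinomial-convolution : ∀ n → ∑< (suc n) (λ i → centralBinomial i * centralBinomial (n ∸ i)) ≡ 4 ^ n
centralBinomial-convolution zero    = refl
centralBinomial-convolution (suc n) = *-cancelˡ-≡ _ _ (suc n) (begin
  suc n * ∑< (2 + n) f
    ≡⟨ ∑-*ˡ (2 + n) (suc n) f ⟨
  ∑< (2 + n) (λ i → suc n * f i)
    ≡⟨ (∑-cong-< (2 + n) λ i i<n → cong (_* f i) (sym (m+[n∸m]≡n (s≤s⁻¹ i<n)))) ⟩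
  ∑< (2 + n) (λ i → (i + (suc n ∸ i)) * f i)
    ≡⟨ ∑-symmetrise (suc n) (λ i → i) f (symm (suc n)) ⟨
  2 * ∑< (2 + n) (λ i → i * f i)
    ≡⟨ cong (2 *_) (∑-shift (suc n) _) ⟩
  2 * ∑< (suc n) (λ i → suc i * f (suc i))
    ≡⟨ cong (2 *_) (∑-cong (suc n) λ i → trans (sym (*-assoc (suc i) (centralBinomial (suc i)) (centralBinomial (n ∸ i))))
         (trans (cong (_* centralBinomial (n ∸ i)) (centralBinomial-suc i)) (re i (centralBinomial i) (centralBinomial (n ∸ i))))) ⟩
  2 * ∑< (suc n) (λ i → 2 * ((2 * i + 1) * g i))
    ≡⟨ cong (2 *_) (∑-*ˡ (suc n) 2 _) ⟩
  2 * (2 * ∑< (suc n) (λ i → (2 * i + 1) * g i))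
    ≡⟨ cong (2 *_) (∑-symmetrise n (λ i → 2 * i + 1) g (symm n)) ⟩
  2 * ∑< (suc n) (λ i → ((2 * i + 1) + (2 * (n ∸ i) + 1)) * g i)
    ≡⟨ cong (2 *_) (∑-cong-< (suc n) λ i i<n → cong (_* g i) (trans (re₂ i (n ∸ i)) (cong (λ k → 2 * suc k) (m+[n∸m]≡n (s≤s⁻¹ i<n))))) ⟩
  2 * ∑< (suc n) (λ i → (2 * suc n) * g i)
    ≡⟨ cong (2 *_) (∑-*ˡ (suc n) (2 * suc n) g) ⟩
  2 * (2 * suc n * ∑< (suc n) g)
    ≡⟨ cong (λ s → 2 * (2 * suc n * s)) (centralBinomial-convolution n) ⟩
  2 * (2 * suc n * 4 ^ n)
    ≡⟨ re₃ (suc n) (4 ^ n) ⟩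
  suc n * 4 ^ suc n ∎)
  where
  open ≡-Reasoning
  f g : ℕ → ℕ
  f i = centralBinomial i * centralBinomial (suc n ∸ i)
  g i = centralBinomial i * centralBinomial (n ∸ i)
  symm : ∀ m i → i ≤ m → centralBinomial (m ∸ i) * centralBinomial (m ∸ (m ∸ i)) ≡ centralBinomial i * centralBinomial (m ∸ i)
  symm m i i≤m = trans (cong (λ k → centralBinomial (m ∸ i) * centralBinomial k) (m∸[m∸n]≡n i≤m)) (*-comm (centralBinomial (m ∸ i)) (centralBinomial i))
  re : ∀ i b c → 2 * (2 * i + 1) * b * c ≡ 2 * ((2 * i + 1) * (b * c))
  re = solve-∀
  re₂ : ∀ i j → (2 * i + 1) + (2 * j + 1) ≡ 2 * (1 + (i + j))
  re₂ = solve-∀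
  re₃ : ∀ n p → 2 * (2 * n * p) ≡ n * (4 * p)
  re₃ = solve-∀

-- Wästlund's subdivision of the quarter plane: the corners are spaced by
-- C(2i,i) / 4^i, scaled by 4^L so as to be integers for i ≤ L.
module Subdivision (L : ℕ) where

  edge corner : ℕ → ℕ
  edge i = 4 ^ (L ∸ i) * centralBinomial i
  corner i = ∑< i edge

  edge-pos : ∀ i → 0 < edge i
  edge-pos i = *-mono-≤ (m^n>0 4 (L ∸ i)) (centralBinomial-pos i)

  edge-suc : ∀ {i} → i < L → 2 * suc i * edge (suc i) ≡ (2 * i + 1) * edge i
  edge-suc {i} i<L = begin
    2 * suc i * (4 ^ (L ∸ suc i) * centralBinomial (suc i))       ≡⟨ re (suc i) (4 ^ (L ∸ suc i)) (centralBinomial (suc i)) ⟩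
    2 * 4 ^ (L ∸ suc i) * (suc i * centralBinomial (suc i))       ≡⟨ cong (2 * 4 ^ (L ∸ suc i) *_) (centralBinomial-suc i) ⟩
    2 * 4 ^ (L ∸ suc i) * (2 * (2 * i + 1) * centralBinomial i)   ≡⟨ re′ (4 ^ (L ∸ suc i)) (2 * i + 1) (centralBinomial i) ⟩
    (2 * i + 1) * (4 ^ suc (L ∸ suc i) * centralBinomial i)       ≡⟨ cong (λ k → (2 * i + 1) * (4 ^ k * centralBinomial i)) (+-∸-assoc 1 i<L) ⟨
    (2 * i + 1) * (4 ^ (L ∸ i) * centralBinomial i)               ∎
    where
    open ≡-Reasoning
    re : ∀ s p b → 2 * s * (p * b) ≡ 2 * p * (s * b)
    re = solve-∀
    re′ : ∀ p t b → 2 * p * (2 * t * b) ≡ t * (4 * p * b)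
    re′ = solve-∀

  -- The recurrence `edge-suc` says that `2 * i * edge i` grows by `edge i` at each step, so the
  -- corners telescope.
  corner≡ : ∀ i → i ≤ L → corner i ≡ 2 * i * edge i
  corner≡ zero    i≤L = refl
  corner≡ (suc i) i<L = begin
    corner i + edge i           ≡⟨ cong (_+ edge i) (corner≡ i (<⇒≤ i<L)) ⟩
    2 * i * edge i + edge i     ≡⟨ re i (edge i) ⟩
    (2 * i + 1) * edge i        ≡⟨ edge-suc i<L ⟨
    2 * suc i * edge (suc i)    ∎
    where
    open ≡-Reasoning
    re : ∀ i a → 2 * i * a + a ≡ (2 * i + 1) * a
    re = solve-∀

  edge-sq-suc : ∀ {i} → i < L →
    4 * (suc i * suc i) * (edge (suc i) * edge (suc i)) ≡ (2 * i + 1) * (2 * i + 1) * (edge i * edge i)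
  edge-sq-suc {i} i<L = begin
    4 * (suc i * suc i) * (edge (suc i) * edge (suc i))         ≡⟨ re (suc i) (edge (suc i)) ⟩
    (2 * suc i * edge (suc i)) * (2 * suc i * edge (suc i))     ≡⟨ cong (λ x → x * x) (edge-suc i<L) ⟩
    ((2 * i + 1) * edge i) * ((2 * i + 1) * edge i)             ≡⟨ re′ (2 * i + 1) (edge i) ⟩
    (2 * i + 1) * (2 * i + 1) * (edge i * edge i)               ∎
    where
    open ≡-Reasoning
    re : ∀ s a → 4 * (s * s) * (a * a) ≡ (2 * s * a) * (2 * s * a)
    re = solve-∀
    re′ : ∀ s a → (s * a) * (s * a) ≡ s * s * (a * a)
    re′ = solve-∀

  -- The ratio of consecutive terms is (2i+1)² / (4i(i+1)) = 1 + 1/(4i(i+1)). Together with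
  -- `edge-sq-decreasing` this confines the squared edges to nearly a constant multiple of 1/i.
  edge-sq-increasing : ∀ {i n} → i ≤ n → n ≤ L → i * (edge i * edge i) ≤ n * (edge n * edge n)
  edge-sq-increasing {i} {n} i≤n n≤L = go (n ∸ i) i (m+[n∸m]≡n i≤n)
    where
    step : ∀ i → i < L → i * (edge i * edge i) ≤ suc i * (edge (suc i) * edge (suc i))
    step i i<L = *-cancelˡ-≤ (4 * suc i) (begin
      4 * suc i * (i * (edge i * edge i))                     ≤⟨ m≤m+n _ (edge i * edge i) ⟩
      4 * suc i * (i * (edge i * edge i)) + edge i * edge i   ≡⟨ re i (edge i * edge i) ⟩
      (2 * i + 1) * (2 * i + 1) * (edge i * edge i)           ≡⟨ edge-sq-suc i<L ⟨
      4 * (suc i * suc i) * (edge (suc i) * edge (suc i))     ≡⟨ re′ (suc i) (edge (suc i) * edge (suc i)) ⟩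
      4 * suc i * (suc i * (edge (suc i) * edge (suc i)))     ∎)
      where
      open ≤-Reasoning
      re : ∀ i a → 4 * (1 + i) * (i * a) + a ≡ (2 * i + 1) * (2 * i + 1) * a
      re = solve-∀
      re′ : ∀ s a → 4 * (s * s) * a ≡ 4 * s * (s * a)
      re′ = solve-∀
    go : ∀ k i → i + k ≡ n → i * (edge i * edge i) ≤ n * (edge n * edge n)
    go zero    i eq = ≤-reflexive (cong (λ j → j * (edge j * edge j)) (trans (sym (+-identityʳ i)) eq))
    go (suc k) i eq = ≤-trans (step i (≤-trans (≤-trans (s≤s (m≤m+n i k)) (≤-reflexive eq′)) n≤L)) (go k (suc i) eq′)
      where
      eq′ : suc i + k ≡ n
      eq′ = trans (sym (+-suc i k)) eq

  -- The ratio of consecutive terms is (2i+1)(2i+3) / (2i+2)², which is less than 1.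
  edge-sq-decreasing : ∀ {i n} → i ≤ n → n ≤ L → (2 * n + 1) * (edge n * edge n) ≤ (2 * i + 1) * (edge i * edge i)
  edge-sq-decreasing {i} {n} i≤n n≤L = go (n ∸ i) i (m+[n∸m]≡n i≤n)
    where
    step : ∀ i → i < L → (2 * suc i + 1) * (edge (suc i) * edge (suc i)) ≤ (2 * i + 1) * (edge i * edge i)
    step i i<L = *-cancelˡ-≤ (4 * (suc i * suc i)) (begin
      4 * (suc i * suc i) * ((2 * suc i + 1) * (edge (suc i) * edge (suc i)))
        ≡⟨ re (suc i) (edge (suc i) * edge (suc i)) ⟩
      (2 * suc i + 1) * (4 * (suc i * suc i) * (edge (suc i) * edge (suc i)))
        ≡⟨ cong ((2 * suc i + 1) *_) (edge-sq-suc i<L) ⟩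
      (2 * suc i + 1) * ((2 * i + 1) * (2 * i + 1) * (edge i * edge i))
        ≤⟨ m≤m+n _ ((2 * i + 1) * (edge i * edge i)) ⟩
      (2 * suc i + 1) * ((2 * i + 1) * (2 * i + 1) * (edge i * edge i)) + (2 * i + 1) * (edge i * edge i)
        ≡⟨ re′ i (edge i * edge i) ⟩
      4 * (suc i * suc i) * ((2 * i + 1) * (edge i * edge i)) ∎)
      where
      open ≤-Reasoning
      re : ∀ s a → 4 * (s * s) * ((2 * s + 1) * a) ≡ (2 * s + 1) * (4 * (s * s) * a)
      re = solve-∀
      re′ : ∀ i a → (2 * (1 + i) + 1) * ((2 * i + 1) * (2 * i + 1) * a) + (2 * i + 1) * a
                  ≡ 4 * ((1 + i) * (1 + i)) * ((2 * i + 1) * a)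
      re′ = solve-∀
    go : ∀ k i → i + k ≡ n → (2 * n + 1) * (edge n * edge n) ≤ (2 * i + 1) * (edge i * edge i)
    go zero    i eq = ≤-reflexive (cong (λ j → (2 * j + 1) * (edge j * edge j)) (trans (sym eq) (+-identityʳ i)))
    go (suc k) i eq = ≤-trans (go k (suc i) eq′) (step i (≤-trans (≤-trans (s≤s (m≤m+n i k)) (≤-reflexive eq′)) n≤L))
      where
      eq′ : suc i + k ≡ n
      eq′ = trans (sym (+-suc i k)) eq

  -- Squared corners grow almost linearly: by this and `corner-lower`, corner(i)² / corner(n)² lies
  -- between (i - 1/2)/n and i/n. So the point (corner i, corner j) is inside the circle of radius
  -- corner n when i + j ≤ n, and outside it when i + j > n + 1.
  corner-upper : ∀ {i n} → i ≤ n → n ≤ L → n * (corner i * corner i) ≤ i * (corner n * corner n)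
  corner-upper {i} {n} i≤n n≤L = begin
    n * (corner i * corner i)                       ≡⟨ cong (λ c → n * (c * c)) (corner≡ i (≤-trans i≤n n≤L)) ⟩
    n * ((2 * i * edge i) * (2 * i * edge i))       ≡⟨ re n i (edge i) ⟩
    4 * (n * i) * (i * (edge i * edge i))           ≤⟨ *-monoʳ-≤ (4 * (n * i)) (edge-sq-increasing i≤n n≤L) ⟩
    4 * (n * i) * (n * (edge n * edge n))           ≡⟨ re′ n i (edge n) ⟩
    i * ((2 * n * edge n) * (2 * n * edge n))       ≡⟨ cong (λ c → i * (c * c)) (corner≡ n n≤L) ⟨
    i * (corner n * corner n)                       ∎
    where
    open ≤-Reasoning
    re : ∀ n i a → n * ((2 * i * a) * (2 * i * a)) ≡ 4 * (n * i) * (i * (a * a))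
    re = solve-∀
    re′ : ∀ n i a → 4 * (n * i) * (n * (a * a)) ≡ i * ((2 * n * a) * (2 * n * a))
    re′ = solve-∀

  corner-lower : ∀ {i n} → i ≤ n → n ≤ L →
    2 * i * (corner n * corner n) ≤ 2 * n * (corner i * corner i) + corner n * corner n
  corner-lower {i} {n} i≤n n≤L = *-cancelˡ-≤ (2 * i + 1) (begin
    (2 * i + 1) * (2 * i * Sn)
      ≡⟨ cong (λ c → (2 * i + 1) * (2 * i * (c * c))) (corner≡ n n≤L) ⟩
    (2 * i + 1) * (2 * i * ((2 * n * edge n) * (2 * n * edge n)))
      ≤⟨ m≤m+n _ _ ⟩
    (2 * i + 1) * (2 * i * ((2 * n * edge n) * (2 * n * edge n))) + (8 * n * (i * i) + 4 * (n * n)) * (edge n * edge n)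
      ≡⟨ re i n (edge n) ⟩
    8 * n * (i * i) * ((2 * n + 1) * (edge n * edge n)) + (2 * i + 1) * ((2 * n * edge n) * (2 * n * edge n))
      ≤⟨ +-monoˡ-≤ _ (*-monoʳ-≤ (8 * n * (i * i)) (edge-sq-decreasing i≤n n≤L)) ⟩
    8 * n * (i * i) * ((2 * i + 1) * (edge i * edge i)) + (2 * i + 1) * ((2 * n * edge n) * (2 * n * edge n))
      ≡⟨ re′ n i (edge i) ((2 * n * edge n) * (2 * n * edge n)) ⟩
    (2 * i + 1) * (2 * n * ((2 * i * edge i) * (2 * i * edge i)) + (2 * n * edge n) * (2 * n * edge n))
      ≡⟨ cong₂ (λ c d → (2 * i + 1) * (2 * n * (c * c) + d * d)) (corner≡ i (≤-trans i≤n n≤L)) (corner≡ n n≤L) ⟨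
    (2 * i + 1) * (2 * n * (corner i * corner i) + Sn) ∎)
    where
    open ≤-Reasoning
    Sn = corner n * corner n
    instance
      2i+1≢0 : NonZero (2 * i + 1)
      2i+1≢0 = >-nonZero (m≤n+m 1 (2 * i))
    re : ∀ i n a → (2 * i + 1) * (2 * i * ((2 * n * a) * (2 * n * a))) + (8 * n * (i * i) + 4 * (n * n)) * (a * a)
                 ≡ 8 * n * (i * i) * ((2 * n + 1) * (a * a)) + (2 * i + 1) * ((2 * n * a) * (2 * n * a))
    re = solve-∀
    re′ : ∀ n i a s → 8 * n * (i * i) * ((2 * i + 1) * (a * a)) + (2 * i + 1) * s
                  ≡ (2 * i + 1) * (2 * n * ((2 * i * a) * (2 * i * a)) + s)
    re′ = solve-∀

-- Lattice cells of the quarter disc between two staircases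

inDisc≡1 : ∀ n i j → i * i + j * j ≤ n * n → inDisc n i j ≡ 1
inDisc≡1 n i j le with i * i + j * j ≤? n * n
... | yes _  = refl
... | no ¬le = contradiction le ¬le

inDisc≡0 : ∀ n i j → n * n < i * i + j * j → inDisc n i j ≡ 0
inDisc≡0 n i j lt with i * i + j * j ≤? n * n
... | yes le = contradiction lt (≤⇒≯ le)
... | no  _  = refl

∑-const-≤ : ∀ n c {f} → (∀ i → i < n → f i ≤ c) → ∑< n f ≤ n * c
∑-const-≤ n c le = ≤-trans (∑-mono n le) (≤-reflexive (∑-const n c))

∑-const-≥ : ∀ n c {f} → (∀ i → i < n → c ≤ f i) → n * c ≤ ∑< n f
∑-const-≥ n c le = ≤-trans (≤-reflexive (sym (∑-const n c))) (∑-mono n le)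

∑-blocks : ∀ n (w f : ℕ → ℕ) → ∑< (∑< n w) f ≡ ∑< n (λ i → ∑< (w i) (λ p → f (∑< i w + p)))
∑-blocks zero    w f = refl
∑-blocks (suc n) w f = trans (∑-append (∑< n w) (w n) f)
  (cong (_+ ∑< (w n) (λ p → f (∑< n w + p))) (∑-blocks n w f))

*-mono-sq : ∀ {m n} → m ≤ n → m * m ≤ n * n
*-mono-sq m≤n = *-mono-≤ m≤n m≤n

module QuarterDisc (n₀ : ℕ) where

  n = suc n₀
  -- The outer staircase has corners with indices adding up to `n + 2`, since `corner-lower` loses
  -- 1/2 in each coordinate; the scale 4^L must make all of them integers.
  L = 2 + n
  U = 4 ^ (L + L)
  open Subdivision L

  R = corner n

  n≤L : n ≤ L
  n≤L = m≤n+m n 2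

  corner-pos : ∀ i → 0 < i → 0 < corner i
  corner-pos (suc i) _ = ≤-trans (edge-pos i) (m≤n+m (edge i) (corner i))

  R>0 : 0 < R
  R>0 = corner-pos n z<s

  row : ℕ → ℕ
  row u = ∑< R (λ v → inDisc R (suc u) (suc v))

  suc-corner : ∀ i p → p < edge i → suc (corner i + p) ≤ corner (suc i)
  suc-corner i p p<w = ≤-trans (≤-reflexive (sym (+-suc (corner i) p))) (+-monoʳ-≤ (corner i) p<w)

  row-lower : ∀ i p → i < n₀ → p < edge i → corner (n₀ ∸ i) ≤ row (corner i + p)
  row-lower i p i<n₀ p<w = begin
    corner j                                          ≡⟨ *-identityʳ (corner j) ⟨
    corner j * 1                                      ≤⟨ (∑-const-≥ (corner j) 1 λ v v<c → ≤-reflexive (sym (inside v v<c))) ⟩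
    ∑< (corner j) (λ v → inDisc R (suc u) (suc v))    ≤⟨ ∑-extend _ (∑-extend edge (≤-trans (m∸n≤m n₀ i) (n≤1+n n₀))) ⟩
    row u                                             ∎
    where
    open ≤-Reasoning
    u = corner i + p
    j = n₀ ∸ i
    inside : ∀ v → v < corner j → inDisc R (suc u) (suc v) ≡ 1
    inside v v<c = inDisc≡1 R (suc u) (suc v) (*-cancelˡ-≤ n (begin
      n * (suc u * suc u + suc v * suc v)
        ≤⟨ *-monoʳ-≤ n (+-mono-≤ (*-mono-sq (suc-corner i p p<w)) (*-mono-sq v<c)) ⟩
      n * (corner (suc i) * corner (suc i) + corner j * corner j)
        ≡⟨ *-distribˡ-+ n (corner (suc i) * corner (suc i)) (corner j * corner j) ⟩
      n * (corner (suc i) * corner (suc i)) + n * (corner j * corner j)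
        ≤⟨ +-mono-≤ (corner-upper {suc i} {n} (m<n⇒m<1+n i<n₀) n≤L)
                    (corner-upper {j} {n} (≤-trans (m∸n≤m n₀ i) (n≤1+n n₀)) n≤L) ⟩
      suc i * (R * R) + j * (R * R)
        ≡⟨ *-distribʳ-+ (R * R) (suc i) j ⟨
      (suc i + j) * (R * R)
        ≡⟨ cong (λ k → suc k * (R * R)) (m+[n∸m]≡n (<⇒≤ i<n₀)) ⟩
      n * (R * R) ∎))

  row-upper : ∀ i p → i < n → row (corner i + p) ≤ corner (L ∸ i)
  row-upper i p i<n with n ≤? (L ∸ i)
  -- This is the case i ≤ 2, in which `corner (L ∸ i)` is at least the whole length `R` of the row.
  ... | yes n≤j = begin
    row (corner i + p)   ≤⟨ (∑-const-≤ R 1 λ v _ → inDisc≤1 R _ _) ⟩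
    R * 1                ≡⟨ *-identityʳ R ⟩
    corner n             ≤⟨ ∑-extend edge n≤j ⟩
    corner (L ∸ i)       ∎
    where open ≤-Reasoning
  ... | no n≰j = begin
    row (corner i + p)
      ≤⟨ ∑-support R (corner j) (λ v c≤v → inDisc≡0 R _ _ (≰⇒> (outside v c≤v))) ⟩
    ∑< (corner j) (λ v → inDisc R (suc (corner i + p)) (suc v))
      ≤⟨ (∑-const-≤ (corner j) 1 λ v _ → inDisc≤1 R _ _) ⟩
    corner j * 1
      ≡⟨ *-identityʳ (corner j) ⟩
    corner j ∎
    where
    open ≤-Reasoning
    j = L ∸ i
    j<n : j < n
    j<n = ≰⇒> n≰j
    re : ∀ i j s → 2 * i * s + 2 * j * s ≡ (2 * (i + j)) * s
    re = solve-∀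
    re₁ : ∀ n c d s → (2 * n * c + s) + (2 * n * d + s) ≡ 2 * n * (c + d) + 2 * s
    re₁ = solve-∀
    re₂ : ∀ n s → 2 * n * s + 2 * s ≡ (2 * (1 + n)) * s
    re₂ = solve-∀
    outside : ∀ v → corner j ≤ v →
      suc (corner i + p) * suc (corner i + p) + suc v * suc v ≤ R * R → _
    outside v c≤v le = <-irrefl refl (≤-trans (s≤s (≤-refl {2 * suc n})) (≤-trans (*-monoʳ-< 2 (n<1+n (suc n)))
      (*-cancelʳ-≤ (2 * L) (2 * suc n) (R * R) {{>-nonZero (*-mono-≤ R>0 R>0)}} (begin
      2 * L * (R * R)
        ≡⟨ cong (λ k → 2 * k * (R * R)) (m+[n∸m]≡n (≤-trans (<⇒≤ i<n) n≤L)) ⟨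
      2 * (i + j) * (R * R)
        ≡⟨ re i j (R * R) ⟨
      2 * i * (R * R) + 2 * j * (R * R)
        ≤⟨ +-mono-≤ (corner-lower {i} (<⇒≤ i<n) n≤L) (corner-lower {j} (<⇒≤ j<n) n≤L) ⟩
      (2 * n * (corner i * corner i) + R * R) + (2 * n * (corner j * corner j) + R * R)
        ≡⟨ re₁ n (corner i * corner i) (corner j * corner j) (R * R) ⟩
      2 * n * (corner i * corner i + corner j * corner j) + 2 * (R * R)
        ≤⟨ +-monoˡ-≤ _ (*-monoʳ-≤ (2 * n) (≤-trans (+-mono-≤ (*-mono-sq (m≤n⇒m≤1+n (m≤m+n (corner i) p))) (*-mono-sq (m≤n⇒m≤1+n c≤v))) le)) ⟩
      2 * n * (R * R) + 2 * (R * R)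
        ≡⟨ re₂ n (R * R) ⟩
      2 * suc n * (R * R) ∎))))

  diagonal : ∀ t → t < L → ∑< (suc t) (λ i → edge i * edge (t ∸ i)) ≡ U
  diagonal t t<L = begin
    ∑< (suc t) (λ i → edge i * edge (t ∸ i))
      ≡⟨ (∑-cong-< (suc t) λ i i≤t → term i (s≤s⁻¹ i≤t)) ⟩
    ∑< (suc t) (λ i → 4 ^ (L + (L ∸ t)) * (centralBinomial i * centralBinomial (t ∸ i)))
      ≡⟨ ∑-*ˡ (suc t) (4 ^ (L + (L ∸ t))) _ ⟩
    4 ^ (L + (L ∸ t)) * ∑< (suc t) (λ i → centralBinomial i * centralBinomial (t ∸ i))
      ≡⟨ cong (4 ^ (L + (L ∸ t)) *_) (centralBinomial-convolution t) ⟩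
    4 ^ (L + (L ∸ t)) * 4 ^ t
      ≡⟨ ^-distribˡ-+-* 4 (L + (L ∸ t)) t ⟨
    4 ^ (L + (L ∸ t) + t)
      ≡⟨ cong (4 ^_) (trans (+-assoc L (L ∸ t) t) (cong (L +_) (m∸n+n≡m (<⇒≤ t<L)))) ⟩
    4 ^ (L + L) ∎
    where
    open ≡-Reasoning
    re : ∀ a b c d → a * b * (c * d) ≡ a * c * (b * d)
    re = solve-∀
    exponent : ∀ i → i ≤ t → (L ∸ i) + (L ∸ (t ∸ i)) ≡ L + (L ∸ t)
    exponent i i≤t = +-cancelʳ-≡ t _ _ (begin
      (L ∸ i) + (L ∸ (t ∸ i)) + t
        ≡⟨ cong ((L ∸ i) + (L ∸ (t ∸ i)) +_) (sym (m+[n∸m]≡n i≤t)) ⟩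
      (L ∸ i) + (L ∸ (t ∸ i)) + (i + (t ∸ i))
        ≡⟨ re₁ (L ∸ i) (L ∸ (t ∸ i)) i (t ∸ i) ⟩
      ((L ∸ i) + i) + ((L ∸ (t ∸ i)) + (t ∸ i))
        ≡⟨ cong₂ _+_ (m∸n+n≡m (≤-trans i≤t (<⇒≤ t<L))) (m∸n+n≡m (≤-trans (m∸n≤m t i) (<⇒≤ t<L))) ⟩
      L + L
        ≡⟨ cong (L +_) (m∸n+n≡m (<⇒≤ t<L)) ⟨
      L + ((L ∸ t) + t)
        ≡⟨ +-assoc L (L ∸ t) t ⟨
      L + (L ∸ t) + t ∎)
      where
      re₁ : ∀ a b c d → a + b + (c + d) ≡ (a + c) + (b + d)
      re₁ = solve-∀
    term : ∀ i → i ≤ t → edge i * edge (t ∸ i) ≡ 4 ^ (L + (L ∸ t)) * (centralBinomial i * centralBinomial (t ∸ i))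
    term i i≤t = begin
      edge i * edge (t ∸ i)
        ≡⟨ re (4 ^ (L ∸ i)) (centralBinomial i) (4 ^ (L ∸ (t ∸ i))) (centralBinomial (t ∸ i)) ⟩
      4 ^ (L ∸ i) * 4 ^ (L ∸ (t ∸ i)) * (centralBinomial i * centralBinomial (t ∸ i))
        ≡⟨ cong (_* (centralBinomial i * centralBinomial (t ∸ i))) (trans (sym (^-distribˡ-+-* 4 (L ∸ i) _)) (cong (4 ^_) (exponent i i≤t))) ⟩
      4 ^ (L + (L ∸ t)) * (centralBinomial i * centralBinomial (t ∸ i)) ∎

  staircase : ∀ N → N ≤ L → ∑< N (λ i → edge i * corner (N ∸ i)) ≡ N * U
  staircase N N≤L = begin
    ∑< N (λ i → edge i * corner (N ∸ i))                        ≡⟨ ∑-triangle N edge ⟩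
    ∑< N (λ t → ∑< (suc t) (λ i → edge i * edge (t ∸ i)))       ≡⟨ ∑-cong-< N (λ t t<N → diagonal t (≤-trans t<N N≤L)) ⟩
    ∑< N (λ _ → U)                                              ≡⟨ ∑-const N U ⟩
    N * U                                                       ∎
    where open ≡-Reasoning

  quarterCount-lower : n₀ * U ≤ quarterCount R
  quarterCount-lower = begin
    n₀ * U                                                         ≡⟨ staircase n₀ (≤-trans (n≤1+n n₀) n≤L) ⟨
    ∑< n₀ (λ i → edge i * corner (n₀ ∸ i))                         ≤⟨ (∑-mono n₀ λ i i<n₀ → ∑-const-≥ (edge i) _ λ p → row-lower i p i<n₀) ⟩
    ∑< n₀ (λ i → ∑< (edge i) (λ p → row (corner i + p)))           ≡⟨ ∑-blocks n₀ edge row ⟨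
    ∑< (corner n₀) row                                             ≤⟨ ∑-extend row (∑-extend edge (n≤1+n n₀)) ⟩
    quarterCount R                                                 ∎
    where open ≤-Reasoning

  quarterCount-upper : quarterCount R ≤ L * U
  quarterCount-upper = begin
    quarterCount R                                                 ≡⟨ ∑-blocks n edge row ⟩
    ∑< n (λ i → ∑< (edge i) (λ p → row (corner i + p)))            ≤⟨ (∑-mono n λ i i<n → ∑-const-≤ (edge i) _ λ p _ → row-upper i p i<n) ⟩
    ∑< n (λ i → edge i * corner (L ∸ i))                           ≤⟨ ∑-extend _ n≤L ⟩
    ∑< L (λ i → edge i * corner (L ∸ i))                           ≡⟨ staircase L ≤-refl ⟩
    L * U                                                          ∎
    where open ≤-Reasoning

  -- The factor 32 is 2 * 4^(L - n); likewise the 256 of `U≡` is 4^(2(L - n)).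
  R≡ : R ≡ 32 * (n * centralBinomial n)
  R≡ = trans (corner≡ n n≤L) (trans (cong (λ k → 2 * n * (4 ^ k * centralBinomial n)) (m+n∸n≡m 2 n)) (re n (centralBinomial n)))
    where
    re : ∀ n b → 2 * n * (16 * b) ≡ 32 * (n * b)
    re = solve-∀

  U≡ : U ≡ 256 * 4 ^ (n + n)
  U≡ = trans (cong (4 ^_) (re n)) (^-distribˡ-+-* 4 4 (n + n))
    where
    re : ∀ n → (2 + n) + (2 + n) ≡ 4 + (n + n)
    re = solve-∀

  -- Since (2n+1) edge(n)² ≤ edge(0)² = 4^(2L) and R = 2n edge(n).
  R≤U : R ≤ U
  R≤U = *-cancelˡ-≤ (2 * n) (begin
    2 * n * R                                    ≤⟨ *-monoˡ-≤ R (≤-trans (≤-reflexive (sym (*-identityʳ (2 * n)))) (*-monoʳ-≤ (2 * n) (edge-pos n))) ⟩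
    2 * n * edge n * R                           ≡⟨ cong (2 * n * edge n *_) (corner≡ n n≤L) ⟩
    2 * n * edge n * (2 * n * edge n)            ≡⟨ re n (edge n) ⟩
    2 * n * (2 * n * (edge n * edge n))          ≤⟨ *-monoʳ-≤ (2 * n) (*-monoˡ-≤ (edge n * edge n) (m≤m+n (2 * n) 1)) ⟩
    2 * n * ((2 * n + 1) * (edge n * edge n))    ≤⟨ *-monoʳ-≤ (2 * n) (edge-sq-decreasing {0} {n} z≤n n≤L) ⟩
    2 * n * (1 * (edge 0 * edge 0))              ≡⟨ cong (2 * n *_) (trans (*-identityˡ _) (trans (cong (λ x → x * x) (*-identityʳ (4 ^ L))) (sym (^-distribˡ-+-* 4 L L)))) ⟩
    2 * n * U                                    ∎)
    where
    open ≤-Reasoning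
    re : ∀ n a → 2 * n * a * (2 * n * a) ≡ 2 * n * (2 * n * (a * a))
    re = solve-∀

-- Wallis' inequalities with the cell count of any radius k

wallisIndex : ℕ → ℕ
wallisIndex n = 2 * ((32 * (n * centralBinomial n)) * (32 * (n * centralBinomial n)))

quarter-compare⁺ : ∀ k m → 0 < k → 0 < m →
  quarterCount k * (m * m) ≤ (quarterCount m + 2 * m) * (k * k)
quarter-compare⁺ (suc k) (suc m) _ _ = quarter-compare k m

-- As 4 * quarterCount(k) / k² approximates π, this is π n (C(2n,n) / 4^n)² ≤ 1 + 4/n. The 4
-- consists of 2 from the outer staircase with its n + 2 antidiagonals and 2 from the boundary cells
-- of radius `R`, which `R≤U` absorbs.
wallis-upper : ∀ n k → 0 < n → 0 < k →
  quarterCount k * (4 * (n * n) * (centralBinomial n * centralBinomial n)) ≤ (n + 4) * 4 ^ (n + n) * (k * k)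
wallis-upper n@(suc n₀) k _ 0<k = *-cancelˡ-≤ 256 (begin
  256 * (quarterCount k * (4 * (n * n) * (c * c)))     ≡⟨ re (quarterCount k) n c ⟩
  quarterCount k * ((32 * (n * c)) * (32 * (n * c)))   ≡⟨ cong (λ r → quarterCount k * (r * r)) R≡ ⟨
  quarterCount k * (R * R)                             ≤⟨ quarter-compare⁺ k R 0<k R>0 ⟩
  (quarterCount R + 2 * R) * (k * k)                   ≤⟨ *-monoˡ-≤ (k * k) (+-mono-≤ quarterCount-upper (*-monoʳ-≤ 2 R≤U)) ⟩
  ((2 + n) * U + 2 * U) * (k * k)                      ≡⟨ cong (λ u → ((2 + n) * u + 2 * u) * (k * k)) U≡ ⟩
  ((2 + n) * (256 * V) + 2 * (256 * V)) * (k * k)      ≡⟨ re′ n V (k * k) ⟩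
  256 * ((n + 4) * V * (k * k))                        ∎)
  where
  open ≤-Reasoning
  open QuarterDisc n₀ using (U; R; R≡; U≡; R>0; R≤U; quarterCount-upper)
  c = centralBinomial n
  V = 4 ^ (n + n)
  re : ∀ q n c → 256 * (q * (4 * (n * n) * (c * c))) ≡ q * ((32 * (n * c)) * (32 * (n * c)))
  re = solve-∀
  re′ : ∀ n V k → ((2 + n) * (256 * V) + 2 * (256 * V)) * k ≡ 256 * ((n + 4) * V * k)
  re′ = solve-∀

-- Here the comparison of radii puts the boundary error at radius `k`, where it amounts to
-- `2 * (R * R) * k`. `wallisIndex` is `2 * (R * R)`, so this error is at most `k * k`; it accounts
-- for the last summand on the right.
wallis-lower : ∀ n k → wallisIndex (suc n) ≤ k → 0 < k →
  n * 4 ^ (suc n + suc n) * (k * k) ≤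
  quarterCount k * (4 * (suc n * suc n) * (centralBinomial (suc n) * centralBinomial (suc n))) + 4 ^ (suc n + suc n) * (k * k)
wallis-lower n₀ k 2R²≤k 0<k = *-cancelˡ-≤ 256 (begin
  256 * (n₀ * V * (k * k))                                          ≡⟨ re₀ n₀ V (k * k) ⟩
  n₀ * (256 * V) * (k * k)                                          ≡⟨ cong (λ u → n₀ * u * (k * k)) U≡ ⟨
  n₀ * U * (k * k)                                                  ≤⟨ *-monoˡ-≤ (k * k) quarterCount-lower ⟩
  quarterCount R * (k * k)                                          ≤⟨ quarter-compare⁺ R k R>0 0<k ⟩
  (quarterCount k + 2 * k) * (R * R)                                ≡⟨ re₁ (quarterCount k) k (R * R) ⟩
  quarterCount k * (R * R) + 2 * (R * R) * k                        ≤⟨ +-monoʳ-≤ (quarterCount k * (R * R)) (*-monoˡ-≤ k (≤-trans (≤-reflexive (cong (λ r → 2 * (r * r)) R≡)) 2R²≤k)) ⟩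
  quarterCount k * (R * R) + k * k                                  ≤⟨ +-monoʳ-≤ (quarterCount k * (R * R)) (≤-trans (≤-reflexive (sym (*-identityˡ (k * k)))) (*-monoˡ-≤ (k * k) (m^n>0 4 (L + L)))) ⟩
  quarterCount k * (R * R) + U * (k * k)                            ≡⟨ cong₂ (λ r u → quarterCount k * (r * r) + u * (k * k)) R≡ U≡ ⟩
  quarterCount k * ((32 * (n * c)) * (32 * (n * c))) + 256 * V * (k * k)
                                                                    ≡⟨ re (quarterCount k) n c (V * (k * k)) V (k * k) ⟩
  256 * (quarterCount k * (4 * (n * n) * (c * c)) + V * (k * k))    ∎)
  where
  open ≤-Reasoning
  open QuarterDisc n₀ using (n; L; U; R; R≡; U≡; R>0; quarterCount-lower)
  c = centralBinomial n
  V = 4 ^ (n + n)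
  re₀ : ∀ n v k → 256 * (n * v * k) ≡ n * (256 * v) * k
  re₀ = solve-∀
  re₁ : ∀ q k r → (q + 2 * k) * r ≡ q * r + 2 * r * k
  re₁ = solve-∀
  re : ∀ q n c w v k → q * ((32 * (n * c)) * (32 * (n * c))) + 256 * v * k ≡ 256 * (q * (4 * (n * n) * (c * c)) + v * k)
  re = solve-∀

-- Inequalities up to a power of 1 + 1/M
module Approximate (M : ℕ) where

  infix 4 _≲[_]_
  record _≲[_]_ (a k b : ℕ) : Set where
    constructor approx
    field bound : M ^ k * a ≤ suc M ^ k * b
  open _≲[_]_ public

  ≤⇒≲ : ∀ {a b} → a ≤ b → a ≲[ 0 ] b
  ≤⇒≲ a≤b = approx (*-monoʳ-≤ 1 a≤b)

  ≲-step : ∀ {a b} → M * a ≤ suc M * b → a ≲[ 1 ] b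
  ≲-step {a} {b} le = approx (subst₂ (λ m n → m * a ≤ n * b) (sym (*-identityʳ M)) (sym (*-identityʳ (suc M))) le)

  ≲-* : ∀ {a b c d k l} → a ≲[ k ] b → c ≲[ l ] d → a * c ≲[ k + l ] b * d
  ≲-* {a} {b} {c} {d} {k} {l} (approx p) (approx q) = approx (begin
    M ^ (k + l) * (a * c)                 ≡⟨ re M a c ⟩
    (M ^ k * a) * (M ^ l * c)             ≤⟨ *-mono-≤ p q ⟩
    (suc M ^ k * b) * (suc M ^ l * d)     ≡⟨ re (suc M) b d ⟨
    suc M ^ (k + l) * (b * d)             ∎)
    where
    open ≤-Reasoning
    rearrange : ∀ u v a c → u * v * (a * c) ≡ (u * a) * (v * c)
    rearrange = solve-∀
    re : ∀ m a c → m ^ (k + l) * (a * c) ≡ (m ^ k * a) * (m ^ l * c)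
    re m a c = trans (cong (_* (a * c)) (^-distribˡ-+-* m k l)) (rearrange (m ^ k) (m ^ l) a c)

  ≲-trans : ∀ {a b c k l} → a ≲[ k ] b → b ≲[ l ] c → a ≲[ k + l ] c
  ≲-trans {a} {b} {c} {k} {l} (approx p) (approx q) = approx (begin
    M ^ (k + l) * a               ≡⟨ cong (_* a) (^-distribˡ-+-* M k l) ⟩
    M ^ k * M ^ l * a             ≡⟨ re (M ^ k) (M ^ l) a ⟩
    M ^ l * (M ^ k * a)           ≤⟨ *-monoʳ-≤ (M ^ l) p ⟩
    M ^ l * (suc M ^ k * b)       ≡⟨ re′ (M ^ l) (suc M ^ k) b ⟩
    suc M ^ k * (M ^ l * b)       ≤⟨ *-monoʳ-≤ (suc M ^ k) q ⟩
    suc M ^ k * (suc M ^ l * c)   ≡⟨ *-assoc (suc M ^ k) (suc M ^ l) c ⟨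
    suc M ^ k * suc M ^ l * c     ≡⟨ cong (_* c) (^-distribˡ-+-* (suc M) k l) ⟨
    suc M ^ (k + l) * c           ∎)
    where
    open ≤-Reasoning
    re : ∀ u v a → u * v * a ≡ v * (u * a)
    re = solve-∀
    re′ : ∀ u v a → u * (v * a) ≡ v * (u * a)
    re′ = solve-∀

  ≤-≲-trans : ∀ {a b c k} → a ≤ b → b ≲[ k ] c → a ≲[ k ] c
  ≤-≲-trans a≤b = ≲-trans (≤⇒≲ a≤b)

  ≲-≤-trans : ∀ {a b c k} → a ≲[ k ] b → b ≤ c → a ≲[ k ] c
  ≲-≤-trans {k = k} (approx p) b≤c = approx (≤-trans p (*-monoʳ-≤ (suc M ^ k) b≤c))

  ≲-*ˡ : ∀ {a b k} c → a ≲[ k ] b → c * a ≲[ k ] c * b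
  ≲-*ˡ c = ≲-* (≤⇒≲ (≤-refl {c}))

  ≲-cancelˡ : ∀ {a b k} c → 0 < c → c * a ≲[ k ] c * b → a ≲[ k ] b
  ≲-cancelˡ {a} {b} {k} c 0<c (approx p) = approx (*-cancelˡ-≤ c {{>-nonZero 0<c}}
    (subst₂ _≤_ (re (M ^ k) c a) (re (suc M ^ k) c b) p))
    where
    re : ∀ u c a → u * (c * a) ≡ c * (u * a)
    re = solve-∀

  ≲-sqrt : ∀ {a b} k → a * a ≲[ k + k ] b * b → a ≲[ k ] b
  ≲-sqrt {a} {b} k (approx p) = approx (≮⇒≥ λ lt → <⇒≱ (*-mono-< lt lt)
    (subst₂ _≤_ (re M a) (re (suc M) b) p))
    where
    rearrange : ∀ u a → u * u * (a * a) ≡ (u * a) * (u * a)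
    rearrange = solve-∀
    re : ∀ m a → m ^ (k + k) * (a * a) ≡ (m ^ k * a) * (m ^ k * a)
    re m a = trans (cong (_* (a * a)) (^-distribˡ-+-* m k k)) (rearrange (m ^ k) a)

  ≲-+ : ∀ {a b c d k} → a ≲[ k ] b → c ≲[ k ] d → a + c ≲[ k ] b + d
  ≲-+ {a} {b} {c} {d} {k} (approx p) (approx q) = approx (begin
    M ^ k * (a + c)                     ≡⟨ *-distribˡ-+ (M ^ k) a c ⟩
    M ^ k * a + M ^ k * c               ≤⟨ +-mono-≤ p q ⟩
    suc M ^ k * b + suc M ^ k * d       ≡⟨ *-distribˡ-+ (suc M ^ k) b d ⟨
    suc M ^ k * (b + d)                 ∎)
    where open ≤-Reasoning

  ≲-pad : ∀ {a b k} → a ≲[ k ] b → a ≲[ suc k ] b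
  ≲-pad {a} p = ≲-trans (≲-step (m≤n+m (M * a) a)) p

  suc-≲ : ∀ {x} → M ≤ x → suc x ≲[ 1 ] x
  suc-≲ {x} M≤x = ≲-step (≤-trans (≤-reflexive (*-suc M x)) (+-monoˡ-≤ (M * x) M≤x))

-- Central coefficients of even and odd order

-- The j-th binomial coefficient of order 2l + e to the right of the centre.
coef : ℕ → ℕ → ℕ → ℕ
coef e l j = (l + e + l) C (l + e + j)

-- One more than the order of the binomial coefficients themselves: the X of the overview, for which
-- the ratios of neighbouring coefficients are (X-s)/(X+s).
order : ℕ → ℕ → ℕ
order e l = suc (l + e + l)

coef-vanish : ∀ e {l j} → l < j → coef e l j ≡ 0
coef-vanish e {l} {j} l<j = k>n⇒nCk≡0 (+-monoʳ-< (l + e) l<j)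

-- Past the end of the row both sides vanish, the right one also through the truncated subtraction.
coef-suc : ∀ e l j → coef e l (suc j) * (l + e + suc j) ≡ coef e l j * (l ∸ j)
coef-suc e l j with j <? l
... | no j≮l = trans (cong (_* (l + e + suc j)) (coef-vanish e (s≤s (≮⇒≥ j≮l))))
                 (sym (trans (cong (coef e l j *_) (m≤n⇒m∸n≡0 (≮⇒≥ j≮l))) (*-zeroʳ (coef e l j))))
... | yes j<l = begin
  (l + e + l) C (l + e + suc j) * (l + e + suc j)     ≡⟨ cong₂ (λ n k → n C k * k) total (+-suc (l + e) j) ⟩
  (k + suc d) C suc k * suc k                         ≡⟨ C-step k d ⟩
  (k + suc d) C k * suc d                             ≡⟨ cong₂ (λ n m → n C k * m) (sym total) (sym l∸j) ⟩
  (l + e + l) C (l + e + j) * (l ∸ j)                 ∎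
  where
  open ≡-Reasoning
  k = l + e + j
  d = l ∸ suc j
  l∸j : l ∸ j ≡ suc d
  l∸j = +-∸-assoc 1 j<l
  total : l + e + l ≡ k + suc d
  total = trans (cong (l + e +_) (trans (sym (m+[n∸m]≡n (<⇒≤ j<l))) (cong (j +_) l∸j))) (sym (+-assoc (l + e) j (suc d)))

-- For e = 0 the central coefficient is C(2l,l), and for e = 1 it is half of
-- C(2l+2,l+1); the scale is 1 or 4 accordingly.
record Centre (e l : ℕ) : Set where
  field
    index scale   : ℕ
    index≥        : l ≤ index
    index>0       : 0 < index
    scale>0       : 0 < scale
    index≤        : index ≤ suc l
    coef-scale    : scale * (coef e l 0 * coef e l 0) ≡ centralBinomial index * centralBinomial index
    power-scale   : scale * 4 ^ (l + e + l) ≡ 4 ^ (index + index)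
    order-lower   : 2 * index ≤ order e l
    order-upper   : order e l ≤ 2 * index + 1

centre : ∀ {e l} → e ≤ 1 → 0 < l → Centre e l
centre {zero} {l} z≤n 0<l = record
  { index = l ; scale = 1 ; index≥ = ≤-refl ; index>0 = 0<l ; scale>0 = z<s ; index≤ = n≤1+n l
  ; coef-scale = trans (*-identityˡ _) (cong (λ c → c * c) (cong₂ _C_ (cong (_+ l) (+-identityʳ l)) (trans (+-identityʳ _) (+-identityʳ l))))
  ; power-scale = trans (*-identityˡ _) (cong (λ k → 4 ^ (k + l)) (+-identityʳ l))
  ; order-lower = ≤-trans (n≤1+n (2 * l)) (≤-reflexive (re l))
  ; order-upper = ≤-reflexive (re′ l)
  }
  where
  re : ∀ l → 1 + 2 * l ≡ 1 + (l + 0 + l)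
  re = solve-∀
  re′ : ∀ l → 1 + (l + 0 + l) ≡ 2 * l + 1
  re′ = solve-∀
centre {suc zero} {l} (s≤s z≤n) _ = record
  { index = suc l ; scale = 4 ; index≥ = n≤1+n l ; index>0 = z<s ; scale>0 = z<s ; index≤ = ≤-refl
  ; coef-scale = trans (re₀ c) (cong (λ c → c * c) (sym half))
  ; power-scale = cong (4 ^_) (re l)
  ; order-lower = ≤-reflexive (re₁ l)
  ; order-upper = ≤-trans (≤-reflexive (sym (re₁ l))) (m≤m+n (2 * suc l) 1)
  }
  where
  open ≡-Reasoning
  c = coef 1 l 0
  re : ∀ l → 1 + (l + 1 + l) ≡ (1 + l) + (1 + l)
  re = solve-∀
  re₀ : ∀ c → 4 * (c * c) ≡ (c + c) * (c + c)
  re₀ = solve-∀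
  re₁ : ∀ l → 2 * (1 + l) ≡ 1 + (l + 1 + l)
  re₁ = solve-∀
  c≡ : (suc l + l) C suc l ≡ c
  c≡ = cong₂ _C_ (cong (_+ l) (sym (+-comm l 1))) (sym (trans (+-identityʳ (l + 1)) (+-comm l 1)))
  half : centralBinomial (suc l) ≡ c + c
  half = begin
    (suc l + suc l) C suc l                     ≡⟨ cong (_C suc l) (+-suc (suc l) l) ⟩
    suc (suc l + l) C suc l                     ≡⟨ nCk+nC[k+1]≡[n+1]C[k+1] (suc l + l) l ⟨
    (suc l + l) C l + (suc l + l) C suc l       ≡⟨ cong (_+ (suc l + l) C suc l) (C-sym (suc l) l) ⟨
    (suc l + l) C suc l + (suc l + l) C suc l   ≡⟨ cong₂ _+_ c≡ c≡ ⟩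
    c + c                                       ∎

-- The decreasing quantity of `edge-sq-decreasing` is compared at n with its value at 0. Scaling by
-- 4^n leaves `edge n` as the bare central coefficient.
central-sq-≤ : ∀ n → (2 * n + 1) * (centralBinomial n * centralBinomial n) ≤ 4 ^ (n + n)
central-sq-≤ n = begin
  (2 * n + 1) * (B * B)                   ≡⟨ cong (λ c → (2 * n + 1) * (c * c)) (sym edge-n) ⟩
  (2 * n + 1) * (edge n * edge n)         ≤⟨ edge-sq-decreasing {0} {n} z≤n ≤-refl ⟩
  1 * (edge 0 * edge 0)                   ≡⟨ trans (*-identityˡ _) (trans (cong (λ x → x * x) (*-identityʳ (4 ^ n))) (sym (^-distribˡ-+-* 4 n n))) ⟩
  4 ^ (n + n)                             ∎
  where
  open ≤-Reasoning
  open Subdivision n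
  B = centralBinomial n
  edge-n : edge n ≡ B
  edge-n = trans (cong (λ k → 4 ^ k * B) (n∸n≡0 n)) (*-identityˡ B)

coef-sq-≤ : ∀ {e l} → e ≤ 1 → 0 < l → coef e l 0 * coef e l 0 * order e l ≤ 4 ^ (l + e + l)
coef-sq-≤ {e} {l} e≤1 0<l = *-cancelˡ-≤ scale {{>-nonZero scale>0}} (begin
  scale * (c * c * order e l)                 ≡⟨ *-assoc scale (c * c) (order e l) ⟨
  scale * (c * c) * order e l                 ≡⟨ cong (_* order e l) coef-scale ⟩
  B * B * order e l                           ≤⟨ *-monoʳ-≤ (B * B) order-upper ⟩
  B * B * (2 * index + 1)                     ≡⟨ *-comm (B * B) _ ⟩
  (2 * index + 1) * (B * B)                   ≤⟨ central-sq-≤ index ⟩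
  4 ^ (index + index)                         ≡⟨ power-scale ⟨
  scale * 4 ^ (l + e + l)                     ∎)
  where
  open ≤-Reasoning
  open Centre (centre e≤1 0<l)
  c = coef e l 0
  B = centralBinomial index

module Wallis (M k : ℕ) (0<k : 0 < k) where
  open Approximate M

  p q : ℕ
  p = 4 * quarterCount k
  q = k * k

  -- The limiting relation is c² X π = 2 * 4^(X-1). One factor 1 + 1/M pays for replacing the order
  -- by `2 * index`, the other for the `n + 4` in `wallis-upper`; the latter asks for `4 * M ≤ l`.
  coef-wallis-upper : ∀ {e l} → e ≤ 1 → 0 < l → 4 * M ≤ l →
    coef e l 0 * coef e l 0 * order e l * p ≲[ 2 ] 2 * 4 ^ (l + e + l) * q
  coef-wallis-upper {e} {l} e≤1 0<l 4M≤l = ≲-cancelˡ (scale * (n * n)) (*-mono-≤ scale>0 (*-mono-≤ index>0 index>0))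
    (≤-≲-trans (begin
      scale * (n * n) * (c * c * order e l * p)
        ≡⟨ re scale n c (order e l) p ⟩
      order e l * ((scale * (c * c)) * (n * n) * p)
        ≡⟨ cong (λ b → order e l * (b * (n * n) * p)) coef-scale ⟩
      order e l * ((B * B) * (n * n) * (4 * quarterCount k))
        ≡⟨ re₁ (order e l) (B * B) n (quarterCount k) ⟩
      order e l * (quarterCount k * (4 * (n * n) * (B * B)))
        ≤⟨ *-mono-≤ order-upper (wallis-upper n k index>0 0<k) ⟩
      (2 * n + 1) * ((n + 4) * 4 ^ (n + n) * q)
        ≡⟨ re₂ (2 * n + 1) (n + 4) (4 ^ (n + n)) q ⟩
      4 ^ (n + n) * q * ((2 * n + 1) * (n + 4))
        ≡⟨ cong (λ v → v * q * ((2 * n + 1) * (n + 4))) power-scale ⟨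
      scale * 4 ^ (l + e + l) * q * ((2 * n + 1) * (n + 4)) ∎)
    (≲-≤-trans (≲-*ˡ (scale * 4 ^ (l + e + l) * q) (≲-* 2n+1≲2n n+4≲n))
      (≤-reflexive (re₃ scale (4 ^ (l + e + l)) q n))))
    where
    open ≤-Reasoning
    open Centre (centre e≤1 0<l)
    n = index
    c = coef e l 0
    B = centralBinomial n
    M≤n : 4 * M ≤ n
    M≤n = ≤-trans 4M≤l index≥
    2n+1≲2n : 2 * n + 1 ≲[ 1 ] 2 * n
    2n+1≲2n = ≲-step (begin
      M * (2 * n + 1)       ≡⟨ e₁ M n ⟩
      M + M * (2 * n)       ≤⟨ +-monoˡ-≤ _ (≤-trans (m≤n*m M 4) (≤-trans M≤n (m≤n*m n 2))) ⟩
      2 * n + M * (2 * n)   ∎)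
      where
      e₁ : ∀ M n → M * (2 * n + 1) ≡ M + M * (2 * n)
      e₁ = solve-∀
    n+4≲n : n + 4 ≲[ 1 ] n
    n+4≲n = ≲-step (begin
      M * (n + 4)      ≡⟨ e₁ M n ⟩
      4 * M + M * n    ≤⟨ +-monoˡ-≤ _ M≤n ⟩
      n + M * n        ∎)
      where
      e₁ : ∀ M n → M * (n + 4) ≡ 4 * M + M * n
      e₁ = solve-∀
    re : ∀ s n c X p → s * (n * n) * (c * c * X * p) ≡ X * ((s * (c * c)) * (n * n) * p)
    re = solve-∀
    re₁ : ∀ X b n r → X * (b * (n * n) * (4 * r)) ≡ X * (r * (4 * (n * n) * b))
    re₁ = solve-∀
    re₂ : ∀ a b v q → a * (b * v * q) ≡ v * q * (a * b)
    re₂ = solve-∀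
    re₃ : ∀ s t q n → s * t * q * (2 * n * n) ≡ s * (n * n) * (2 * t * q)
    re₃ = solve-∀

  -- The single factor 1 + 1/M replaces n by the n - 2 left over in `wallis-lower`. The row refers
  -- to the central coefficient of index l or l + 1 according to parity, hence two lower bounds on
  -- k.
  coef-wallis-lower : ∀ {e l} → e ≤ 1 → 0 < l → 2 + 2 * M ≤ l → wallisIndex l ≤ k → wallisIndex (suc l) ≤ k →
    2 * 4 ^ (l + e + l) * q ≲[ 1 ] coef e l 0 * coef e l 0 * order e l * p
  coef-wallis-lower {e} {l} e≤1 0<l 2M≤l k≥ k≥′ = ≲-cancelˡ (scale * (n * n)) (*-mono-≤ scale>0 (*-mono-≤ index>0 index>0))
    (≤-≲-trans (begin
      scale * (n * n) * (2 * 4 ^ (l + e + l) * q)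
        ≡⟨ re scale n (4 ^ (l + e + l)) q ⟩
      2 * n * ((scale * 4 ^ (l + e + l)) * q) * n
        ≡⟨ cong (λ v → 2 * n * (v * q) * n) power-scale ⟩
      2 * n * (4 ^ (n + n) * q) * n ∎)
    (≲-≤-trans (≲-*ˡ (2 * n * (4 ^ (n + n) * q)) n≲n-2) (begin
      2 * n * (4 ^ (n + n) * q) * (n ∸ 2)
        ≡⟨ re₁ (2 * n) (4 ^ (n + n)) q (n ∸ 2) ⟩
      2 * n * ((n ∸ 2) * 4 ^ (n + n) * q)
        ≤⟨ *-mono-≤ order-lower (lower n index>0 index-bound) ⟩
      order e l * (quarterCount k * (4 * (n * n) * (B * B)))
        ≡⟨ re₂ (order e l) (quarterCount k) n (B * B) ⟩
      order e l * ((B * B) * (n * n) * p)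
        ≡⟨ cong (λ b → order e l * (b * (n * n) * p)) coef-scale ⟨
      order e l * ((scale * (c * c)) * (n * n) * p)
        ≡⟨ re₃ scale n c (order e l) p ⟨
      scale * (n * n) * (c * c * order e l * p) ∎)))
    where
    open ≤-Reasoning
    open Centre (centre e≤1 0<l)
    n = index
    c = coef e l 0
    B = centralBinomial n
    M≤n : 2 + 2 * M ≤ n
    M≤n = ≤-trans 2M≤l index≥
    index-bound : wallisIndex n ≤ k
    index-bound with m≤n⇒m<n∨m≡n index≤
    ... | inj₂ eq = subst (λ i → wallisIndex i ≤ k) (sym eq) k≥′
    ... | inj₁ lt = subst (λ i → wallisIndex i ≤ k) (≤-antisym index≥ (s≤s⁻¹ lt)) k≥
    lower : ∀ n → 0 < n → wallisIndex n ≤ k →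
      (n ∸ 2) * 4 ^ (n + n) * q ≤ quarterCount k * (4 * (n * n) * (centralBinomial n * centralBinomial n))
    lower (suc zero) _ _ = z≤n
    lower n@(suc n₀@(suc n₁)) _ k≥n = +-cancelʳ-≤ (4 ^ (n + n) * q) _ _
      (≤-trans (≤-reflexive (e₁ n₁ (4 ^ (n + n)) q)) (wallis-lower n₀ k k≥n 0<k))
      where
      e₁ : ∀ m v q → m * v * q + v * q ≡ (1 + m) * v * q
      e₁ = solve-∀
    n≲n-2 : n ≲[ 1 ] n ∸ 2
    n≲n-2 = ≲-step (begin
      M * n                               ≡⟨ cong (M *_) (sym (m∸n+n≡m (≤-trans (m≤m+n 2 (2 * M)) M≤n))) ⟩
      M * (n ∸ 2 + 2)                     ≡⟨ e₁ M (n ∸ 2) ⟩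
      2 * M + M * (n ∸ 2)                 ≤⟨ +-monoˡ-≤ _ (∸-monoˡ-≤ 2 M≤n) ⟩
      n ∸ 2 + M * (n ∸ 2)                 ∎)
      where
      e₁ : ∀ M m → M * (m + 2) ≡ 2 * M + M * m
      e₁ = solve-∀
    re : ∀ s n t q → s * (n * n) * (2 * t * q) ≡ 2 * n * ((s * t) * q) * n
    re = solve-∀
    re₁ : ∀ a v q m → a * (v * q) * m ≡ a * (m * v * q)
    re₁ = solve-∀
    re₂ : ∀ X r n b → X * (r * (4 * (n * n) * b)) ≡ X * (b * (n * n) * (4 * r))
    re₂ = solve-∀
    re₃ : ∀ s n c X p → s * (n * n) * (c * c * X * p) ≡ X * ((s * (c * c)) * (n * n) * p)
    re₃ = solve-∀

-- Comparison of a product of binomial coefficients with a single one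

-- Induction on j multiplies the inequalities v′/u′ ≤ v/u between the successive ratios of g and f.
-- Everything is cross-multiplied because f and g reach 0 at the ends of their rows.
ratio-compare : ∀ (f g u v u′ v′ : ℕ → ℕ) J →
  (∀ j → 0 < u j) → (∀ j → 0 < u′ j) →
  (∀ j → f (suc j) * u j ≡ f j * v j) → (∀ j → g (suc j) * u′ j ≡ g j * v′ j) →
  (∀ j → j < J → u j * v′ j ≤ v j * u′ j) →
  ∀ j → j ≤ J → f 0 * g j ≤ f j * g 0
ratio-compare f g u v u′ v′ J u>0 u′>0 f-step g-step le zero    _   = ≤-refl
ratio-compare f g u v u′ v′ J u>0 u′>0 f-step g-step le (suc j) j<J =
  *-cancelʳ-≤ _ _ (u j * u′ j) {{>-nonZero (*-mono-≤ (u>0 j) (u′>0 j))}} (begin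
    f 0 * g (suc j) * (u j * u′ j)      ≡⟨ re (f 0) (g (suc j)) (u j) (u′ j) ⟩
    f 0 * (g (suc j) * u′ j) * u j      ≡⟨ cong (λ x → f 0 * x * u j) (g-step j) ⟩
    f 0 * (g j * v′ j) * u j            ≡⟨ re₁ (f 0) (g j) (v′ j) (u j) ⟩
    f 0 * g j * (u j * v′ j)            ≤⟨ *-mono-≤ (ratio-compare f g u v u′ v′ J u>0 u′>0 f-step g-step le j (<⇒≤ j<J)) (le j j<J) ⟩
    f j * g 0 * (v j * u′ j)            ≡⟨ re₂ (f j) (g 0) (v j) (u′ j) ⟩
    f j * v j * g 0 * u′ j              ≡⟨ cong (λ x → x * g 0 * u′ j) (f-step j) ⟨
    f (suc j) * u j * g 0 * u′ j        ≡⟨ re₃ (f (suc j)) (u j) (g 0) (u′ j) ⟩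
    f (suc j) * g 0 * (u j * u′ j)      ∎)
  where
  open ≤-Reasoning
  re : ∀ a b c d → a * b * (c * d) ≡ a * (b * d) * c
  re = solve-∀
  re₁ : ∀ a b c d → a * (b * c) * d ≡ a * b * (d * c)
  re₁ = solve-∀
  re₂ : ∀ a b c d → a * b * (c * d) ≡ a * c * b * d
  re₂ = solve-∀
  re₃ : ∀ a b c d → a * b * c * d ≡ a * c * (b * d)
  re₃ = solve-∀

-- With X = 2x + s, …, W = 2w + s, the difference of both sides of the comparison
--   (X-s)(Y-s)(Z-s)(W+s) ≷ (X+s)(Y+s)(Z+s)(W-s)
-- is 2s (XYZ + (X+Y+Z)s² - W (XY+YZ+ZX + s²)).
module RatioStep (x y z w s : ℕ) where

  private
    X = 2 * x + s
    Y = 2 * y + s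
    Z = 2 * z + s
    W = 2 * w + s
    V = W * (X * Y + Y * Z + Z * X + s * s)
    T = X * Y * Z + (X + Y + Z) * (s * s)

    ratio-identity : 16 * (x * y * z * (w + s)) + 2 * s * V ≡ 16 * ((x + s) * (y + s) * (z + s) * w) + 2 * s * T
    ratio-identity = identity x y z w s
      where
      identity : ∀ x y z w s → 16 * (x * y * z * (w + s)) +
          2 * s * ((2 * w + s) * ((2 * x + s) * (2 * y + s) + (2 * y + s) * (2 * z + s) + (2 * z + s) * (2 * x + s) + s * s))
        ≡ 16 * ((x + s) * (y + s) * (z + s) * w) +
          2 * s * ((2 * x + s) * (2 * y + s) * (2 * z + s) + ((2 * x + s) + (2 * y + s) + (2 * z + s)) * (s * s))
      identity = solve-∀

  step-lower : V ≤ T → (x + s) * (y + s) * (z + s) * w ≤ x * y * z * (w + s)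
  step-lower V≤T = *-cancelˡ-≤ 16 (+-cancelʳ-≤ (2 * s * V) _ _
    (≤-trans (+-monoʳ-≤ (16 * ((x + s) * (y + s) * (z + s) * w)) (*-monoʳ-≤ (2 * s) V≤T)) (≤-reflexive (sym ratio-identity))))

  step-upper : T ≤ V → x * y * z * (w + s) ≤ (x + s) * (y + s) * (z + s) * w
  step-upper T≤V = *-cancelˡ-≤ 16 (+-cancelʳ-≤ (2 * s * T) _ _
    (≤-trans (+-monoʳ-≤ (16 * (x * y * z * (w + s))) (*-monoʳ-≤ (2 * s) T≤V)) (≤-reflexive ratio-identity)))

-- The s of the overview for the step from term j to term j + 1, which lie at distances (s-1)/2 and
-- (s+1)/2 from the centre.
offset : ℕ → ℕ → ℕ
offset e j = 2 * j + 1 + e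

coef-suc-≤ : ∀ e l j → coef e l (suc j) ≤ coef e l j
coef-suc-≤ e l j = *-cancelʳ-≤ _ _ (l + e + suc j) {{>-nonZero (≤-trans (s≤s z≤n) (m≤n+m (suc j) (l + e)))}} (begin
  coef e l (suc j) * (l + e + suc j)    ≡⟨ coef-suc e l j ⟩
  coef e l j * (l ∸ j)                  ≤⟨ *-monoʳ-≤ (coef e l j) (≤-trans (m∸n≤m l j) (≤-trans (m≤m+n l e) (m≤m+n (l + e) (suc j)))) ⟩
  coef e l j * (l + e + suc j)          ∎)
  where open ≤-Reasoning

order-offset : ∀ e j d → order e (j + d) ≡ 2 * d + offset e j
order-offset = re
  where
  re : ∀ e j d → 1 + (j + d + e + (j + d)) ≡ 2 * d + (2 * j + 1 + e)
  re = solve-∀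

step-offset : ∀ e j d → j + d + e + suc j ≡ d + offset e j
step-offset e j d = trans (+-suc (j + d + e) j) (re e j d)
  where
  re : ∀ e j d → 1 + (j + d + e + j) ≡ d + (2 * j + 1 + e)
  re = solve-∀

-- With c, c′ the two coefficients, the ratio rule c′ (X + s) = c (X - s) is s (c + c′) = X (c -
-- c′). Dropping s c′ bounds s c by a telescoping difference.
coef-telescope : ∀ e l j → offset e j * coef e l j + order e l * coef e l (suc j) ≤ order e l * coef e l j
coef-telescope e l j with j ≤? l
... | no j≰l = ≤-trans (≤-reflexive (cong₂ _+_
  (trans (cong (offset e j *_) (coef-vanish e (≰⇒> j≰l))) (*-zeroʳ (offset e j)))
  (trans (cong (order e l *_) (coef-vanish e (m<n⇒m<1+n (≰⇒> j≰l)))) (*-zeroʳ (order e l))))) z≤n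
... | yes j≤l = begin
  s * c + order e l * c′              ≤⟨ m≤m+n _ (s * c′) ⟩
  s * c + order e l * c′ + s * c′     ≡⟨ cong (λ o → s * c + o * c′ + s * c′) order≡ ⟩
  s * c + (2 * d + s) * c′ + s * c′   ≡⟨ re s c d c′ ⟩
  s * c + 2 * (c′ * (d + s))          ≡⟨ cong (λ x → s * c + 2 * x) step ⟩
  s * c + 2 * (c * d)                 ≡⟨ re′ s c d ⟩
  (2 * d + s) * c                     ≡⟨ cong (_* c) order≡ ⟨
  order e l * c                       ∎
  where
  open ≤-Reasoning
  d = l ∸ j
  s = offset e j
  c = coef e l j
  c′ = coef e l (suc j)
  order≡ : order e l ≡ 2 * d + s
  order≡ = trans (cong (order e) (sym (m+[n∸m]≡n j≤l))) (order-offset e j d)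
  step : c′ * (d + s) ≡ c * d
  step = trans (cong (c′ *_) (sym (trans (cong (λ k → k + e + suc j) (sym (m+[n∸m]≡n j≤l))) (step-offset e j d)))) (coef-suc e l j)
  re : ∀ s c d c′ → s * c + (2 * d + s) * c′ + s * c′ ≡ s * c + 2 * (c′ * (d + s))
  re = solve-∀
  re′ : ∀ s c d → s * c + 2 * (c * d) ≡ (2 * d + s) * c
  re′ = solve-∀

-- Offsets beyond J are at least the one at J, so summing `coef-telescope` bounds the tail by X /
-- offset(J) times its leading term. The decreasing factor `D` carries the other two coefficients of
-- a product.
tail-bound : ∀ e l (D : ℕ → ℕ) → (∀ j → D (suc j) ≤ D j) → ∀ J R →
  offset e J * ∑< R (λ i → coef e l (J + i) * D (J + i)) + order e l * (coef e l (J + R) * D (J + R)) ≤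
  order e l * (coef e l J * D J)
tail-bound e l D decr J zero = ≤-reflexive (trans (cong (_+ order e l * (coef e l (J + 0) * D (J + 0))) (*-zeroʳ (offset e J)))
  (cong (λ j → order e l * (coef e l j * D j)) (+-identityʳ J)))
tail-bound e l D decr J (suc R) = begin
  offset e J * (T + coef e l j * D j) + order e l * (coef e l (J + suc R) * D (J + suc R))
    ≡⟨ cong (λ k → offset e J * (T + coef e l j * D j) + order e l * (coef e l k * D k)) (+-suc J R) ⟩
  offset e J * (T + coef e l j * D j) + order e l * (coef e l (suc j) * D (suc j))
    ≤⟨ +-mono-≤ (≤-reflexive (*-distribˡ-+ (offset e J) T _)) (*-monoʳ-≤ (order e l) (*-monoʳ-≤ (coef e l (suc j)) (decr j))) ⟩
  offset e J * T + offset e J * (coef e l j * D j) + order e l * (coef e l (suc j) * D j)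
    ≤⟨ +-monoˡ-≤ _ (+-monoʳ-≤ (offset e J * T) (*-monoˡ-≤ (coef e l j * D j) offset-mono)) ⟩
  offset e J * T + offset e j * (coef e l j * D j) + order e l * (coef e l (suc j) * D j)
    ≡⟨ re (offset e J * T) (offset e j) (coef e l j) (D j) (order e l) (coef e l (suc j)) ⟩
  offset e J * T + (offset e j * coef e l j + order e l * coef e l (suc j)) * D j
    ≤⟨ +-monoʳ-≤ (offset e J * T) (*-monoˡ-≤ (D j) (coef-telescope e l j)) ⟩
  offset e J * T + order e l * coef e l j * D j
    ≡⟨ cong (offset e J * T +_) (*-assoc (order e l) (coef e l j) (D j)) ⟩
  offset e J * T + order e l * (coef e l j * D j)
    ≤⟨ tail-bound e l D decr J R ⟩
  order e l * (coef e l J * D J) ∎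
  where
  open ≤-Reasoning
  j = J + R
  T = ∑< R (λ i → coef e l (J + i) * D (J + i))
  offset-mono : offset e J ≤ offset e j
  offset-mono = +-monoˡ-≤ e (+-monoˡ-≤ 1 (*-monoʳ-≤ 2 (m≤m+n J R)))
  re : ∀ t o c d x c′ → t + o * (c * d) + x * (c′ * d) ≡ t + (o * c + x * c′) * d
  re = solve-∀

-- The terms j ≥ 0 and the terms j < 0 of a symmetric sum over j ∈ ℤ + e/2,
-- where e + e′ = 1.
twoSided : (e′ A B : ℕ) → (ℕ → ℕ) → ℕ
twoSided e′ A B f = ∑< A f + ∑< B (λ j → f (j + e′))

∑-centre : ∀ e l m t → ∑< (suc (l + e + m)) t ≡ ∑< (suc m) (λ j → t (l + e + j)) + ∑< (l + e) (λ j → t (l + e ∸ suc j))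
∑-centre e l m t = begin
  ∑< (suc (l + e + m)) t                                      ≡⟨ cong (λ k → ∑< k t) (+-suc (l + e) m) ⟨
  ∑< (l + e + suc m) t                                        ≡⟨ ∑-append (l + e) (suc m) t ⟩
  ∑< (l + e) t + ∑< (suc m) (λ j → t (l + e + j))             ≡⟨ +-comm (∑< (l + e) t) _ ⟩
  ∑< (suc m) (λ j → t (l + e + j)) + ∑< (l + e) t             ≡⟨ cong (∑< (suc m) (λ j → t (l + e + j)) +_) (∑-reverse (l + e) t) ⟩
  ∑< (suc m) (λ j → t (l + e + j)) + ∑< (l + e) (λ j → t (l + e ∸ suc j))  ∎
  where open ≡-Reasoning

-- The index l + e - 1 - j lies at distance j + e′ + e/2 to the left of the centre l + e/2, so it
-- mirrors the term `j + e′` on the right.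
mirror : ∀ {e e′ l j} → e + e′ ≡ 1 → j < l + e → l + e ∸ suc j + (j + e′) ≡ l
mirror {e} {e′} {l} {j} e+e′ j<l = suc-injective (begin
  suc (l + e ∸ suc j + (j + e′))     ≡⟨ re (l + e ∸ suc j) j e′ ⟩
  l + e ∸ suc j + suc j + e′         ≡⟨ cong (_+ e′) (m∸n+n≡m j<l) ⟩
  l + e + e′                         ≡⟨ trans (+-assoc l e e′) (cong (l +_) e+e′) ⟩
  l + 1                              ≡⟨ +-comm l 1 ⟩
  suc l                              ∎)
  where
  open ≡-Reasoning
  re : ∀ a j e′ → 1 + (a + (j + e′)) ≡ a + (1 + j) + e′
  re = solve-∀

coef-sum : ∀ e e′ → e + e′ ≡ 1 → ∀ h → twoSided e′ (suc h) (h + e) (coef e h) ≡ 2 ^ (h + e + h)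
coef-sum e e′ e+e′ h = begin
  twoSided e′ (suc h) (h + e) (coef e h)
    ≡⟨ cong (∑< (suc h) (coef e h) +_) (∑-cong-< (h + e) λ j j<h → reflect (h + e ∸ suc j) (j + e′) (mirror {e} {e′} {h} e+e′ j<h)) ⟨
  ∑< (suc h) (coef e h) + ∑< (h + e) (λ j → (h + e + h) C (h + e ∸ suc j))
    ≡⟨ ∑-centre e h h ((h + e + h) C_) ⟨
  ∑< (suc (h + e + h)) ((h + e + h) C_)
    ≡⟨ C-sum (h + e + h) ⟩
  2 ^ (h + e + h) ∎
  where
  open ≡-Reasoning
  reflect : ∀ i j → i + j ≡ h → (h + e + h) C i ≡ coef e h j
  reflect i j refl = trans (cong (_C i) total) (trans (C-sym i (i + j + e + j)) (cong (_C (i + j + e + j)) (sym total)))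
    where
    total : i + j + e + (i + j) ≡ i + (i + j + e + j)
    total = re i j e
      where
      re : ∀ i j e → i + j + e + (i + j) ≡ i + (i + j + e + j)
      re = solve-∀

-- Three rows against one: decay, bulk and tail

module Product (e l m n : ℕ) where

  X Y Z e₂ e₃ : ℕ
  X = order e l
  Y = order e m
  Z = order e n
  e₂ = X * Y + Y * Z + Z * X
  e₃ = X * Y * Z

  prod : ℕ → ℕ
  prod j = coef e l j * coef e m j * coef e n j

  up down : ℕ → ℕ
  up j = (l + e + suc j) * (m + e + suc j) * (n + e + suc j)
  down j = (l ∸ j) * (m ∸ j) * (n ∸ j)

  step>0 : ∀ l j → 0 < l + e + suc j
  step>0 l j = ≤-trans (s≤s z≤n) (m≤n+m (suc j) (l + e))

  up>0 : ∀ j → 0 < up j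
  up>0 j = *-mono-≤ (*-mono-≤ (step>0 l j) (step>0 m j)) (step>0 n j)

  prod-suc : ∀ j → prod (suc j) * up j ≡ prod j * down j
  prod-suc j = begin
    prod (suc j) * up j
      ≡⟨ re (coef e l (suc j)) (coef e m (suc j)) (coef e n (suc j)) _ _ _ ⟩
    (coef e l (suc j) * (l + e + suc j)) * (coef e m (suc j) * (m + e + suc j)) * (coef e n (suc j) * (n + e + suc j))
      ≡⟨ cong₂ _*_ (cong₂ _*_ (coef-suc e l j) (coef-suc e m j)) (coef-suc e n j) ⟩
    (coef e l j * (l ∸ j)) * (coef e m j * (m ∸ j)) * (coef e n j * (n ∸ j))
      ≡⟨ re (coef e l j) (coef e m j) (coef e n j) _ _ _ ⟨
    prod j * down j ∎
    where
    open ≡-Reasoning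
    re : ∀ a b c u v w → a * b * c * (u * v * w) ≡ (a * u) * (b * v) * (c * w)
    re = solve-∀

  prod-suc-≤ : ∀ j → prod (suc j) ≤ prod j
  prod-suc-≤ j = *-mono-≤ (*-mono-≤ (coef-suc-≤ e l j) (coef-suc-≤ e m j)) (coef-suc-≤ e n j)

  prod-antitone : ∀ j k → prod (j + k) ≤ prod j
  prod-antitone j zero    = ≤-reflexive (cong prod (+-identityʳ j))
  prod-antitone j (suc k) = ≤-trans (≤-reflexive (cong prod (+-suc j k))) (≤-trans (prod-suc-≤ (j + k)) (prod-antitone j k))

  -- The ranges are those of an index from 0 to l + e + m, cut at the centre l + e; terms beyond the
  -- shortest row vanish.
  S : ℕ → ℕ
  S e′ = twoSided e′ (suc m) (l + e) prod

  module Compare (h : ℕ) where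

    W : ℕ
    W = order e h

    ratio : ∀ {j} → j ≤ l → j ≤ m → j ≤ n → j ≤ h → (s : ℕ) → s ≡ offset e j →
      let V = W * (e₂ + s * s) ; T = e₃ + (X + Y + Z) * (s * s) in
      (V ≤ T → up j * (h ∸ j) ≤ down j * (h + e + suc j)) ×
      (T ≤ V → down j * (h + e + suc j) ≤ up j * (h ∸ j))
    ratio {j} j≤l j≤m j≤n j≤h s refl = helper _ _ _ _
      (order≡ j≤l) (order≡ j≤m) (order≡ j≤n) (order≡ j≤h) (step≡ j≤l) (step≡ j≤m) (step≡ j≤n) (step≡ j≤h)
      where
      order≡ : ∀ {k} → j ≤ k → order e k ≡ 2 * (k ∸ j) + s
      order≡ {k} j≤k = trans (cong (order e) (sym (m+[n∸m]≡n j≤k))) (order-offset e j (k ∸ j))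
      step≡ : ∀ {k} → j ≤ k → k + e + suc j ≡ k ∸ j + s
      step≡ {k} j≤k = trans (cong (λ i → i + e + suc j) (sym (m+[n∸m]≡n j≤k))) (step-offset e j (k ∸ j))
      helper : ∀ X Y Z W →
        X ≡ 2 * (l ∸ j) + s → Y ≡ 2 * (m ∸ j) + s → Z ≡ 2 * (n ∸ j) + s → W ≡ 2 * (h ∸ j) + s →
        ∀ {a b c d} → a ≡ l ∸ j + s → b ≡ m ∸ j + s → c ≡ n ∸ j + s → d ≡ h ∸ j + s →
        let V = W * (X * Y + Y * Z + Z * X + s * s) ; T = X * Y * Z + (X + Y + Z) * (s * s) in
        (V ≤ T → a * b * c * (h ∸ j) ≤ down j * d) × (T ≤ V → down j * d ≤ a * b * c * (h ∸ j))
      helper _ _ _ _ refl refl refl refl refl refl refl refl =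
        RatioStep.step-lower (l ∸ j) (m ∸ j) (n ∸ j) (h ∸ j) s , RatioStep.step-upper (l ∸ j) (m ∸ j) (n ∸ j) (h ∸ j) s

  e₂>0 : 0 < e₂
  e₂>0 = ≤-trans (*-mono-≤ {1} {X} {1} {Y} (s≤s z≤n) (s≤s z≤n)) (≤-trans (m≤m+n (X * Y) (Y * Z)) (m≤m+n _ (Z * X)))

  order-reflects-≤ : ∀ h l → order e h ≤ order e l → h ≤ l
  order-reflects-≤ h l le with h ≤? l
  ... | yes h≤l = h≤l
  ... | no h≰l  = contradiction le (<⇒≱ (s≤s (+-mono-< (+-monoˡ-< e (≰⇒> h≰l)) (≰⇒> h≰l))))

  offset-reflects-≤ : ∀ {j k} → offset e j ≤ order e k → j ≤ k
  offset-reflects-≤ {j} {k} le = order-reflects-≤ j k (≤-trans (≤-reflexive (re e j)) le)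
    where
    re : ∀ e j → 1 + (j + e + j) ≡ 2 * j + 1 + e
    re = solve-∀

  module Lower {h} (We₂≤e₃ : order e h * e₂ ≤ e₃) where
    open Compare h

    W≤X : W ≤ X
    W≤X = *-cancelʳ-≤ W X (Y * Z) (≤-trans (*-monoʳ-≤ W (≤-trans (m≤n+m (Y * Z) (X * Y)) (m≤m+n _ (Z * X))))
      (≤-trans We₂≤e₃ (≤-reflexive (*-assoc X Y Z))))

    W≤Y : W ≤ Y
    W≤Y = *-cancelʳ-≤ W Y (Z * X) (≤-trans (*-monoʳ-≤ W (m≤n+m (Z * X) (X * Y + Y * Z)))
      (≤-trans We₂≤e₃ (≤-reflexive (re X Y Z))))
      where
      re : ∀ x y z → x * y * z ≡ y * (z * x)
      re = solve-∀

    W≤Z : W ≤ Z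
    W≤Z = *-cancelʳ-≤ W Z (X * Y) (≤-trans (*-monoʳ-≤ W (≤-trans (m≤m+n (X * Y) (Y * Z)) (m≤m+n _ (Z * X))))
      (≤-trans We₂≤e₃ (≤-reflexive (*-comm (X * Y) Z))))

    -- The hypothesis `We₂≤e₃`, that is 1/W ≥ 1/X + 1/Y + 1/Z, settles the main terms, and W ≤ X + Y
    -- + Z settles those in s². So row `h` decays at least as fast as the product at every offset,
    -- and past its end the left side is 0.
    step : ∀ j → up j * (h ∸ j) ≤ down j * (h + e + suc j)
    step j with j ≤? h
    ... | no j≰h = ≤-trans (≤-reflexive (trans (cong (up j *_) (m≤n⇒m∸n≡0 (<⇒≤ (≰⇒> j≰h)))) (*-zeroʳ (up j)))) z≤n
    ... | yes j≤h = proj₁ (ratio (≤-trans j≤h (order-reflects-≤ h l W≤X)) (≤-trans j≤h (order-reflects-≤ h m W≤Y))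
                                 (≤-trans j≤h (order-reflects-≤ h n W≤Z)) j≤h s refl) (begin
      W * (e₂ + s * s)                ≡⟨ *-distribˡ-+ W e₂ (s * s) ⟩
      W * e₂ + W * (s * s)            ≤⟨ +-mono-≤ We₂≤e₃ (*-monoˡ-≤ (s * s) (≤-trans W≤X (≤-trans (m≤m+n X Y) (m≤m+n _ Z)))) ⟩
      e₃ + (X + Y + Z) * (s * s)      ∎)
      where
      open ≤-Reasoning
      s = offset e j

    term : ∀ j → prod 0 * coef e h j ≤ prod j * coef e h 0
    term j = ratio-compare prod (coef e h) up down (λ j → h + e + suc j) (λ j → h ∸ j) j
      up>0 (step>0 h) prod-suc (coef-suc e h) (λ i _ → step i) j ≤-refl

    half : ∀ {A B} d → A ≤ B →
      prod 0 * ∑< A (λ j → coef e h (j + d)) ≤ ∑< B (λ j → prod (j + d)) * coef e h 0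
    half {A} {B} d A≤B = begin
      prod 0 * ∑< A (λ j → coef e h (j + d))      ≡⟨ ∑-*ˡ A (prod 0) (λ j → coef e h (j + d)) ⟨
      ∑< A (λ j → prod 0 * coef e h (j + d))      ≤⟨ ∑-mono A (λ j _ → term (j + d)) ⟩
      ∑< A (λ j → prod (j + d) * coef e h 0)      ≡⟨ ∑-*ʳ A (λ j → prod (j + d)) (coef e h 0) ⟩
      ∑< A (λ j → prod (j + d)) * coef e h 0      ≤⟨ *-monoˡ-≤ (coef e h 0) (∑-extend (λ j → prod (j + d)) A≤B) ⟩
      ∑< B (λ j → prod (j + d)) * coef e h 0      ∎
      where open ≤-Reasoning

    sum-lower : ∀ e′ → e + e′ ≡ 1 → prod 0 * 2 ^ (h + e + h) ≤ S e′ * coef e h 0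
    sum-lower e′ e+e′ = begin
      prod 0 * 2 ^ (h + e + h)
        ≡⟨ cong (prod 0 *_) (coef-sum e e′ e+e′ h) ⟨
      prod 0 * (∑< (suc h) Q + ∑< (h + e) Qʳ)
        ≡⟨ *-distribˡ-+ (prod 0) (∑< (suc h) Q) (∑< (h + e) Qʳ) ⟩
      prod 0 * ∑< (suc h) Q + prod 0 * ∑< (h + e) Qʳ
        ≡⟨ cong (λ x → prod 0 * x + prod 0 * ∑< (h + e) Qʳ) (∑-cong (suc h) λ j → cong Q (sym (+-identityʳ j))) ⟩
      prod 0 * ∑< (suc h) (λ j → Q (j + 0)) + prod 0 * ∑< (h + e) Qʳ
        ≤⟨ +-mono-≤ (half 0 (s≤s (order-reflects-≤ h m W≤Y))) (half e′ (+-monoˡ-≤ e (order-reflects-≤ h l W≤X))) ⟩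
      ∑< (suc m) (λ j → prod (j + 0)) * Q 0 + ∑< (l + e) (λ j → prod (j + e′)) * Q 0
        ≡⟨ cong (λ x → x * Q 0 + ∑< (l + e) (λ j → prod (j + e′)) * Q 0) (∑-cong (suc m) λ j → cong prod (+-identityʳ j)) ⟩
      ∑< (suc m) prod * Q 0 + ∑< (l + e) (λ j → prod (j + e′)) * Q 0
        ≡⟨ *-distribʳ-+ (Q 0) (∑< (suc m) prod) (∑< (l + e) (λ j → prod (j + e′))) ⟨
      S e′ * Q 0 ∎
      where
      open ≤-Reasoning
      Q Qʳ : ℕ → ℕ
      Q = coef e h
      Qʳ j = Q (j + e′)

  module Upper (M : ℕ) (3≤M : 3 ≤ M) {h} (e₃≤We₂ : suc M * e₃ ≤ M * (order e h * e₂))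
    (J : ℕ) (near : ∀ j → j < J → M * offset e j ≤ X × M * offset e j ≤ Y × M * offset e j ≤ Z)
    (far : X ≤ M * offset e J ⊎ Y ≤ M * offset e J ⊎ Z ≤ M * offset e J) where
    open Compare h

    instance
      M≢0 : NonZero M
      M≢0 = >-nonZero (≤-trans (s≤s z≤n) 3≤M)

    j≤l : ∀ {k j} → M * offset e j ≤ order e k → j ≤ k
    j≤l {k} {j} le = offset-reflects-≤ (≤-trans (m≤n*m (offset e j) M) le)

    -- The slack 1 + 1/M in `e₃≤We₂` pays for the terms in s²: when M s is at most X, Y and Z, these
    -- add up to at most e₃/M (`cubic`). The three summands there are absorbed by `3 ≤ M`.
    step : ∀ j → j < J → (h + e + suc j) * down j ≤ (h ∸ j) * up j
    step j j<J = subst₂ _≤_ (*-comm (down j) (h + e + suc j)) (*-comm (up j) (h ∸ j))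
      (proj₂ (ratio (j≤l sX) (j≤l sY) (j≤l sZ) j≤h s refl) T≤V)
      where
      open ≤-Reasoning
      s = offset e j
      sX : M * s ≤ X
      sX = proj₁ (near j j<J)
      sY : M * s ≤ Y
      sY = proj₁ (proj₂ (near j j<J))
      sZ : M * s ≤ Z
      sZ = proj₂ (proj₂ (near j j<J))
      e₃≤ : e₃ ≤ W * e₂
      e₃≤ = *-cancelˡ-≤ M (≤-trans (m≤n+m (M * e₃) e₃) e₃≤We₂)
      se₂≤e₃ : s * e₂ ≤ e₃
      se₂≤e₃ = *-cancelˡ-≤ 3 (begin
        3 * (s * e₂)                                              ≤⟨ *-monoˡ-≤ (s * e₂) 3≤M ⟩
        M * (s * e₂)                                              ≡⟨ re M s X Y Z ⟩
        (M * s) * (X * Y) + (M * s) * (Y * Z) + (M * s) * (Z * X) ≤⟨ +-mono-≤ (+-mono-≤ (*-monoˡ-≤ (X * Y) sZ) (*-monoˡ-≤ (Y * Z) sX)) (*-monoˡ-≤ (Z * X) sY) ⟩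
        Z * (X * Y) + X * (Y * Z) + Y * (Z * X)                   ≡⟨ re′ X Y Z ⟩
        3 * e₃                                                    ∎)
        where
        re : ∀ M s x y z → M * (s * (x * y + y * z + z * x)) ≡ (M * s) * (x * y) + (M * s) * (y * z) + (M * s) * (z * x)
        re = solve-∀
        re′ : ∀ x y z → z * (x * y) + x * (y * z) + y * (z * x) ≡ 3 * (x * y * z)
        re′ = solve-∀
      j≤h : j ≤ h
      j≤h = offset-reflects-≤ (*-cancelʳ-≤ s W e₂ {{>-nonZero e₂>0}} (≤-trans se₂≤e₃ e₃≤))
      cubic : M * ((X + Y + Z) * (s * s)) ≤ e₃
      cubic = *-cancelˡ-≤ 3 (begin
        3 * (M * ((X + Y + Z) * (s * s)))                         ≤⟨ *-monoˡ-≤ (M * ((X + Y + Z) * (s * s))) 3≤M ⟩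
        M * (M * ((X + Y + Z) * (s * s)))                         ≡⟨ re M s X Y Z ⟩
        X * ((M * s) * (M * s)) + Y * ((M * s) * (M * s)) + Z * ((M * s) * (M * s))
          ≤⟨ +-mono-≤ (+-mono-≤ (*-monoʳ-≤ X (*-mono-≤ sY sZ)) (*-monoʳ-≤ Y (*-mono-≤ sX sZ))) (*-monoʳ-≤ Z (*-mono-≤ sX sY)) ⟩
        X * (Y * Z) + Y * (X * Z) + Z * (X * Y)                   ≡⟨ re′ X Y Z ⟩
        3 * e₃                                                    ∎)
        where
        re : ∀ M s x y z → M * (M * ((x + y + z) * (s * s))) ≡
          x * ((M * s) * (M * s)) + y * ((M * s) * (M * s)) + z * ((M * s) * (M * s))
        re = solve-∀
        re′ : ∀ x y z → x * (y * z) + y * (x * z) + z * (x * y) ≡ 3 * (x * y * z)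
        re′ = solve-∀
      T≤V : e₃ + (X + Y + Z) * (s * s) ≤ W * (e₂ + s * s)
      T≤V = *-cancelˡ-≤ M (begin
        M * (e₃ + (X + Y + Z) * (s * s))          ≡⟨ *-distribˡ-+ M e₃ _ ⟩
        M * e₃ + M * ((X + Y + Z) * (s * s))      ≤⟨ +-monoʳ-≤ (M * e₃) cubic ⟩
        M * e₃ + e₃                               ≡⟨ +-comm (M * e₃) e₃ ⟩
        suc M * e₃                                ≤⟨ e₃≤We₂ ⟩
        M * (W * e₂)                              ≤⟨ *-monoʳ-≤ M (*-monoʳ-≤ W (m≤m+n e₂ (s * s))) ⟩
        M * (W * (e₂ + s * s))                    ∎)

    term : ∀ j → j ≤ J → prod j * coef e h 0 ≤ prod 0 * coef e h j
    term j j≤J = subst₂ _≤_ (*-comm (coef e h 0) (prod j)) (*-comm (coef e h j) (prod 0))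
      (ratio-compare (coef e h) prod (λ j → h + e + suc j) (λ j → h ∸ j) up down J
        (step>0 h) up>0 (coef-suc e h) prod-suc step j j≤J)

    -- One of the three orders is at most `M * offset e J`; `tail-bound` is applied to that row,
    -- with the product of the other two coefficients as the decreasing factor.
    tail : ∀ R → ∑< R (λ i → prod (J + i)) ≤ M * prod 0
    tail R = *-cancelˡ-≤ (offset e J) {{>-nonZero offset>0}} (≤-trans (bound far) (*-comm-≤))
      where
      open ≤-Reasoning
      offset>0 : 0 < offset e J
      offset>0 = ≤-trans (m≤n+m 1 (2 * J)) (m≤m+n _ e)
      *-comm-≤ : M * offset e J * prod 0 ≤ offset e J * (M * prod 0)
      *-comm-≤ = ≤-reflexive (re M (offset e J) (prod 0))
        where
        re : ∀ M o p → M * o * p ≡ o * (M * p)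
        re = solve-∀
      one : ∀ k (D : ℕ → ℕ) → (∀ j → D (suc j) ≤ D j) → (∀ j → prod j ≡ coef e k j * D j) →
        order e k ≤ M * offset e J → offset e J * ∑< R (λ i → prod (J + i)) ≤ M * offset e J * prod 0
      one k D decr eq le = begin
        offset e J * ∑< R (λ i → prod (J + i))                      ≡⟨ cong (offset e J *_) (∑-cong R λ i → eq (J + i)) ⟩
        offset e J * ∑< R (λ i → coef e k (J + i) * D (J + i))      ≤⟨ m≤m+n _ (order e k * (coef e k (J + R) * D (J + R))) ⟩
        offset e J * ∑< R (λ i → coef e k (J + i) * D (J + i)) + order e k * (coef e k (J + R) * D (J + R))
                                                                    ≤⟨ tail-bound e k D decr J R ⟩
        order e k * (coef e k J * D J)                              ≡⟨ cong (order e k *_) (sym (eq J)) ⟩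
        order e k * prod J                                          ≤⟨ *-mono-≤ le (prod-antitone 0 J) ⟩
        M * offset e J * prod 0                                     ∎
      bound : X ≤ M * offset e J ⊎ Y ≤ M * offset e J ⊎ Z ≤ M * offset e J →
        offset e J * ∑< R (λ i → prod (J + i)) ≤ M * offset e J * prod 0
      bound (inj₁ le)        = one l (λ j → coef e m j * coef e n j) (λ j → *-mono-≤ (coef-suc-≤ e m j) (coef-suc-≤ e n j))
        (λ j → *-assoc (coef e l j) (coef e m j) (coef e n j)) le
      bound (inj₂ (inj₁ le)) = one m (λ j → coef e l j * coef e n j) (λ j → *-mono-≤ (coef-suc-≤ e l j) (coef-suc-≤ e n j))
        (λ j → re (coef e l j) (coef e m j) (coef e n j)) le
        where
        re : ∀ a b c → a * b * c ≡ b * (a * c)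
        re = solve-∀
      bound (inj₂ (inj₂ le)) = one n (λ j → coef e l j * coef e m j) (λ j → *-mono-≤ (coef-suc-≤ e l j) (coef-suc-≤ e m j))
        (λ j → *-comm (coef e l j * coef e m j) (coef e n j)) le

    half : ∀ N R d → d ≤ 1 → (∀ j → N ≤ j → coef e h (j + d) ≡ 0) →
      ∑< R (λ j → prod (j + d)) * coef e h 0 ≤ prod 0 * ∑< N (λ j → coef e h (j + d)) + M * prod 0 * coef e h 0
    half N R d d≤1 vanish = begin
      ∑< R f * Q 0
        -- Lengthening the sum to `J + R` terms allows the cut at `J` whatever the size of `R`.
        ≤⟨ *-monoˡ-≤ (Q 0) (∑-extend f (m≤n+m R J)) ⟩
      ∑< (J + R) f * Q 0
        ≡⟨ cong (_* Q 0) (∑-append J R f) ⟩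
      (∑< J f + ∑< R (λ i → f (J + i))) * Q 0
        ≡⟨ *-distribʳ-+ (Q 0) (∑< J f) (∑< R (λ i → f (J + i))) ⟩
      ∑< J f * Q 0 + ∑< R (λ i → f (J + i)) * Q 0
        ≡⟨ cong (_+ ∑< R (λ i → f (J + i)) * Q 0) (∑-*ʳ J f (Q 0)) ⟨
      ∑< J (λ j → f j * Q 0) + ∑< R (λ i → f (J + i)) * Q 0
        -- The termwise comparison reaches `J` itself, which leaves room for the shift by `d ≤ 1`.
        ≤⟨ +-mono-≤ (∑-mono J λ j j<J → term (j + d) (≤-trans (+-monoʳ-≤ j d≤1) (≤-trans (≤-reflexive (+-comm j 1)) j<J)))
             (*-monoˡ-≤ (Q 0) (≤-trans (∑-mono R λ i _ → prod-antitone (J + i) d) (tail R))) ⟩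
      ∑< J (λ j → prod 0 * Q (j + d)) + M * prod 0 * Q 0
        ≡⟨ cong (_+ M * prod 0 * Q 0) (∑-*ˡ J (prod 0) (λ j → Q (j + d))) ⟩
      prod 0 * ∑< J (λ j → Q (j + d)) + M * prod 0 * Q 0
        ≤⟨ +-monoˡ-≤ _ (*-monoʳ-≤ (prod 0) (∑-support J N vanish)) ⟩
      prod 0 * ∑< N (λ j → Q (j + d)) + M * prod 0 * Q 0 ∎
      where
      open ≤-Reasoning
      Q = coef e h
      f : ℕ → ℕ
      f j = prod (j + d)

    sum-upper : ∀ e′ → e + e′ ≡ 1 → S e′ * coef e h 0 ≤ prod 0 * 2 ^ (h + e + h) + 2 * M * prod 0 * coef e h 0
    sum-upper e′ e+e′ = begin
      S e′ * Q 0
        ≡⟨ *-distribʳ-+ (Q 0) (∑< (suc m) prod) (∑< (l + e) (λ j → prod (j + e′))) ⟩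
      ∑< (suc m) prod * Q 0 + ∑< (l + e) (λ j → prod (j + e′)) * Q 0
        ≡⟨ cong (λ x → x * Q 0 + ∑< (l + e) (λ j → prod (j + e′)) * Q 0) (∑-cong (suc m) λ j → cong prod (sym (+-identityʳ j))) ⟩
      ∑< (suc m) (λ j → prod (j + 0)) * Q 0 + ∑< (l + e) (λ j → prod (j + e′)) * Q 0
        ≤⟨ +-mono-≤
             (half (suc h) (suc m) 0 z≤n (λ j h<j → coef-vanish e (≤-trans h<j (m≤m+n j 0))))
             (half (h + e) (l + e) e′ (≤-trans (m≤n+m e′ e) (≤-reflexive e+e′)) λ j h≤j → coef-vanish e (beyond j h≤j)) ⟩
      (prod 0 * ∑< (suc h) (λ j → Q (j + 0)) + M * prod 0 * Q 0) + (prod 0 * ∑< (h + e) (λ j → Q (j + e′)) + M * prod 0 * Q 0)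
        ≡⟨ re (prod 0) (∑< (suc h) (λ j → Q (j + 0))) (∑< (h + e) (λ j → Q (j + e′))) M (Q 0) ⟩
      prod 0 * (∑< (suc h) (λ j → Q (j + 0)) + ∑< (h + e) (λ j → Q (j + e′))) + 2 * M * prod 0 * Q 0
        ≡⟨ cong (λ x → prod 0 * (x + ∑< (h + e) (λ j → Q (j + e′))) + 2 * M * prod 0 * Q 0) (∑-cong (suc h) λ j → cong Q (+-identityʳ j)) ⟩
      prod 0 * twoSided e′ (suc h) (h + e) Q + 2 * M * prod 0 * Q 0
        ≡⟨ cong (λ x → prod 0 * x + 2 * M * prod 0 * Q 0) (coef-sum e e′ e+e′ h) ⟩
      prod 0 * 2 ^ (h + e + h) + 2 * M * prod 0 * Q 0 ∎
      where
      open ≤-Reasoning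
      Q = coef e h
      beyond : ∀ j → h + e ≤ j → suc h ≤ j + e′
      beyond j h≤j = ≤-trans (≤-reflexive (trans (+-comm 1 h) (trans (cong (h +_) (sym e+e′)) (sym (+-assoc h e e′))))) (+-monoˡ-≤ e′ h≤j)
      re : ∀ p a b M q → (p * a + M * p * q) + (p * b + M * p * q) ≡ p * (a + b) + 2 * M * p * q
      re = solve-∀

-- Choice of the tolerances and of the comparison rows

order-exists : ∀ e d N → 0 < d → suc e * d ≤ N → ∃[ h ] order e h * d ≤ N × N < order e (suc h) * d
order-exists e d N 0<d small = search N (≤-trans (s≤s (≤-trans (m≤n+m N (suc (N + e))) (n≤1+n _)))
    (≤-trans (≤-reflexive (trans (cong (λ x → suc (suc x)) (sym (+-suc (N + e) N))) (sym (*-identityʳ _)))) (*-monoʳ-≤ (order e (suc N)) 0<d)))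
  where
  search : ∀ h → N < order e (suc h) * d → ∃[ h ] order e h * d ≤ N × N < order e (suc h) * d
  search zero    lt = 0 , ≤-trans (≤-reflexive (cong (λ k → suc k * d) (+-identityʳ e))) small , lt
  search (suc h) lt with order e (suc h) * d ≤? N
  ... | yes le = suc h , le , lt
  ... | no ¬le = search h (≰⇒> ¬le)

order-suc : ∀ e h → order e (suc h) ≡ 2 + order e h
order-suc e h = cong (λ k → suc (suc k)) (+-suc (h + e) h)

order-bound : ∀ {e h g} → e ≤ 1 → 2 * g + 2 < order e h → g < h
order-bound {e} {h} {g} e≤1 lt = *-cancelˡ-< 2 g h (+-cancelʳ-< 2 (2 * g) (2 * h) (≤-trans lt (begin
  suc (h + e + h)   ≤⟨ s≤s (+-monoˡ-≤ h (+-monoʳ-≤ h e≤1)) ⟩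
  suc (h + 1 + h)   ≡⟨ re h ⟩
  2 * h + 2         ∎)))
  where
  open ≤-Reasoning
  re : ∀ h → 1 + (h + 1 + h) ≡ 2 * h + 2
  re = solve-∀

4^n≡2^n*2^n : ∀ n → 4 ^ n ≡ 2 ^ n * 2 ^ n
4^n≡2^n*2^n zero    = refl
4^n≡2^n*2^n (suc n) = trans (cong (4 *_) (4^n≡2^n*2^n n)) (re (2 ^ n))
  where
  re : ∀ a → 4 * (a * a) ≡ 2 * a * (2 * a)
  re = solve-∀

-- The summands of the margin serve `coef-small` (4M⁴) and the two Wallis estimates (4M and 2 + 2M).
-- The threshold is 3 * 2 * (margin + 2): orders that large make 1/X + 1/Y + 1/Z at most 1/(2
-- (margin + 2)), so that the comparison row also has index above the margin.
threshold margin : ℕ → ℕ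
margin M = 4 * (M * M * (M * M)) + 4 * M + 2
threshold M = 6 * margin M + 12

-- Here tx, ty, tz and u² stand for the powers of 4, cx, cy, cz and c for the
-- central coefficients, and p / q for π; as variables they are not unfolded.
module Combine (M tx ty tz q p X Y Z cx cy cz s e₂ : ℕ)
  (0<q : 0 < q) (0<p : 0 < p) (0<e₃ : 0 < X * Y * Z) where

  open Approximate M

  private
    e₃ = X * Y * Z
    F = (2 * tx * q) * (2 * ty * q) * (2 * tz * q)
    G = (cx * cx * X * p) * (cy * cy * Y * p) * (cz * cz * Z * p)
    P₀ = cx * cy * cz

    factor>0 : ∀ {u} → 0 < u → 0 < 2 * (u * u) * q * p * e₃
    factor>0 0<u = *-mono-≤ (*-mono-≤ (*-mono-≤ (*-mono-≤ {1} {2} (s≤s z≤n) (*-mono-≤ 0<u 0<u)) 0<q) 0<p) 0<e₃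

    left : ∀ w → 2 * w * q * p * e₃ * (4 * (tx * ty * tz) * (q * q)) ≡ F * (w * p) * e₃
    left w = re tx ty tz w q p e₃
      where
      re : ∀ a b c w q p e → 2 * w * q * p * e * (4 * (a * b * c) * (q * q)) ≡ (2 * a * q) * (2 * b * q) * (2 * c * q) * (w * p) * e
      re = solve-∀

    middle : ∀ w W → G * (w * p * (W * e₂)) ≡ P₀ * P₀ * w * (e₃ * (p * p * p) * (p * W * e₂))
    middle w W = trans (cong (_* (w * p * (W * e₂))) (re₁ cx cy cz X Y Z p)) (re₂ P₀ e₃ p w W e₂)
      where
      re₁ : ∀ a b c X Y Z p → (a * a * X * p) * (b * b * Y * p) * (c * c * Z * p) ≡ (a * b * c) * (a * b * c) * (X * Y * Z * (p * p * p))
      re₁ = solve-∀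
      re₂ : ∀ a x p w W e → a * a * (x * (p * p * p)) * (w * p * (W * e)) ≡ a * a * w * (x * (p * p * p) * (p * W * e))
      re₂ = solve-∀

    right : ∀ W c → (s * s) * (c * c) * (e₃ * (p * p * p) * (p * W * e₂)) ≡ s * s * (p * p) * e₂ * (p * e₃) * (c * c * W * p)
    right W c = re s c e₃ p W e₂
      where
      re : ∀ s c x p W e → (s * s) * (c * c) * (x * (p * p * p) * (p * W * e)) ≡ s * s * (p * p) * e * (p * x) * (c * c * W * p)
      re = solve-∀

    last : ∀ w → s * s * (p * p) * e₂ * (p * e₃) * (2 * w * q) ≡ 2 * w * q * p * e₃ * (s * s * (p * p) * e₂)
    last w = re (s * s * (p * p) * e₂) p e₃ w q
      where
      re : ∀ a p e w q → a * (p * e) * (2 * w * q) ≡ 2 * w * q * p * e * a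
      re = solve-∀

    square : ∀ a b → (a * b) * (a * b) ≡ (a * a) * (b * b)
    square = solve-∀

  -- The squared sum estimate is multiplied by the Wallis estimates, so that c, W and the three
  -- central coefficients cancel and S² π² e₂ remains. The exponent 6 is 3 for the lower Wallis
  -- bounds of the three rows, 2 for the upper one of the comparison row and 1 for e₃ against W e₂.
  total-lower : ∀ u W c → 0 < u → P₀ * u ≤ s * c → F ≲[ 3 ] G → c * c * W * p ≲[ 2 ] 2 * (u * u) * q →
    e₃ ≲[ 1 ] W * e₂ → 4 * (tx * ty * tz) * (q * q) ≲[ 6 ] s * s * (p * p) * e₂
  total-lower u W c 0<u sum F≲G wallis e₃≲We₂ = ≲-cancelˡ (2 * (u * u) * q * p * e₃) (factor>0 0<u)
    (≤-≲-trans (≤-reflexive (left (u * u)))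
    (≲-trans (≲-*ˡ (F * (u * u * p)) e₃≲We₂)
    (≤-≲-trans (≤-reflexive (*-assoc F (u * u * p) (W * e₂)))
    (≲-trans (≲-* F≲G (≤⇒≲ (≤-refl {u * u * p * (W * e₂)})))
    (≤-≲-trans (≤-reflexive (middle (u * u) W))
    (≤-≲-trans (*-monoˡ-≤ (e₃ * (p * p * p) * (p * W * e₂)) (subst₂ _≤_ (square P₀ u) (square s c) (*-mono-≤ sum sum)))
    (≤-≲-trans (≤-reflexive (right W c))
    (≲-≤-trans (≲-*ˡ (s * s * (p * p) * e₂ * (p * e₃)) wallis)
    (≤-reflexive (last (u * u)))))))))))

  -- The exponent 11 is 1 for the comparison row, 2 for the squared sum estimate, 6 for the upper
  -- Wallis bounds of the three rows and 2 for W e₂ against e₃.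
  total-upper : ∀ u W c → 0 < u → s * c ≲[ 1 ] P₀ * u → G ≲[ 6 ] F → 2 * (u * u) * q ≲[ 1 ] c * c * W * p →
    W * e₂ ≲[ 2 ] e₃ → s * s * (p * p) * e₂ ≲[ 11 ] 4 * (tx * ty * tz) * (q * q)
  total-upper u W c 0<u sum G≲F wallis We₂≲e₃ = ≲-cancelˡ (2 * (u * u) * q * p * e₃) (factor>0 0<u)
    (≤-≲-trans (≤-reflexive (sym (last (u * u))))
    (≲-trans (≲-*ˡ (s * s * (p * p) * e₂ * (p * e₃)) wallis)
    (≤-≲-trans (≤-reflexive (sym (right W c)))
    (≲-trans (≲-* (subst₂ _≲[ 2 ]_ (square s c) (square P₀ u) (≲-* sum sum)) (≤⇒≲ (≤-refl {e₃ * (p * p * p) * (p * W * e₂)})))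
    (≤-≲-trans (≤-reflexive (sym (middle (u * u) W)))
    (≲-trans (≲-* G≲F (≤⇒≲ (≤-refl {u * u * p * (W * e₂)})))
    (≤-≲-trans (≤-reflexive (sym (*-assoc F (u * u * p) (W * e₂))))
    (≲-≤-trans (≲-*ˡ (F * (u * u * p)) We₂≲e₃)
    (≤-reflexive (sym (left (u * u))))))))))))

  module _ (power D t k : ℕ) (power-sq : power * power ≡ 4 * (tx * ty * tz)) where

    private
      re₁ : (power * (q * k)) * (power * (q * k)) ≡ 4 * (tx * ty * tz) * (q * q) * (k * k)
      re₁ = trans (re power q k) (cong (λ u → u * (q * q) * (k * k)) power-sq)
        where
        re : ∀ a q k → (a * (q * k)) * (a * (q * k)) ≡ a * a * (q * q) * (k * k)
        re = solve-∀
      re₂ : s * s * (p * p) * (t * t) ≡ s * p * t * (s * p * t)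
      re₂ = re s p t
        where
        re : ∀ s p t → s * s * (p * p) * (t * t) ≡ s * p * t * (s * p * t)
        re = solve-∀

    -- The exponents 6 + 2 + 2 = 10 here and 11 in `root-upper` are both padded to 12, so that
    -- taking roots gives 6 in either direction.
    root-lower : e₂ ≲[ 2 ] D → D * (k * k) ≲[ 2 ] t * t → 4 * (tx * ty * tz) * (q * q) ≲[ 6 ] s * s * (p * p) * e₂ →
      power * (q * k) ≲[ 6 ] s * p * t
    root-lower e₂≲D Dkk≲tt total = ≲-sqrt 6 (≲-pad (≲-pad
      (≤-≲-trans (≤-reflexive re₁)
      (≲-trans (≲-* (≲-trans total (≲-*ˡ (s * s * (p * p)) e₂≲D)) (≤⇒≲ (≤-refl {k * k})))
      (≤-≲-trans (≤-reflexive (*-assoc (s * s * (p * p)) D (k * k)))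
      (≲-≤-trans (≲-*ˡ (s * s * (p * p)) Dkk≲tt)
      (≤-reflexive re₂)))))))

    root-upper : D ≤ e₂ → t * t ≤ D * (k * k) → s * s * (p * p) * e₂ ≲[ 11 ] 4 * (tx * ty * tz) * (q * q) →
      s * p * t ≲[ 6 ] power * (q * k)
    root-upper D≤e₂ tt≤Dkk total = ≲-sqrt 6 (≲-pad
      (≤-≲-trans (≤-reflexive (sym re₂))
      (≤-≲-trans (*-monoʳ-≤ (s * s * (p * p)) (≤-trans tt≤Dkk (*-monoˡ-≤ (k * k) D≤e₂)))
      (≤-≲-trans (≤-reflexive (sym (*-assoc (s * s * (p * p)) e₂ (k * k))))
      (≲-≤-trans (≲-* total (≤⇒≲ (≤-refl {k * k})))
      (≤-reflexive (sym re₁)))))))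

margin-bounds : ∀ M → M ≤ margin M × 4 * M ≤ margin M × 2 + 2 * M ≤ margin M × 4 * (M * M * (M * M)) ≤ margin M
margin-bounds M = ≤-trans (m≤n*m M 4) 4M≤ , 4M≤
  , ≤-trans (≤-reflexive (+-comm 2 (2 * M))) (+-monoˡ-≤ 2 (≤-trans (*-monoˡ-≤ M {2} {4} (s≤s (s≤s z≤n))) (m≤n+m (4 * M) Q)))
  , ≤-trans (m≤m+n Q (4 * M)) (m≤m+n _ 2)
  where
  Q = 4 * (M * M * (M * M))
  4M≤ : 4 * M ≤ margin M
  4M≤ = ≤-trans (m≤n+m (4 * M) Q) (m≤m+n _ 2)

-- The orders W with W e₂ slightly below e₃ and slightly above e₃ (1 + 1/M), and
-- the offset J which separates the bulk of the sum from its tail.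
module Comparators (M : ℕ) (3≤M : 3 ≤ M) (e : ℕ) (e≤1 : e ≤ 1) (X Y Z : ℕ)
  (X≥ : threshold M ≤ X) (Y≥ : threshold M ≤ Y) (Z≥ : threshold M ≤ Z) where

  open Approximate M

  private
    g e₂ e₃ : ℕ
    g = margin M
    e₂ = X * Y + Y * Z + Z * X
    e₃ = X * Y * Z

    M≥1 : 1 ≤ M
    M≥1 = ≤-trans (s≤s z≤n) 3≤M

    M≤g : M ≤ g
    M≤g = proj₁ (margin-bounds M)

    threshold>0 : 0 < threshold M
    threshold>0 = ≤-trans (s≤s z≤n) (m≤n+m 12 (6 * g))

    e₂>0 : 0 < e₂
    e₂>0 = ≤-trans (*-mono-≤ (≤-trans threshold>0 X≥) (≤-trans threshold>0 Y≥)) (≤-trans (m≤m+n (X * Y) (Y * Z)) (m≤m+n _ (Z * X)))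

    e₂*margin : 2 * (g + 2) * e₂ ≤ e₃
    e₂*margin = *-cancelˡ-≤ 3 (begin
      3 * (2 * (g + 2) * e₂)                          ≡⟨ re₀ g e₂ ⟩
      K * (X * Y + Y * Z + Z * X)                     ≡⟨ re K X Y Z ⟩
      K * (X * Y) + K * (Y * Z) + K * (Z * X)         ≤⟨ +-mono-≤ (+-mono-≤ (*-monoˡ-≤ (X * Y) Z≥) (*-monoˡ-≤ (Y * Z) X≥)) (*-monoˡ-≤ (Z * X) Y≥) ⟩
      Z * (X * Y) + X * (Y * Z) + Y * (Z * X)         ≡⟨ re′ X Y Z ⟩
      3 * e₃                                          ∎)
      where
      open ≤-Reasoning
      K = 6 * g + 12
      re₀ : ∀ g e → 3 * (2 * (g + 2) * e) ≡ (6 * g + 12) * e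
      re₀ = solve-∀
      re : ∀ K x y z → K * (x * y + y * z + z * x) ≡ K * (x * y) + K * (y * z) + K * (z * x)
      re = solve-∀
      re′ : ∀ x y z → z * (x * y) + x * (y * z) + y * (z * x) ≡ 3 * (x * y * z)
      re′ = solve-∀

    suc-e₂≤e₃ : suc e * e₂ ≤ e₃
    suc-e₂≤e₃ = ≤-trans (*-monoˡ-≤ e₂ (≤-trans (s≤s e≤1) (≤-trans (m≤n+m 2 g) (m≤n*m (g + 2) 2)))) e₂*margin

    large : ∀ {k} → 2 * (g + 2) < order e k + 2 → g < k
    large {k} lt = order-bound {e} {k} {g} e≤1 (+-cancelʳ-< 2 _ _ (≤-trans (≤-reflexive (cong suc (re g))) lt))
      where
      re : ∀ g → 2 * g + 2 + 2 ≡ 2 * (g + 2)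
      re = solve-∀

    x∙yz : ∀ s M e → s * (M * e) ≡ M * (s * e)
    x∙yz = solve-∀

  large-side : ∀ {k} → threshold M ≤ order e k → g < k
  large-side {k} le = large (≤-trans (≤-trans (s≤s (≤-trans (≤-trans (m≤n*m (2 * (g + 2)) 3) (≤-reflexive (re g))) le)) (n≤1+n _)) (≤-reflexive (+-comm 2 (order e k))))
    where
    re : ∀ g → 3 * (2 * (g + 2)) ≡ 6 * g + 12
    re = solve-∀

  inner : ∃[ h ] g < h × order e h * e₂ ≤ e₃ × e₃ ≲[ 1 ] order e h * e₂
  inner = from (order-exists e e₂ e₃ e₂>0 suc-e₂≤e₃)
    where
    from : ∃[ h ] order e h * e₂ ≤ e₃ × e₃ < order e (suc h) * e₂ → ∃[ h ] g < h × order e h * e₂ ≤ e₃ × e₃ ≲[ 1 ] order e h * e₂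
    from (h , We₂≤e₃ , e₃<) = h , g<h , We₂≤e₃ , ≲-step (begin
      M * e₃                                       ≤⟨ *-monoʳ-≤ M (<⇒≤ e₃<W+2) ⟩
      M * ((W + 2) * e₂)                           ≡⟨ re M W e₂ ⟩
      2 * M * e₂ + M * (W * e₂)                    ≤⟨ +-monoˡ-≤ _ (*-monoˡ-≤ e₂ 2M≤W) ⟩
      W * e₂ + M * (W * e₂)                        ∎)
      where
      open ≤-Reasoning
      W = order e h
      e₃<W+2 : e₃ < (W + 2) * e₂
      e₃<W+2 = ≤-trans e₃< (≤-reflexive (cong (_* e₂) (trans (order-suc e h) (+-comm 2 W))))
      g<h : g < h
      g<h = large (*-cancelʳ-< e₂ (2 * (g + 2)) (W + 2) (≤-trans (s≤s e₂*margin) e₃<W+2))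
      M≤h : M ≤ h
      M≤h = ≤-trans M≤g (<⇒≤ g<h)
      2M≤W : 2 * M ≤ W
      2M≤W = ≤-trans (≤-trans (≤-reflexive (cong (M +_) (+-identityʳ M))) (+-mono-≤ (≤-trans M≤h (m≤m+n h e)) M≤h)) (n≤1+n _)
      re : ∀ M W e → M * ((W + 2) * e) ≡ 2 * M * e + M * (W * e)
      re = solve-∀

  -- Of the exponent 2, one unit is the slack that `Upper` asks for; the other covers rounding up to
  -- the next order of the right parity, which is larger by 2. The two fit because M (M + 2) + 1 =
  -- (M + 1)².
  outer : ∃[ h ] g < h × suc M * e₃ ≤ M * (order e h * e₂) × order e h * e₂ ≲[ 2 ] e₃
  outer = from (order-exists e (M * e₂) (suc M * e₃) (*-mono-≤ M≥1 e₂>0)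
      (≤-trans (≤-reflexive (x∙yz (suc e) M e₂)) (≤-trans (*-monoʳ-≤ M suc-e₂≤e₃) (m≤n+m (M * e₃) e₃))))
    where
    from : ∃[ h ] order e h * (M * e₂) ≤ suc M * e₃ × suc M * e₃ < order e (suc h) * (M * e₂) →
      ∃[ h ] g < h × suc M * e₃ ≤ M * (order e h * e₂) × order e h * e₂ ≲[ 2 ] e₃
    from (h₀ , W₀≤ , <W) = suc h₀ , g<h , e₃≤We₂ , approx (begin
      M ^ 2 * (order e (suc h₀) * e₂)                ≡⟨ cong (λ w → M ^ 2 * (w * e₂)) (order-suc e h₀) ⟩
      M ^ 2 * ((2 + W₀) * e₂)                        ≡⟨ re M W₀ e₂ ⟩
      M * (W₀ * (M * e₂) + 2 * M * e₂)               ≤⟨ *-monoʳ-≤ M (+-mono-≤ W₀≤ (≤-trans (*-monoˡ-≤ e₂ (*-monoʳ-≤ 2 (≤-trans M≤g (m≤m+n g 2)))) e₂*margin)) ⟩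
      M * (suc M * e₃ + e₃)                          ≤⟨ m≤m+n _ e₃ ⟩
      M * (suc M * e₃ + e₃) + e₃                     ≡⟨ re′ M e₃ ⟩
      suc M ^ 2 * e₃                                 ∎)
      where
      open ≤-Reasoning
      W₀ = order e h₀
      e₃≤We₂ : suc M * e₃ ≤ M * (order e (suc h₀) * e₂)
      e₃≤We₂ = ≤-trans (<⇒≤ <W) (≤-reflexive (x∙yz (order e (suc h₀)) M e₂))
      g<h : g < suc h₀
      g<h = large (≤-trans (s≤s (*-cancelʳ-≤ (2 * (g + 2)) (order e (suc h₀)) e₂ {{>-nonZero e₂>0}} (≤-trans e₂*margin
        (*-cancelˡ-≤ M {{>-nonZero M≥1}} (≤-trans (m≤n+m (M * e₃) e₃) e₃≤We₂))))) (≤-trans (n≤1+n _) (≤-reflexive (+-comm 2 (order e (suc h₀))))))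
      re : ∀ M w e → M * (M * 1) * ((2 + w) * e) ≡ M * (w * (M * e) + 2 * M * e)
      re = solve-∀
      re′ : ∀ M e → M * ((1 + M) * e + e) + e ≡ (1 + M) * ((1 + M) * 1) * e
      re′ = solve-∀

  Near Far : ℕ → Set
  Near J = ∀ j → j < J → M * offset e j ≤ X × M * offset e j ≤ Y × M * offset e j ≤ Z
  Far J = X ≤ M * offset e J ⊎ Y ≤ M * offset e J ⊎ Z ≤ M * offset e J

  -- Offsets and orders are given by the same formula, so `order-exists` finds where M times the
  -- offset crosses the smallest of X, Y, Z.
  window : ∃[ J ] Near J × Far J
  window = from (order-exists e M μ M≥1 (≤-trans (*-monoˡ-≤ M (s≤s e≤1)) (⊓-glb (⊓-glb (2M≤ X≥) (2M≤ Y≥)) (2M≤ Z≥))))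
    where
    μ : ℕ
    μ = X ⊓ Y ⊓ Z
    2M≤ : ∀ {x} → threshold M ≤ x → 2 * M ≤ x
    2M≤ le = ≤-trans (≤-trans (≤-trans (*-monoˡ-≤ M {2} {4} (s≤s (s≤s z≤n))) (proj₁ (proj₂ (margin-bounds M)))) (≤-trans (m≤n*m g 6) (m≤m+n (6 * g) 12))) le
    offset≡order : ∀ j → offset e j ≡ order e j
    offset≡order j = re e j
      where
      re : ∀ e j → 2 * j + 1 + e ≡ 1 + (j + e + j)
      re = solve-∀
    from : ∃[ h ] order e h * M ≤ μ × μ < order e (suc h) * M → ∃[ J ] Near J × Far J
    from (h , ≤μ , μ<) = suc h , near , far
      where
      near : Near (suc h)
      near j (s≤s j≤) = ≤-trans le (≤-trans (m⊓n≤m (X ⊓ Y) Z) (m⊓n≤m X Y)) , ≤-trans le (≤-trans (m⊓n≤m (X ⊓ Y) Z) (m⊓n≤n X Y)) , ≤-trans le (m⊓n≤n (X ⊓ Y) Z)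
        where
        le : M * offset e j ≤ μ
        le = ≤-trans (≤-reflexive (trans (cong (M *_) (offset≡order j)) (*-comm M (order e j))))
          (≤-trans (*-monoˡ-≤ M (s≤s (+-mono-≤ (+-monoˡ-≤ e j≤) j≤))) ≤μ)
      μ≤ : μ ≤ M * offset e (suc h)
      μ≤ = ≤-trans (<⇒≤ μ<) (≤-reflexive (trans (*-comm (order e (suc h)) M) (cong (M *_) (sym (offset≡order (suc h))))))
      far : Far (suc h)
      far with ⊓-sel (X ⊓ Y) Z | ⊓-sel X Y
      ... | inj₁ eq | inj₁ eq′ = inj₁ (subst (_≤ M * offset e (suc h)) (trans eq eq′) μ≤)
      ... | inj₁ eq | inj₂ eq′ = inj₂ (inj₁ (subst (_≤ M * offset e (suc h)) (trans eq eq′) μ≤))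
      ... | inj₂ eq | _        = inj₂ (inj₂ (subst (_≤ M * offset e (suc h)) eq μ≤))

-- Follows from c² W ≤ 4^(W-1) and W ≥ 4M⁴ by taking roots. It makes the tail term of `sum-upper` at
-- most 1/M of the main term.
coef-small : ∀ M {e h} → e ≤ 1 → margin M < h → 2 * (M * M) * coef e h 0 ≤ 2 ^ (h + e + h)
coef-small M {e} {h} e≤1 g<h = ≮⇒≥ λ lt → <⇒≱ (*-mono-< lt lt) (begin
  (2 * (M * M) * c) * (2 * (M * M) * c)        ≡⟨ re M c ⟩
  c * c * (4 * (M * M * (M * M)))              ≤⟨ *-monoʳ-≤ (c * c) W-large ⟩
  c * c * order e h                            ≤⟨ coef-sq-≤ e≤1 (≤-trans (s≤s z≤n) g<h) ⟩
  4 ^ (h + e + h)                              ≡⟨ 4^n≡2^n*2^n (h + e + h) ⟩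
  2 ^ (h + e + h) * 2 ^ (h + e + h)            ∎)
  where
  open ≤-Reasoning
  c = coef e h 0
  re : ∀ M c → (2 * (M * M) * c) * (2 * (M * M) * c) ≡ c * c * (4 * (M * M * (M * M)))
  re = solve-∀
  W-large : 4 * (M * M * (M * M)) ≤ order e h
  W-large = ≤-trans (proj₂ (proj₂ (proj₂ (margin-bounds M)))) (≤-trans (<⇒≤ g<h) (≤-trans (m≤n+m h (h + e)) (n≤1+n _)))

sum-absorb : ∀ M {s c p₀ u} → 2 * (M * M) * c ≤ u → s * c ≤ p₀ * u + 2 * M * p₀ * c →
  let open Approximate M in s * c ≲[ 1 ] p₀ * u
sum-absorb M {s} {c} {p₀} {u} c-small le = Approximate.≲-step M (begin
  M * (s * c)                                   ≤⟨ *-monoʳ-≤ M le ⟩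
  M * (p₀ * u + 2 * M * p₀ * c)                 ≡⟨ re M p₀ u c ⟩
  p₀ * (2 * (M * M) * c) + M * (p₀ * u)         ≤⟨ +-monoˡ-≤ _ (*-monoʳ-≤ p₀ c-small) ⟩
  p₀ * u + M * (p₀ * u)                         ∎)
  where
  open ≤-Reasoning
  re : ∀ M p t c → M * (p * t + 2 * M * p * c) ≡ p * (2 * (M * M) * c) + M * (p * t)
  re = solve-∀

-- Two-sided estimate of the symmetric sum

wallisBound : ℕ → ℕ
wallisBound k = wallisIndex k + wallisIndex (suc k)

module CoefEstimates (M : ℕ) (3≤M : 3 ≤ M) {e : ℕ} (e≤1 : e ≤ 1) (k : ℕ) (0<k : 0 < k) where

  open Approximate M
  open Wallis M k 0<k

  coef-upper : ∀ {j} → margin M < j → coef e j 0 * coef e j 0 * order e j * p ≲[ 2 ] 2 * 4 ^ (j + e + j) * q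
  coef-upper g<j = coef-wallis-upper e≤1 (≤-trans (s≤s z≤n) g<j) (≤-trans (proj₁ (proj₂ (margin-bounds M))) (<⇒≤ g<j))

  coef-lower : ∀ {j} → margin M < j → wallisBound j ≤ k →
    2 * 4 ^ (j + e + j) * q ≲[ 1 ] coef e j 0 * coef e j 0 * order e j * p
  coef-lower {j} g<j le = coef-wallis-lower e≤1 (≤-trans (s≤s z≤n) g<j) (≤-trans (proj₁ (proj₂ (proj₂ (margin-bounds M)))) (<⇒≤ g<j))
    (≤-trans (m≤m+n _ (wallisIndex (suc j))) le) (≤-trans (m≤n+m _ (wallisIndex j)) le)

  q-positive : 0 < q
  q-positive = *-mono-≤ 0<k 0<k

  -- The lower Wallis estimate bounds a positive number by a multiple of `p`.
  p-positive : ∀ {j} → margin M < j → wallisBound j ≤ k → 0 < p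
  p-positive {j} g<j le = n≢0⇒n>0 λ p≡0 → <⇒≱ positive (≤-trans (bound (coef-lower g<j le))
      (≤-reflexive (trans (cong (λ z → suc M ^ 1 * (x * z)) p≡0) (trans (cong (suc M ^ 1 *_) (*-zeroʳ x)) (*-zeroʳ (suc M ^ 1))))))
    where
    x = coef e j 0 * coef e j 0 * order e j
    positive : 0 < M ^ 1 * (2 * 4 ^ (j + e + j) * q)
    positive = *-mono-≤ (*-mono-≤ (≤-trans (s≤s z≤n) 3≤M) (≤-refl {1})) (*-mono-≤ (*-mono-≤ {1} {2} (s≤s z≤n) (m^n>0 4 (j + e + j))) q-positive)

module SumEstimate (M : ℕ) (3≤M : 3 ≤ M) (e e′ : ℕ) (e+e′ : e + e′ ≡ 1) (l m n : ℕ)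
  (X≥ : threshold M ≤ order e l) (Y≥ : threshold M ≤ order e m) (Z≥ : threshold M ≤ order e n) where

  open Approximate M
  open Product e l m n

  private
    e≤1 : e ≤ 1
    e≤1 = ≤-trans (m≤m+n e e′) (≤-reflexive e+e′)

    M≥1 : 1 ≤ M
    M≥1 = ≤-trans (s≤s z≤n) 3≤M

  open Comparators M 3≤M e e≤1 X Y Z X≥ Y≥ Z≥

  x y z D power : ℕ
  x = l + e + l
  y = m + e + m
  z = n + e + n
  D = x * y + y * z + z * x
  power = 2 ^ (x + y + z + 1)

  power-sq : power * power ≡ 4 * (4 ^ x * 4 ^ y * 4 ^ z)
  power-sq = begin
    power * power                                  ≡⟨ 4^n≡2^n*2^n (x + y + z + 1) ⟨
    4 ^ (x + y + z + 1)                            ≡⟨ ^-distribˡ-+-* 4 (x + y + z) 1 ⟩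
    4 ^ (x + y + z) * 4                            ≡⟨ *-comm (4 ^ (x + y + z)) 4 ⟩
    4 * 4 ^ (x + y + z)                            ≡⟨ cong (4 *_) (trans (^-distribˡ-+-* 4 (x + y) z) (cong (_* 4 ^ z) (^-distribˡ-+-* 4 x y))) ⟩
    4 * (4 ^ x * 4 ^ y * 4 ^ z)                    ∎
    where open ≡-Reasoning

  D≤e₂ : D ≤ e₂
  D≤e₂ = +-mono-≤ (+-mono-≤ (*-mono-≤ (n≤1+n x) (n≤1+n y)) (*-mono-≤ (n≤1+n y) (n≤1+n z))) (*-mono-≤ (n≤1+n z) (n≤1+n x))

  M≤side : ∀ {j} → margin M < j → M ≤ j + e + j
  M≤side {j} g<j = ≤-trans (proj₁ (margin-bounds M)) (≤-trans (<⇒≤ g<j) (m≤n+m j (j + e)))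

  e₂≲D : e₂ ≲[ 2 ] D
  e₂≲D = ≲-+ (≲-+ (≲-* x≲ y≲) (≲-* y≲ z≲)) (≲-* z≲ x≲)
    where
    x≲ : suc x ≲[ 1 ] x
    x≲ = suc-≲ (M≤side {l} (large-side X≥))
    y≲ : suc y ≲[ 1 ] y
    y≲ = suc-≲ (M≤side {m} (large-side Y≥))
    z≲ : suc z ≲[ 1 ] z
    z≲ = suc-≲ (M≤side {n} (large-side Z≥))

  D>0 : 0 < D
  D>0 = ≤-trans (*-mono-≤ (≤-trans M≥1 (M≤side {l} (large-side X≥))) (≤-trans M≥1 (M≤side {m} (large-side Y≥)))) (≤-trans (m≤m+n (x * y) (y * z)) (m≤m+n _ (z * x)))

  module _ (k : ℕ) (M≤k : M ≤ k) where

    root : ℕ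
    root = ⌊√ D * (k * k) ⌋

    k≤root : k ≤ root
    k≤root = s≤s⁻¹ (square-cancel-< {k} {suc root} (≤-trans (s≤s (m≤n*m (k * k) D {{>-nonZero D>0}})) (⌊√⌋-upper (D * (k * k)))))

    root-≲ : D * (k * k) ≲[ 2 ] root * root
    root-≲ = ≤-≲-trans (<⇒≤ (⌊√⌋-upper (D * (k * k)))) (≲-* root≲ root≲)
      where
      root≲ : suc root ≲[ 1 ] root
      root≲ = suc-≲ (≤-trans M≤k k≤root)

  -- This is S π √D ≈ 2^(x+y+z+1) with π and √D replaced by approximants of denominators k² and k,
  -- and multiplied by k³.
  Estimate : ℕ → Set
  Estimate k = power * (k * k * k) ≲[ 6 ] S e′ * (4 * quarterCount k) * ⌊√ D * (k * k) ⌋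
             × S e′ * (4 * quarterCount k) * ⌊√ D * (k * k) ⌋ ≲[ 6 ] power * (k * k * k)

  estimate-with : ∀ h → margin M < h → order e h * e₂ ≤ e₃ → e₃ ≲[ 1 ] order e h * e₂ →
    ∀ h′ → margin M < h′ → suc M * e₃ ≤ M * (order e h′ * e₂) → order e h′ * e₂ ≲[ 2 ] e₃ →
    ∀ J → Near J → Far J →
    ∀ k → M ≤ k → wallisBound l ≤ k → wallisBound m ≤ k → wallisBound n ≤ k → wallisBound h′ ≤ k → Estimate k
  estimate-with h g<h We₂≤e₃ e₃≲We₂ h′ g<h′ e₃≤We₂ We₂≲e₃ J near far k M≤k l≤k m≤k n≤k h′≤k =
    root-lower power D (root k M≤k) k power-sq e₂≲D (root-≲ k M≤k)
      (total-lower (2 ^ (h + e + h)) (order e h) (coef e h 0) (m^n>0 2 (h + e + h))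
        (Lower.sum-lower {h} We₂≤e₃ e′ e+e′)
        (≲-* (≲-* (coef-lower {l} g<l l≤k) (coef-lower {m} g<m m≤k)) (coef-lower {n} g<n n≤k))
        (subst (λ t → coef e h 0 * coef e h 0 * order e h * p ≲[ 2 ] 2 * t * q) (4^n≡2^n*2^n (h + e + h)) (coef-upper {h} g<h))
        e₃≲We₂) ,
    root-upper power D (root k M≤k) k power-sq D≤e₂ (⌊√⌋-lower (D * (k * k)))
      (total-upper (2 ^ (h′ + e + h′)) (order e h′) (coef e h′ 0) (m^n>0 2 (h′ + e + h′))
        (sum-absorb M {S e′} {coef e h′ 0} {prod 0} {2 ^ (h′ + e + h′)} (coef-small M {e} {h′} e≤1 g<h′) (Upper.sum-upper M 3≤M {h′} e₃≤We₂ J near far e′ e+e′))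
        (≲-* (≲-* (coef-upper {l} g<l) (coef-upper {m} g<m)) (coef-upper {n} g<n))
        (subst (λ t → 2 * t * q ≲[ 1 ] coef e h′ 0 * coef e h′ 0 * order e h′ * p) (4^n≡2^n*2^n (h′ + e + h′)) (coef-lower {h′} g<h′ h′≤k))
        We₂≲e₃)
    where
    0<k : 0 < k
    0<k = ≤-trans M≥1 M≤k
    open Wallis M k 0<k using (p; q)
    open CoefEstimates M 3≤M e≤1 k 0<k
    g<l = large-side X≥
    g<m = large-side Y≥
    g<n = large-side Z≥
    open Combine M (4 ^ x) (4 ^ y) (4 ^ z) q p X Y Z (coef e l 0) (coef e m 0) (coef e n 0) (S e′) e₂
      q-positive (p-positive {l} g<l l≤k) (s≤s z≤n)

  estimate : ∃[ N ] ∀ k → N ≤ k → Estimate k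
  estimate = from inner outer window
    where
    from : (∃[ h ] margin M < h × order e h * e₂ ≤ e₃ × e₃ ≲[ 1 ] order e h * e₂) →
      (∃[ h ] margin M < h × suc M * e₃ ≤ M * (order e h * e₂) × order e h * e₂ ≲[ 2 ] e₃) →
      (∃[ J ] Near J × Far J) → ∃[ N ] ∀ k → N ≤ k → Estimate k
    from (h , g<h , i₁ , i₂) (h′ , g<h′ , o₁ , o₂) (J , near , far) =
      -- The lower Wallis estimate, which needs k large, is applied to the rows l, m, n and h′; row
      -- h enters through the upper estimate alone.
      M + (wallisBound l + (wallisBound m + (wallisBound n + wallisBound h′))) , λ k N≤k →
      let from₁ = m+n≤o⇒n≤o M N≤k
          from₂ = m+n≤o⇒n≤o (wallisBound l) from₁
          from₃ = m+n≤o⇒n≤o (wallisBound m) from₂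
      in estimate-with h g<h i₁ i₂ h′ g<h′ o₁ o₂ J near far k (m+n≤o⇒m≤o M N≤k)
           (m+n≤o⇒m≤o (wallisBound l) from₁) (m+n≤o⇒m≤o (wallisBound m) from₂)
           (m+n≤o⇒m≤o (wallisBound n) from₃) (m+n≤o⇒n≤o (wallisBound n) from₃)

-- Counting block derangements

module _ {A B : Set} {P : B → Set} {Q : A → Set} (P? : Decidable P) (Q? : Decidable Q) (f : A → B)
  (to : ∀ x → P (f x) → Q x) (from : ∀ x → Q x → P (f x)) where

  length-filter-map : ∀ xs → length (filter P? (List.map f xs)) ≡ length (filter Q? xs)
  length-filter-map []       = refl
  length-filter-map (x ∷ xs) with P? (f x) | Q? x
  ... | yes _ | yes _ = cong suc (length-filter-map xs)
  ... | no  _ | no  _ = length-filter-map xs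
  ... | yes p | no ¬q = contradiction (to x p) ¬q
  ... | no ¬p | yes q = contradiction (from x q) ¬p

length-filter-none : ∀ {A B : Set} {P : B → Set} (P? : Decidable P) (f : A → B) →
  (∀ x → ¬ P (f x)) → ∀ xs → length (filter P? (List.map f xs)) ≡ 0
length-filter-none P? f none []       = refl
length-filter-none P? f none (x ∷ xs) with P? (f x)
... | yes p = contradiction p (none x)
... | no  _ = length-filter-none P? f none xs

#_ : ∀ {N} → Fin 3 → Vec (Fin 3) N → ℕ
# j = Vec.count (Fin._≟ j)

pattern 0F = zero
pattern 1F = suc zero
pattern 2F = suc (suc zero)

-- Hand sizes are kept apart from the owners so that cards can be removed one at a time. With
-- variables x, y, z for the receiving players, `deals os p q r` is the coefficient of x^p y^q z^r
-- in the product, over the cards, of the two variables other than the owner's, added.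
Deal : ∀ {N} → Vec (Fin 3) N → (p q r : ℕ) → Vec (Fin 3) N → Set
Deal os p q r v = ((# 0F) v ≡ p × (# 1F) v ≡ q × (# 2F) v ≡ r) × Pointwise _≢_ v os

deal? : ∀ {N} (os : Vec (Fin 3) N) p q r → Decidable (Deal os p q r)
deal? os p q r v = (((# 0F) v ≟ p) ×-dec ((# 1F) v ≟ q) ×-dec ((# 2F) v ≟ r))
  ×-dec Pointwise.decidable (λ i j → ¬? (i Fin.≟ j)) v os

deals : ∀ {N} → Vec (Fin 3) N → (p q r : ℕ) → ℕ
deals {N} os p q r = length (filter (deal? os p q r) (allVecs 3 N))

-- Multiplication of a generating function by the variable.
shift : (ℕ → ℕ) → ℕ → ℕ
shift f zero    = 0
shift f (suc n) = f n

module _ {N} (o : Fin 3) (os : Vec (Fin 3) N) (p q r : ℕ) where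

  private
    given : Fin 3 → ℕ
    given j = length (filter (deal? (o ∷ os) p q r) (List.map (j ∷_) (allVecs 3 N)))

  deals-split : deals (o ∷ os) p q r ≡ given 0F + (given 1F + given 2F)
  deals-split = begin
    length (filter D? (m₀ ++ (m₁ ++ (m₂ ++ []))))
      ≡⟨ append m₀ _ ⟩
    given 0F + length (filter D? (m₁ ++ (m₂ ++ [])))
      ≡⟨ cong (given 0F +_) (append m₁ _) ⟩
    given 0F + (given 1F + length (filter D? (m₂ ++ [])))
      ≡⟨ cong (λ x → given 0F + (given 1F + x)) (trans (append m₂ []) (+-identityʳ _)) ⟩
    given 0F + (given 1F + given 2F) ∎
    where
    open ≡-Reasoning
    D? = deal? (o ∷ os) p q r
    m₀ = List.map (0F ∷_) (allVecs 3 N)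
    m₁ = List.map (1F ∷_) (allVecs 3 N)
    m₂ = List.map (2F ∷_) (allVecs 3 N)
    append : ∀ xs ys → length (filter D? (xs ++ ys)) ≡ length (filter D? xs) + length (filter D? ys)
    append xs ys = trans (cong length (filter-++ D? xs ys)) (length-++ (filter D? xs))

  given-owner : given o ≡ 0
  given-owner = length-filter-none (deal? (o ∷ os) p q r) (o ∷_) (λ { v (_ , o≢o ∷ _) → o≢o refl }) (allVecs 3 N)

given-0 : ∀ {N} o (os : Vec (Fin 3) N) p q r → 0F ≢ o →
  length (filter (deal? (o ∷ os) p q r) (List.map (0F ∷_) (allVecs 3 N))) ≡ shift (λ p → deals os p q r) p
given-0 {N} o os zero    q r ≢o = length-filter-none _ (0F ∷_) (λ { v ((() , _) , _) }) (allVecs 3 N)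
given-0 {N} o os (suc p) q r ≢o = length-filter-map _ (deal? os p q r) (0F ∷_)
  (λ { v ((eq , eqs) , _ ∷ ps) → (suc-injective eq , eqs) , ps })
  (λ { v ((eq , eqs) , ps) → (cong suc eq , eqs) , ≢o ∷ ps }) (allVecs 3 N)

given-1 : ∀ {N} o (os : Vec (Fin 3) N) p q r → 1F ≢ o →
  length (filter (deal? (o ∷ os) p q r) (List.map (1F ∷_) (allVecs 3 N))) ≡ shift (λ q → deals os p q r) q
given-1 {N} o os p zero    r ≢o = length-filter-none _ (1F ∷_) (λ { v ((_ , () , _) , _) }) (allVecs 3 N)
given-1 {N} o os p (suc q) r ≢o = length-filter-map _ (deal? os p q r) (1F ∷_)
  (λ { v ((eq₀ , eq , eq₂) , _ ∷ ps) → (eq₀ , suc-injective eq , eq₂) , ps })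
  (λ { v ((eq₀ , eq , eq₂) , ps) → (eq₀ , cong suc eq , eq₂) , ≢o ∷ ps }) (allVecs 3 N)

given-2 : ∀ {N} o (os : Vec (Fin 3) N) p q r → 2F ≢ o →
  length (filter (deal? (o ∷ os) p q r) (List.map (2F ∷_) (allVecs 3 N))) ≡ shift (λ r → deals os p q r) r
given-2 {N} o os p q zero    ≢o = length-filter-none _ (2F ∷_) (λ { v ((_ , _ , ()) , _) }) (allVecs 3 N)
given-2 {N} o os p q (suc r) ≢o = length-filter-map _ (deal? os p q r) (2F ∷_)
  (λ { v ((eq₀ , eq₁ , eq) , _ ∷ ps) → (eq₀ , eq₁ , suc-injective eq) , ps })
  (λ { v ((eq₀ , eq₁ , eq) , ps) → (eq₀ , eq₁ , cong suc eq) , ≢o ∷ ps }) (allVecs 3 N)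

-- A card of player 0 contributes the factor y + z.
deals-0∷ : ∀ {N} (os : Vec (Fin 3) N) p q r →
  deals (0F ∷ os) p q r ≡ shift (λ q → deals os p q r) q + shift (λ r → deals os p q r) r
deals-0∷ os p q r = trans (deals-split 0F os p q r) (cong₂ _+_ (given-owner 0F os p q r)
  (cong₂ _+_ (given-1 0F os p q r λ ()) (given-2 0F os p q r λ ())))

deals-1∷ : ∀ {N} (os : Vec (Fin 3) N) p q r →
  deals (1F ∷ os) p q r ≡ shift (λ p → deals os p q r) p + shift (λ r → deals os p q r) r
deals-1∷ os p q r = trans (deals-split 1F os p q r) (cong₂ _+_ (given-0 1F os p q r λ ())
  (cong₂ _+_ (given-owner 1F os p q r) (given-2 1F os p q r λ ())))

deals-2∷ : ∀ {N} (os : Vec (Fin 3) N) p q r →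
  deals (2F ∷ os) p q r ≡ shift (λ p → deals os p q r) p + shift (λ q → deals os p q r) q
deals-2∷ os p q r = trans (deals-split 2F os p q r) (cong₂ _+_ (given-0 2F os p q r λ ())
  (trans (cong₂ _+_ (given-1 2F os p q r λ ()) (given-owner 2F os p q r)) (+-identityʳ _)))

shift-cong : ∀ {f g : ℕ → ℕ} n → (∀ m → n ≡ suc m → f m ≡ g m) → shift f n ≡ shift g n
shift-cong zero    eq = refl
shift-cong (suc n) eq = eq n refl

shift-const : ∀ p k → (p ≡ 0 → k ≡ 0) → shift (λ _ → k) p ≡ k
shift-const zero    k vanish = sym (vanish refl)
shift-const (suc p) k _      = refl

pascal : ∀ n k w → n C k * w + shift (λ k → n C k * w) k ≡ suc n C k * w
pascal n zero    w = +-identityʳ _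
pascal n (suc k) w = begin
  n C suc k * w + n C k * w     ≡⟨ *-distribʳ-+ w (n C suc k) (n C k) ⟨
  (n C suc k + n C k) * w       ≡⟨ cong (_* w) (trans (+-comm (n C suc k) (n C k)) (nCk+nC[k+1]≡[n+1]C[k+1] n k)) ⟩
  suc n C suc k * w             ∎
  where open ≡-Reasoning

C-overflow : ∀ m n i j → m + n < i + j → m C i * n C j ≡ 0
C-overflow m n i j lt with i ≤? m
... | no i≰m  = cong (_* n C j) (k>n⇒nCk≡0 (≰⇒> i≰m))
... | yes i≤m = trans (cong (m C i *_) (k>n⇒nCk≡0 (+-cancelˡ-< m n j (≤-trans lt (+-monoˡ-≤ j i≤m))))) (*-zeroʳ (m C i))

-- The generating function is (x + y)^c. The factor `0 C r` is the indicator of r = 0, written as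
-- the start of the recursion for `deals₁`.
deals₂ : ∀ c p q r → p + q + r ≡ c → deals (Vec.map suc (Vec.map suc (owners (c ∷ [])))) p q r ≡ 0 C r * c C q
deals₂ zero zero zero zero refl = refl
deals₂ (suc c) p q r eq = begin
  deals (2F ∷ os) p q r
    ≡⟨ deals-2∷ os p q r ⟩
  shift (λ p → deals os p q r) p + shift (λ q → deals os p q r) q
    ≡⟨ cong₂ _+_ (shift-cong p λ { p refl → deals₂ c p q r (suc-injective eq) })
                 (shift-cong q λ { q refl → deals₂ c p q r (suc-injective (trans (cong (_+ r) (sym (+-suc p q))) eq)) }) ⟩
  shift (λ _ → 0 C r * c C q) p + shift (λ q → 0 C r * c C q) q
    ≡⟨ cong₂ _+_ (shift-const p _ λ { refl → C-overflow 0 c r q (≤-reflexive (trans (sym eq) (+-comm q r))) })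
                 (shift-cong q λ q _ → *-comm (0 C r) (c C q)) ⟩
  0 C r * c C q + shift (λ q → c C q * 0 C r) q
    ≡⟨ cong (_+ shift (λ q → c C q * 0 C r) q) (*-comm (0 C r) (c C q)) ⟩
  c C q * 0 C r + shift (λ q → c C q * 0 C r) q
    ≡⟨ pascal c q (0 C r) ⟩
  suc c C q * 0 C r
    ≡⟨ *-comm (suc c C q) (0 C r) ⟩
  0 C r * suc c C q ∎
  where
  open ≡-Reasoning
  os = Vec.map suc (Vec.map suc (owners (c ∷ [])))

-- In (x + z)^b (x + y)^c the exponents of z and y fix how many cards each factor sends away from
-- player 0.
deals₁ : ∀ b c p q r → p + q + r ≡ b + c → deals (Vec.map suc (owners (b ∷ c ∷ []))) p q r ≡ b C r * c C q
deals₁ zero    c p q r eq = deals₂ c p q r eq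
deals₁ (suc b) c p q r eq = begin
  deals (1F ∷ os) p q r
    ≡⟨ deals-1∷ os p q r ⟩
  shift (λ p → deals os p q r) p + shift (λ r → deals os p q r) r
    ≡⟨ cong₂ _+_ (shift-cong p λ { p refl → deals₁ b c p q r (suc-injective eq) })
                 (shift-cong r λ { r refl → deals₁ b c p q r (suc-injective (trans (sym (+-suc (p + q) r)) eq)) }) ⟩
  shift (λ _ → b C r * c C q) p + shift (λ r → b C r * c C q) r
    -- At p = 0 the shift gives 0, and so does the product: q + r exceeds the b + c cards that
    -- remain.
    ≡⟨ cong (_+ shift (λ r → b C r * c C q) r) (shift-const p _ λ { refl → C-overflow b c r q (≤-reflexive (trans (sym eq) (+-comm q r))) }) ⟩
  b C r * c C q + shift (λ r → b C r * c C q) r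
    ≡⟨ pascal b r (c C q) ⟩
  suc b C r * c C q ∎
  where
  open ≡-Reasoning
  os = Vec.map suc (owners (b ∷ c ∷ []))

shifts : ℕ → (ℕ → ℕ) → ℕ → ℕ
shifts zero    f = f
shifts (suc i) f = shift (shifts i f)

shifts-+ : ∀ i f n → shifts i f (i + n) ≡ f n
shifts-+ zero    f n = refl
shifts-+ (suc i) f n = shifts-+ i f n

shifts-< : ∀ i f {n} → n < i → shifts i f n ≡ 0
shifts-< (suc i) f {zero}  _         = refl
shifts-< (suc i) f {suc n} (s≤s n<i) = shifts-< i f n<i

shift-∑ : ∀ k (w : ℕ → ℕ) (f : ℕ → ℕ → ℕ) n →
  shift (λ n → ∑< k (λ i → w i * f i n)) n ≡ ∑< k (λ i → w i * shift (f i) n)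
shift-∑ k w f zero    = sym (trans (∑-cong k λ i → *-zeroʳ (w i)) (trans (∑-const k 0) (*-zeroʳ k)))
shift-∑ k w f (suc n) = refl

shift-*ʳ : ∀ f c n → shift (λ n → f n * c) n ≡ shift f n * c
shift-*ʳ f c zero    = refl
shift-*ʳ f c (suc n) = refl

shift-*ˡ : ∀ f c n → shift (λ n → c * f n) n ≡ c * shift f n
shift-*ˡ f c zero    = sym (*-zeroʳ c)
shift-*ˡ f c (suc n) = refl

-- The expansion of (y + z)(y + z)^a, where `t i j` stands for the effect of y^i z^j.
binomial-suc : ∀ a (t : ℕ → ℕ → ℕ) →
  ∑< (suc a) (λ i → a C i * t (suc i) (a ∸ i)) + ∑< (suc a) (λ i → a C i * t i (suc (a ∸ i))) ≡
  ∑< (suc (suc a)) (λ i → suc a C i * t i (suc a ∸ i))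
binomial-suc a t = begin
  ∑< (suc a) f + ∑< (suc a) (λ i → a C i * t i (suc (a ∸ i)))
    ≡⟨ cong (∑< (suc a) f +_) (trans (∑-cong-< (suc a) λ i i≤a → cong (λ k → a C i * t i k) (sym (+-∸-assoc 1 (s≤s⁻¹ i≤a))))
         (∑-shift a (λ i → a C i * t i (suc a ∸ i)))) ⟩
  ∑< (suc a) f + (a C 0 * t 0 (suc a) + ∑< a g)
    ≡⟨ re (∑< (suc a) f) (a C 0 * t 0 (suc a)) (∑< a g) ⟩
  a C 0 * t 0 (suc a) + (∑< (suc a) f + (∑< a g + 0))
    ≡⟨ cong (λ x → a C 0 * t 0 (suc a) + (∑< (suc a) f + (∑< a g + x * t (suc a) (a ∸ a)))) (k>n⇒nCk≡0 (n<1+n a)) ⟨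
  a C 0 * t 0 (suc a) + (∑< (suc a) f + ∑< (suc a) g)
    ≡⟨ cong (a C 0 * t 0 (suc a) +_) (trans (sym (∑-+ (suc a) f g)) (∑-cong (suc a) λ i →
         trans (sym (*-distribʳ-+ (t (suc i) (a ∸ i)) (a C i) (a C suc i))) (cong (_* t (suc i) (a ∸ i)) (nCk+nC[k+1]≡[n+1]C[k+1] a i)))) ⟩
  suc a C 0 * t 0 (suc a) + ∑< (suc a) (λ i → suc a C suc i * t (suc i) (a ∸ i))
    ≡⟨ ∑-shift (suc a) (λ i → suc a C i * t i (suc a ∸ i)) ⟨
  ∑< (suc (suc a)) (λ i → suc a C i * t i (suc a ∸ i)) ∎
  where
  open ≡-Reasoning
  f g : ℕ → ℕ
  f i = a C i * t (suc i) (a ∸ i)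
  g i = a C suc i * t (suc i) (a ∸ i)
  re : ∀ x y z → x + (y + z) ≡ y + (x + (z + 0))
  re = solve-∀

-- The index i counts the cards of player 0 that go to player 1. `shifts i (c C_) q` is C(c, q - i),
-- read as 0 when q < i.
deals₀ : ∀ a b c p q r → p + q + r ≡ a + (b + c) →
  deals (owners (a ∷ b ∷ c ∷ [])) p q r ≡ ∑< (suc a) (λ i → a C i * (shifts i (c C_) q * shifts (a ∸ i) (b C_) r))
deals₀ zero    b c p q r eq = trans (deals₁ b c p q r eq) (re (b C r) (c C q))
  where
  re : ∀ x y → x * y ≡ 1 * (y * x)
  re = solve-∀
deals₀ (suc a) b c p q r eq = begin
  deals (0F ∷ os) p q r
    ≡⟨ deals-0∷ os p q r ⟩
  shift (λ q → deals os p q r) q + shift (λ r → deals os p q r) r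
    ≡⟨ cong₂ _+_ (shift-cong q λ { q refl → deals₀ a b c p q r (suc-injective (trans (cong (_+ r) (sym (+-suc p q))) eq)) })
                 (shift-cong r λ { r refl → deals₀ a b c p q r (suc-injective (trans (sym (+-suc (p + q) r)) eq)) }) ⟩
  shift (λ q → ∑< (suc a) (λ i → a C i * (u i q * v (a ∸ i) r))) q + shift (λ r → ∑< (suc a) (λ i → a C i * (u i q * v (a ∸ i) r))) r
    ≡⟨ cong₂ _+_ (trans (shift-∑ (suc a) (a C_) (λ i q → u i q * v (a ∸ i) r) q) (∑-cong (suc a) λ i → cong (a C i *_) (shift-*ʳ (u i) (v (a ∸ i) r) q)))
                 (trans (shift-∑ (suc a) (a C_) (λ i r → u i q * v (a ∸ i) r) r) (∑-cong (suc a) λ i → cong (a C i *_) (shift-*ˡ (v (a ∸ i)) (u i q) r))) ⟩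
  ∑< (suc a) (λ i → a C i * (u (suc i) q * v (a ∸ i) r)) + ∑< (suc a) (λ i → a C i * (u i q * v (suc (a ∸ i)) r))
    ≡⟨ binomial-suc a (λ i j → u i q * v j r) ⟩
  ∑< (suc (suc a)) (λ i → suc a C i * (u i q * v (suc a ∸ i) r)) ∎
  where
  open ≡-Reasoning
  os = owners (a ∷ b ∷ c ∷ [])
  u v : ℕ → ℕ → ℕ
  u i = shifts i (c C_)
  v j = shifts j (b C_)

E-deals : ∀ a b c → E (a ∷ b ∷ c ∷ []) ≡ deals (owners (a ∷ b ∷ c ∷ [])) a b c
E-deals a b c = cong length (filter-≐ (isBlockDerangement? (a ∷ b ∷ c ∷ [])) (deal? (owners (a ∷ b ∷ c ∷ [])) a b c)
  ( (λ (eq , ps) → (eq 0F , eq 1F , eq 2F) , ps)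
  , (λ ((eq₀ , eq₁ , eq₂) , ps) → (λ { 0F → eq₀ ; 1F → eq₁ ; 2F → eq₂ }) , ps)) (allVecs 3 (Vec.sum (a ∷ b ∷ c ∷ []))))

E-sum : ∀ a b c → E (a ∷ b ∷ c ∷ []) ≡ ∑< (suc a) (λ i → a C i * (shifts i (c C_) b * shifts (a ∸ i) (b C_) c))
E-sum a b c = trans (E-deals a b c) (deals₀ a b c a b c (+-assoc a b c))

-- The count as a factorial quotient times the symmetric sum

C-!³ : ∀ p₁ q₁ p₂ q₂ p₃ q₃ → (p₁ + q₁) C p₁ * ((p₂ + q₂) C p₂ * (p₃ + q₃) C p₃) *
  ((p₁ ! * q₁ !) * ((p₂ ! * q₂ !) * (p₃ ! * q₃ !))) ≡ (p₁ + q₁) ! * ((p₂ + q₂) ! * (p₃ + q₃) !)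
C-!³ p₁ q₁ p₂ q₂ p₃ q₃ = trans
  (re ((p₁ + q₁) C p₁) ((p₂ + q₂) C p₂) ((p₃ + q₃) C p₃) (p₁ ! * q₁ !) (p₂ ! * q₂ !) (p₃ ! * q₃ !))
  (cong₂ _*_ (C-! p₁ q₁) (cong₂ _*_ (C-! p₂ q₂) (C-! p₃ q₃)))
  where
  re : ∀ a b c u v w → a * (b * c) * (u * (v * w)) ≡ (a * u) * ((b * v) * (c * w))
  re = solve-∀

-- The terms with positive and with negative offset; only the pairing of the
-- six factorials in the denominator differs.
term-upper : ∀ u v w α β γ → (u + β) C u * ((γ + v) C γ * (w + α) C w) * ((u + α) ! * (v + β) ! * (w + γ) !) ≡
  ((u + β) ! * (w + α) ! * (γ + v) !) * ((u + α) C u * (v + β) C v * (w + γ) C w)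
term-upper u v w α β γ = *-cancelʳ-≡ _ _ F {{F≢0}} (begin
  c₁ * ((u + α) ! * (v + β) ! * (w + γ) !) * F
    ≡⟨ re₁ c₁ ((u + α) !) ((v + β) !) ((w + γ) !) (u !) (α !) (v !) (β !) (w !) (γ !) ⟩
  c₁ * ((u ! * β !) * ((γ ! * v !) * (w ! * α !))) * ((u + α) ! * ((v + β) ! * (w + γ) !))
    ≡⟨ cong₂ _*_ (C-!³ u β γ v w α) (sym (C-!³ u α v β w γ)) ⟩
  ((u + β) ! * ((γ + v) ! * (w + α) !)) * ((u + α) C u * ((v + β) C v * (w + γ) C w) * F)
    ≡⟨ re₂ ((u + β) !) ((γ + v) !) ((w + α) !) ((u + α) C u) ((v + β) C v) ((w + γ) C w) F ⟩
  ((u + β) ! * (w + α) ! * (γ + v) !) * ((u + α) C u * (v + β) C v * (w + γ) C w) * F ∎)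
  where
  open ≡-Reasoning
  F = (u ! * α !) * ((v ! * β !) * (w ! * γ !))
  F≢0 : NonZero F
  F≢0 = m*n≢0 _ _ {{u !* α !≢0}} {{m*n≢0 _ _ {{v !* β !≢0}} {{w !* γ !≢0}}}}
  c₁ = (u + β) C u * ((γ + v) C γ * (w + α) C w)
  re₁ : ∀ c x y z u a v b w g → c * (x * y * z) * ((u * a) * ((v * b) * (w * g))) ≡ c * ((u * b) * ((g * v) * (w * a))) * (x * (y * z))
  re₁ = solve-∀
  re₂ : ∀ a b c x y z f → (a * (b * c)) * ((x * (y * z)) * f) ≡ (a * c * b) * (x * y * z) * f
  re₂ = solve-∀

term-lower : ∀ u v w α β γ → (α + v) C α * ((w + β) C w * (γ + u) C γ) * ((u + α) ! * (v + β) ! * (w + γ) !) ≡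
  ((α + v) ! * (γ + u) ! * (w + β) !) * ((u + α) C u * (v + β) C v * (w + γ) C w)
term-lower u v w α β γ = *-cancelʳ-≡ _ _ F {{F≢0}} (begin
  c₁ * ((u + α) ! * (v + β) ! * (w + γ) !) * F
    ≡⟨ re₁ c₁ ((u + α) !) ((v + β) !) ((w + γ) !) (u !) (α !) (v !) (β !) (w !) (γ !) ⟩
  c₁ * ((α ! * v !) * ((w ! * β !) * (γ ! * u !))) * ((u + α) ! * ((v + β) ! * (w + γ) !))
    ≡⟨ cong₂ _*_ (C-!³ α v w β γ u) (sym (C-!³ u α v β w γ)) ⟩
  ((α + v) ! * ((w + β) ! * (γ + u) !)) * ((u + α) C u * ((v + β) C v * (w + γ) C w) * F)
    ≡⟨ re₂ ((α + v) !) ((w + β) !) ((γ + u) !) ((u + α) C u) ((v + β) C v) ((w + γ) C w) F ⟩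
  ((α + v) ! * (γ + u) ! * (w + β) !) * ((u + α) C u * (v + β) C v * (w + γ) C w) * F ∎)
  where
  open ≡-Reasoning
  F = (u ! * α !) * ((v ! * β !) * (w ! * γ !))
  F≢0 : NonZero F
  F≢0 = m*n≢0 _ _ {{u !* α !≢0}} {{m*n≢0 _ _ {{v !* β !≢0}} {{w !* γ !≢0}}}}
  c₁ = (α + v) C α * ((w + β) C w * (γ + u) C γ)
  re₁ : ∀ c x y z u a v b w g → c * (x * y * z) * ((u * a) * ((v * b) * (w * g))) ≡ c * ((a * v) * ((w * b) * (g * u))) * (x * (y * z))
  re₁ = solve-∀
  re₂ : ∀ a b c x y z f → (a * (b * c)) * ((x * (y * z)) * f) ≡ (a * c * b) * (x * y * z) * f
  re₂ = solve-∀

module Closed (e e′ : ℕ) (e+e′ : e + e′ ≡ 1) (l m n : ℕ) where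

  open Product e l m n

  private
    a = l + e + m
    b = l + e + n
    c = m + e + n
    numerator   = a ! * b ! * c !
    denominator = (l + e + l) ! * (m + e + m) ! * (n + e + n) !

    term : ℕ → ℕ
    term i = a C i * (shifts i (c C_) b * shifts (a ∸ i) (b C_) c)

    both-zero : ∀ i j → term i ≡ 0 → prod j ≡ 0 → term i * denominator ≡ numerator * prod j
    both-zero i j eq eq′ = trans (cong (_* denominator) eq) (sym (trans (cong (numerator *_) eq′) (*-zeroʳ numerator)))

    prod≡0 : ∀ j → l < j ⊎ m < j ⊎ n < j → prod j ≡ 0
    prod≡0 j (inj₁ l<j)        = cong (λ x → x * coef e m j * coef e n j) (coef-vanish e l<j)
    prod≡0 j (inj₂ (inj₁ m<j)) = cong (_* coef e n j) (trans (cong (coef e l j *_) (coef-vanish e m<j)) (*-zeroʳ (coef e l j)))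
    prod≡0 j (inj₂ (inj₂ n<j)) = trans (cong (coef e l j * coef e m j *_) (coef-vanish e n<j)) (*-zeroʳ (coef e l j * coef e m j))

    term≡0ˡ : ∀ i → shifts i (c C_) b ≡ 0 → term i ≡ 0
    term≡0ˡ i eq = trans (cong (λ y → a C i * (y * shifts (a ∸ i) (b C_) c)) eq) (*-zeroʳ (a C i))

    term≡0ʳ : ∀ i → shifts (a ∸ i) (b C_) c ≡ 0 → term i ≡ 0
    term≡0ʳ i eq = trans (cong (λ z → a C i * (shifts i (c C_) b * z)) eq)
      (trans (cong (a C i *_) (*-zeroʳ (shifts i (c C_) b))) (*-zeroʳ (a C i)))

    -- Within the rows, the summand has denominators u! β!, γ! v!, w! α! and the product of
    -- coefficients has u! α!, v! β!, w! γ!: the same six factorials, paired differently. When j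
    -- exceeds l or n both sides vanish.
    upper : ∀ j → j ≤ m → term (l + e + j) * denominator ≡ numerator * prod j
    upper j j≤m with j ≤? l | j ≤? n
    ... | _ | no j≰n = both-zero (l + e + j) j (term≡0ˡ (l + e + j) (shifts-< (l + e + j) (c C_) (+-monoʳ-< (l + e) (≰⇒> j≰n))))
                         (prod≡0 j (inj₂ (inj₂ (≰⇒> j≰n))))
    ... | no j≰l | yes j≤n = both-zero (l + e + j) j (term≡0ʳ (l + e + j) (trans (cong (λ k → shifts k (b C_) c) a∸i)
            (trans (cong (shifts (m ∸ j) (b C_)) c≡) (trans (shifts-+ (m ∸ j) (b C_) (n + e + j)) (k>n⇒nCk≡0 b<)))))
          (prod≡0 j (inj₁ (≰⇒> j≰l)))
      where
      a∸i : a ∸ (l + e + j) ≡ m ∸ j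
      a∸i = [m+n]∸[m+o]≡n∸o (l + e) m j
      c≡ : c ≡ m ∸ j + (n + e + j)
      c≡ = trans (cong (λ k → k + e + n) (sym (m∸n+n≡m j≤m))) (re (m ∸ j) j e n)
        where
        re : ∀ d j e n → d + j + e + n ≡ d + (n + e + j)
        re = solve-∀
      b< : b < n + e + j
      b< = ≤-trans (+-monoˡ-< n (+-monoˡ-< e (≰⇒> j≰l))) (≤-reflexive (re j e n))
        where
        re : ∀ j e n → j + e + n ≡ n + e + j
        re = solve-∀
    ... | yes j≤l | yes j≤n = begin
      term u * denominator
        ≡⟨ cong (_* denominator) term≡ ⟩
      (u + β) C u * ((γ + v) C γ * (w + α) C w) * denominator
        ≡⟨ cong₂ (λ x y → (u + β) C u * ((γ + v) C γ * (w + α) C w) * (x * y)) (cong₂ (λ x y → x ! * y !) x≡ y≡) (cong _! z≡) ⟩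
      (u + β) C u * ((γ + v) C γ * (w + α) C w) * ((u + α) ! * (v + β) ! * (w + γ) !)
        ≡⟨ term-upper u v w α β γ ⟩
      ((u + β) ! * (w + α) ! * (γ + v) !) * ((u + α) C u * (v + β) C v * (w + γ) C w)
        ≡⟨ cong₂ _*_ (cong₂ _*_ (cong₂ (λ x y → x ! * y !) (sym a≡) (sym b≡w)) (cong _! (sym c≡)))
             (cong₂ _*_ (cong₂ (λ x y → x C u * y C v) (sym x≡) (sym y≡)) (cong (_C w) (sym z≡))) ⟩
      numerator * prod j ∎
      where
      open ≡-Reasoning
      u = l + e + j
      v = m + e + j
      w = n + e + j
      α = l ∸ j
      β = m ∸ j
      γ = n ∸ j
      re : ∀ k j d → k + (j + d) ≡ k + j + d
      re k j d = sym (+-assoc k j d)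
      plus : ∀ k {o} → j ≤ o → k + o ≡ k + j + (o ∸ j)
      plus k {o} j≤o = trans (cong (k +_) (sym (m+[n∸m]≡n j≤o))) (re k j (o ∸ j))
      flip : ∀ x e y → x + e + y ≡ y + e + x
      flip = solve-∀
      x≡ : l + e + l ≡ u + α
      x≡ = plus (l + e) j≤l
      y≡ : m + e + m ≡ v + β
      y≡ = plus (m + e) j≤m
      z≡ : n + e + n ≡ w + γ
      z≡ = plus (n + e) j≤n
      a≡ : a ≡ u + β
      a≡ = plus (l + e) j≤m
      b≡ : b ≡ u + γ
      b≡ = plus (l + e) j≤n
      b≡w : b ≡ w + α
      b≡w = trans (flip l e n) (plus (n + e) j≤l)
      c≡v : c ≡ v + γ
      c≡v = plus (m + e) j≤n
      c≡ : c ≡ γ + v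
      c≡ = trans c≡v (+-comm v γ)
      c≡β : c ≡ β + w
      c≡β = trans (flip m e n) (trans (plus (n + e) j≤m) (+-comm w β))
      term≡ : term u ≡ (u + β) C u * ((γ + v) C γ * (w + α) C w)
      term≡ = cong₂ _*_ (cong (_C u) a≡) (cong₂ _*_
        (trans (cong (shifts u (c C_)) b≡) (trans (shifts-+ u (c C_) γ) (cong (_C γ) c≡)))
        (trans (cong (λ k → shifts k (b C_) c) ([m+n]∸[m+o]≡n∸o (l + e) m j))
          (trans (cong (shifts β (b C_)) c≡β) (trans (shifts-+ β (b C_) w) (cong (_C w) b≡w)))))

    lower : ∀ i j → i + j ≡ l → term i * denominator ≡ numerator * prod j
    lower i j refl with j ≤? m | j ≤? n
    ... | no j≰m | _ = both-zero i j (term≡0ˡ i (trans (cong (shifts i (c C_)) (re i j e n))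
            (trans (shifts-+ i (c C_) (n + e + j)) (k>n⇒nCk≡0 (≤-trans (+-monoˡ-< n (+-monoˡ-< e (≰⇒> j≰m))) (≤-reflexive (flip j e n)))))))
          (prod≡0 j (inj₂ (inj₁ (≰⇒> j≰m))))
      where
      re : ∀ i j e n → i + j + e + n ≡ i + (n + e + j)
      re = solve-∀
      flip : ∀ x e y → x + e + y ≡ y + e + x
      flip = solve-∀
    ... | yes j≤m | no j≰n = both-zero i j (term≡0ʳ i (trans (cong (λ k → shifts k (b C_) c) a∸i)
            (shifts-< (m + e + j) (b C_) (+-monoʳ-< (m + e) (≰⇒> j≰n)))))
          (prod≡0 j (inj₂ (inj₂ (≰⇒> j≰n))))
      where
      re : ∀ i j e m → i + j + e + m ≡ i + (m + e + j)
      re = solve-∀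
      a∸i : a ∸ i ≡ m + e + j
      a∸i = trans (cong (_∸ i) (re i j e m)) (m+n∸m≡n i (m + e + j))
    ... | yes j≤m | yes j≤n = begin
      term i * denominator
        ≡⟨ cong (_* denominator) term≡ ⟩
      (α + v) C α * ((w + β) C w * (γ + u) C γ) * denominator
        ≡⟨ cong₂ (λ x y → (α + v) C α * ((w + β) C w * (γ + u) C γ) * (x * y)) (cong₂ (λ x y → x ! * y !) x≡ y≡) (cong _! z≡) ⟩
      (α + v) C α * ((w + β) C w * (γ + u) C γ) * ((u + α) ! * (v + β) ! * (w + γ) !)
        ≡⟨ term-lower u v w α β γ ⟩
      ((α + v) ! * (γ + u) ! * (w + β) !) * ((u + α) C u * (v + β) C v * (w + γ) C w)
        ≡⟨ cong₂ _*_ (cong₂ _*_ (cong₂ (λ x y → x ! * y !) (sym a≡) (sym b≡)) (cong _! (sym c≡)))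
             (cong₂ _*_ (cong₂ (λ x y → x C u * y C v) (sym x≡) (sym y≡)) (cong (_C w) (sym z≡))) ⟩
      numerator * prod j ∎
      where
      open ≡-Reasoning
      u = i + j + e + j
      v = m + e + j
      w = n + e + j
      α = i
      β = m ∸ j
      γ = n ∸ j
      plus : ∀ k {o} → j ≤ o → k + o ≡ k + j + (o ∸ j)
      plus k {o} j≤o = trans (cong (k +_) (sym (m+[n∸m]≡n j≤o))) (sym (+-assoc k j (o ∸ j)))
      flip : ∀ x e y → x + e + y ≡ y + e + x
      flip = solve-∀
      re : ∀ i j e m → i + j + e + m ≡ i + (m + e + j)
      re = solve-∀
      x≡ : i + j + e + (i + j) ≡ u + α
      x≡ = re′ i j e
        where
        re′ : ∀ i j e → i + j + e + (i + j) ≡ i + j + e + j + i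
        re′ = solve-∀
      y≡ : m + e + m ≡ v + β
      y≡ = plus (m + e) j≤m
      z≡ : n + e + n ≡ w + γ
      z≡ = plus (n + e) j≤n
      a≡ : a ≡ α + v
      a≡ = re i j e m
      b≡ : b ≡ γ + u
      b≡ = trans (plus (i + j + e) j≤n) (+-comm u γ)
      c≡ : c ≡ w + β
      c≡ = trans (flip m e n) (plus (n + e) j≤m)
      term≡ : term i ≡ (α + v) C α * ((w + β) C w * (γ + u) C γ)
      term≡ = cong₂ _*_ (cong (_C α) a≡) (cong₂ _*_
        (trans (cong (shifts i (c C_)) (re i j e n)) (trans (shifts-+ i (c C_) w) (cong (_C w) c≡)))
        (trans (cong (λ k → shifts k (b C_) c) (trans (cong (_∸ i) a≡) (m+n∸m≡n i v)))
          (trans (cong (shifts v (b C_)) (plus (m + e) j≤n)) (trans (shifts-+ v (b C_) γ) (cong (_C γ) b≡)))))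

  E-closed : E (a ∷ b ∷ c ∷ []) * denominator ≡ numerator * S e′
  E-closed = begin
    E (a ∷ b ∷ c ∷ []) * denominator
      ≡⟨ cong (_* denominator) (trans (E-sum a b c) (∑-centre e l m term)) ⟩
    (∑< (suc m) up′ + ∑< (l + e) down′) * denominator
      ≡⟨ *-distribʳ-+ denominator (∑< (suc m) up′) (∑< (l + e) down′) ⟩
    ∑< (suc m) up′ * denominator + ∑< (l + e) down′ * denominator
      ≡⟨ cong₂ _+_ (∑-*ʳ (suc m) up′ denominator) (∑-*ʳ (l + e) down′ denominator) ⟨
    ∑< (suc m) (λ j → up′ j * denominator) + ∑< (l + e) (λ j → down′ j * denominator)
      ≡⟨ cong₂ _+_ (∑-cong-< (suc m) λ j j≤m → upper j (s≤s⁻¹ j≤m))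
           (∑-cong-< (l + e) λ j j<l → lower (l + e ∸ suc j) (j + e′) (mirror {e} {e′} {l} e+e′ j<l)) ⟩
    ∑< (suc m) (λ j → numerator * prod j) + ∑< (l + e) (λ j → numerator * prod (j + e′))
      ≡⟨ cong₂ _+_ (∑-*ˡ (suc m) numerator prod) (∑-*ˡ (l + e) numerator (λ j → prod (j + e′))) ⟩
    numerator * ∑< (suc m) prod + numerator * ∑< (l + e) (λ j → prod (j + e′))
      ≡⟨ *-distribˡ-+ numerator (∑< (suc m) prod) _ ⟨
    numerator * S e′ ∎
    where
    open ≡-Reasoning
    up′ down′ : ℕ → ℕ
    up′ j = term (l + e + j)
    down′ j = term (l + e ∸ suc j)

-- Rational bounds

ι : ℕ → ℚ
ι n = ℤ.+ n ℚ./ 1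

/-cong : ∀ a b c d → a * suc d ≡ c * suc b → ℤ.+ a ℚ./ suc b ≡ ℤ.+ c ℚ./ suc d
/-cong a b c d eq = ℚ.≤-antisym (/-cross-≤ a b c d (≤-reflexive eq)) (/-cross-≤ c d a b (≤-reflexive (sym eq)))

/-* : ∀ a b c d → ℤ.+ a ℚ./ suc b ℚ.* (ℤ.+ c ℚ./ suc d) ≡ ℤ.+ (a * c) ℚ./ (suc b * suc d)
/-* a b c d = ℚ.toℚᵘ-injective
  (ℚᵘ.≃-trans (ℚ.toℚᵘ-homo-* (ℤ.+ a ℚ./ suc b) (ℤ.+ c ℚ./ suc d))
  (ℚᵘ.≃-trans (ℚᵘ.*-cong (ℚ.toℚᵘ-fromℚᵘ (ℚᵘ.mkℚᵘ (ℤ.+ a) b)) (ℚ.toℚᵘ-fromℚᵘ (ℚᵘ.mkℚᵘ (ℤ.+ c) d)))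
  (ℚᵘ.≃-trans (ℚᵘ.≃-reflexive (cong (λ z → ℚᵘ.mkℚᵘ z (d + b * suc d)) (sym (ℤ.pos-* a c))))
  (ℚᵘ.≃-sym (ℚ.toℚᵘ-fromℚᵘ (ℚᵘ.mkℚᵘ (ℤ.+ (a * c)) (d + b * suc d)))))))

/-*ι : ∀ a d .{{_ : NonZero d}} → ℤ.+ a ℚ./ d ℚ.* ι d ≡ ι a
/-*ι a (suc d) = trans (/-* a d (suc d) 0) (/-cong (a * suc d) (d * 1) a 0 (re a d))
  where
  re : ∀ a d → a * (1 + d) * 1 ≡ a * (1 + d * 1)
  re = solve-∀

ι-* : ∀ a b → ι (a * b) ≡ ι a ℚ.* ι b
ι-* a b = sym (/-* a 0 b 0)

ι-+ : ∀ a b → ι (a + b) ≡ ι a ℚ.+ ι b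
ι-+ a b = /-+ a b 0

ι-mono-≤ : ∀ {a b} → a ≤ b → ι a ℚ.≤ ι b
ι-mono-≤ {a} {b} a≤b = /-cross-≤ a 0 b 0 (*-monoˡ-≤ 1 a≤b)

ι-nonNeg : ∀ a → 0ℚ ℚ.≤ ι a
ι-nonNeg a = ι-mono-≤ {0} {a} z≤n

ι-pos : ∀ {a} → 0 < a → 0ℚ ℚ.< ι a
ι-pos 0<a = ℚ.<-≤-trans (ℚ.positive⁻¹ 1ℚ) (ι-mono-≤ 0<a)

-- (1 + 1/M)^κ ≤ 1 + κ/u, with denominators cleared.
bernoulli : ∀ κ M u → suc M ≡ κ + u → suc M ^ κ * u ≤ M ^ κ * suc M
bernoulli zero    M u eq = ≤-reflexive (cong (1 *_) (sym eq))
bernoulli (suc κ) M u eq = begin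
  suc M * suc M ^ κ * u           ≡⟨ re (suc M) (suc M ^ κ) u ⟩
  suc M ^ κ * (suc M * u)         ≤⟨ *-monoʳ-≤ (suc M ^ κ) step ⟩
  suc M ^ κ * (M * suc u)         ≡⟨ *-assoc (suc M ^ κ) M (suc u) ⟨
  suc M ^ κ * M * suc u           ≡⟨ re (suc M ^ κ) M (suc u) ⟩
  M * (suc M ^ κ * suc u)         ≤⟨ *-monoʳ-≤ M (bernoulli κ M (suc u) (trans eq (sym (+-suc κ u)))) ⟩
  M * (M ^ κ * suc M)             ≡⟨ *-assoc M (M ^ κ) (suc M) ⟨
  M * M ^ κ * suc M               ∎
  where
  open ≤-Reasoning
  re : ∀ a b c → a * b * c ≡ b * (a * c)
  re = solve-∀
  step : suc M * u ≤ M * suc u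
  step = begin
    u + M * u     ≤⟨ +-monoˡ-≤ (M * u) (≤-trans (m≤n+m u κ) (≤-reflexive (sym (suc-injective eq)))) ⟩
    M + M * u     ≡⟨ *-suc M u ⟨
    M * suc u     ∎

-- With u = κ L the preceding bound gives (1 + 1/M)^κ ≤ (κ + κ L) / (κ L) = 1 + 1/L. For the
-- exponent 6 of the estimates this dictates M + 1 = 6 + 6 L.
bernoulli-≤ : ∀ κ M L {a b} .{{_ : NonZero κ}} .{{_ : NonZero M}} → suc M ≡ κ + κ * L →
  M ^ κ * a ≤ suc M ^ κ * b → L * a ≤ suc L * b
bernoulli-≤ κ M L {a} {b} {{κ≢0}} {{M≢0}} eq le = *-cancelˡ-≤ (κ * M ^ κ) {{m*n≢0 κ (M ^ κ) {{κ≢0}} {{m^n≢0 M κ {{M≢0}}}}}} (begin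
  κ * M ^ κ * (L * a)             ≡⟨ re κ (M ^ κ) L a ⟩
  κ * L * (M ^ κ * a)             ≤⟨ *-monoʳ-≤ (κ * L) le ⟩
  κ * L * (suc M ^ κ * b)         ≡⟨ re₁ (κ * L) (suc M ^ κ) b ⟩
  suc M ^ κ * (κ * L) * b         ≤⟨ *-monoˡ-≤ b (bernoulli κ M (κ * L) eq) ⟩
  M ^ κ * suc M * b               ≡⟨ cong (λ N → M ^ κ * N * b) eq ⟩
  M ^ κ * (κ + κ * L) * b         ≡⟨ re₂ κ (M ^ κ) L b ⟩
  κ * M ^ κ * (suc L * b)         ∎)
  where
  open ≤-Reasoning
  re : ∀ k t L a → k * t * (L * a) ≡ k * L * (t * a)
  re = solve-∀
  re₁ : ∀ L t b → L * (t * b) ≡ t * L * b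
  re₁ = solve-∀
  re₂ : ∀ k t L b → t * (k + k * L) * b ≡ k * t * ((1 + L) * b)
  re₂ = solve-∀

-- Abstract, since unfolding polynomials in this number is expensive.
abstract
  tolerance : ∀ L → ∃[ M ] 3 ≤ M × suc M ≡ 6 + 6 * L
  tolerance L = 5 + 6 * L , s≤s (s≤s (s≤s z≤n)) , refl

-- The error has to be relative to b, the approximating term; when a exceeds b there is nothing to
-- correct.
close : ∀ L {a b} → L * b ≤ suc L * a → L * b ≤ L * a + b
close L {a} {b} le with ≤-total b a
... | inj₁ b≤a = ≤-trans (*-monoʳ-≤ L b≤a) (m≤m+n (L * a) b)
... | inj₂ a≤b = ≤-trans le (≤-trans (≤-reflexive (+-comm a (L * a))) (+-monoʳ-≤ (L * a) a≤b))

module _ {b d λ′ ε : ℚ} (0<d : 0ℚ ℚ.< d) (0<λ : 0ℚ ℚ.< λ′) (0≤b : 0ℚ ℚ.≤ b) (1≤ελ : 1ℚ ℚ.≤ ε ℚ.* λ′) where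

  open ℚ.≤-Reasoning
  open +-*-Solver

  scaled-error : ∀ x y → λ′ ℚ.* (d ℚ.* x) ℚ.≤ λ′ ℚ.* (d ℚ.* y) ℚ.+ d ℚ.* b → x ℚ.- y ℚ.≤ ε ℚ.* b
  scaled-error x y le = ℚ.*-cancelˡ-≤-pos (λ′ ℚ.* d) {{ℚ.positive (*-pos 0<λ 0<d)}} (begin
    λ′ ℚ.* d ℚ.* (x ℚ.- y)
      ≡⟨ solve 4 (λ l d x y → l :* d :* (x :- y) := l :* (d :* x) :- l :* (d :* y)) refl λ′ d x y ⟩
    λ′ ℚ.* (d ℚ.* x) ℚ.- λ′ ℚ.* (d ℚ.* y)
      ≤⟨ ℚ.+-monoˡ-≤ (ℚ.- (λ′ ℚ.* (d ℚ.* y))) le ⟩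
    λ′ ℚ.* (d ℚ.* y) ℚ.+ d ℚ.* b ℚ.- λ′ ℚ.* (d ℚ.* y)
      ≡⟨ solve 2 (λ u v → u :+ v :- u := con 1ℚ :* v) refl (λ′ ℚ.* (d ℚ.* y)) (d ℚ.* b) ⟩
    1ℚ ℚ.* (d ℚ.* b)
      ≤⟨ ℚ.*-monoʳ-≤-nonNeg (d ℚ.* b) {{ℚ.nonNegative 0≤db}} 1≤ελ ⟩
    ε ℚ.* λ′ ℚ.* (d ℚ.* b)
      ≡⟨ solve 4 (λ e l d b → e :* l :* (d :* b) := l :* d :* (e :* b)) refl ε λ′ d b ⟩
    λ′ ℚ.* d ℚ.* (ε ℚ.* b) ∎)
    where
    0≤db : 0ℚ ℚ.≤ d ℚ.* b
    0≤db = subst (ℚ._≤ d ℚ.* b) (ℚ.*-zeroʳ d) (ℚ.*-monoˡ-≤-nonNeg d {{ℚ.nonNegative (ℚ.<⇒≤ 0<d)}} 0≤b)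

  relative-error : ∀ a →
    λ′ ℚ.* (d ℚ.* a) ℚ.≤ λ′ ℚ.* (d ℚ.* b) ℚ.+ d ℚ.* b →
    λ′ ℚ.* (d ℚ.* b) ℚ.≤ λ′ ℚ.* (d ℚ.* a) ℚ.+ d ℚ.* b →
    ℚ.∣ a ℚ.- b ∣ ℚ.≤ ε ℚ.* b
  relative-error a le₁ le₂ with ℚ.∣p∣≡p∨∣p∣≡-p (a ℚ.- b)
  ... | inj₁ eq = subst (ℚ._≤ ε ℚ.* b) (sym eq) (scaled-error a b le₁)
  ... | inj₂ eq = subst (ℚ._≤ ε ℚ.* b) (sym (trans eq (neg-sub a b))) (scaled-error b a le₂)

-- From the index `N` of the positivity proof on, the maximum with δ inside `recip` is inactive.
recip-inverse : ∀ x (0<x : 0ᴿ <ᴿ x) → ∃[ N ] ∀ n → N ≤ n →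
  seq (recip x 0<x) n ℚ.* seq x n ≡ 1ℚ
recip-inverse (mkℝ x cx) (δ , 0<δ , N , δ≤x) = N , λ n N≤n →
  let u>0 = ⊔-pos (x n) 0<δ
      u≡x = ℚ.p≥q⇒p⊔q≡p (subst (ℚ._≤ x n) (ℚ.+-identityˡ δ) (δ≤x n N≤n))
  in trans (cong ((ℚ.1/ (x n ℚ.⊔ δ)) {{ℚ.>-nonZero u>0}} ℚ.*_) (sym u≡x)) (ℚ.*-inverseˡ (x n ℚ.⊔ δ) {{ℚ.>-nonZero u>0}})

-- Sides of a triangle as sums of two of three numbers

halve : ∀ x → ∃[ e ] ∃[ e′ ] ∃[ l ] e + e′ ≡ 1 × x ≡ l + e + l
halve zero          = 0 , 1 , 0 , refl , refl
halve (suc zero)    = 1 , 0 , 0 , refl , refl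
halve (suc (suc x)) with halve x
... | e , e′ , l , e+e′ , refl = e , e′ , suc l , e+e′ , cong suc (sym (+-suc (l + e) l))

record Split (a b c : ℕ) : Set where
  field
    e e′ l m n : ℕ
    e+e′ : e + e′ ≡ 1
    a≡   : a ≡ l + e + m
    b≡   : b ≡ l + e + n
    c≡   : c ≡ m + e + n

-- Here e is the parity of a + b - c = 2l + e. The triangle inequality b < a + c gives 2l + e < 2a,
-- hence l + e ≤ a, and likewise for b.
split : ∀ {a b c} → Triangle a b c → Split a b c
split {a} {b} {c} (triangle a<b+c b<a+c c<a+b) with halve (a + b ∸ c)
... | e , e′ , l , e+e′ , eq = record
  { e = e ; e′ = e′ ; l = l ; m = a ∸ (l + e) ; n = b ∸ (l + e) ; e+e′ = e+e′
  ; a≡ = sym (m+[n∸m]≡n l+e≤a)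
  ; b≡ = sym (m+[n∸m]≡n l+e≤b)
  ; c≡ = +-cancelˡ-≡ (l + e + l) _ _ (trans total (trans (cong₂ _+_ (sym (m+[n∸m]≡n l+e≤a)) (sym (m+[n∸m]≡n l+e≤b)))
      (re l e (a ∸ (l + e)) (b ∸ (l + e)))))
  }
  where
  open ≤-Reasoning
  total : l + e + l + c ≡ a + b
  total = trans (cong (_+ c) (sym eq)) (m∸n+n≡m (<⇒≤ c<a+b))
  re : ∀ l e m n → (l + e + m) + (l + e + n) ≡ (l + e + l) + (m + e + n)
  re = solve-∀
  re₁ : ∀ l e → l + e + (l + e) ≡ l + e + l + e
  re₁ l e = sym (+-assoc (l + e) l e)
  half-≤ : ∀ u v → u + v ≡ a + b → v < u + c → l + e ≤ u
  half-≤ u v u+v v<u+c = ≮⇒≥ λ u<l+e → <-irrefl refl (begin-strict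
    u + u                 <⟨ +-mono-< (n<1+n u) (n<1+n u) ⟩
    suc u + suc u         ≤⟨ +-mono-≤ u<l+e u<l+e ⟩
    l + e + (l + e)       ≡⟨ re₁ l e ⟩
    l + e + l + e         ≤⟨ +-monoʳ-≤ (l + e + l) (≤-trans (m≤m+n e e′) (≤-reflexive e+e′)) ⟩
    l + e + l + 1         ≡⟨ +-comm (l + e + l) 1 ⟩
    suc (l + e + l)       ≤⟨ +-cancelʳ-< c (l + e + l) (u + u) (begin-strict
      l + e + l + c         ≡⟨ trans total (sym u+v) ⟩
      u + v                 <⟨ +-monoʳ-< u v<u+c ⟩
      u + (u + c)           ≡⟨ +-assoc u u c ⟨
      u + u + c             ∎) ⟩
    u + u                 ∎)
  l+e≤a : l + e ≤ a
  l+e≤a = half-≤ a b refl b<a+c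
  l+e≤b : l + e ≤ b
  l+e≤b = half-≤ b a (+-comm b a) (≤-trans a<b+c ≤-refl)

*-cancelʳ-≡-pos : ∀ {p q} r → 0ℚ ℚ.< r → p ℚ.* r ≡ q ℚ.* r → p ≡ q
*-cancelʳ-≡-pos r 0<r eq = ℚ.≤-antisym
  (ℚ.*-cancelʳ-≤-pos r {{ℚ.positive 0<r}} (ℚ.≤-reflexive eq))
  (ℚ.*-cancelʳ-≤-pos r {{ℚ.positive 0<r}} (ℚ.≤-reflexive (sym eq)))

p≤p+q : ∀ p {q} → 0ℚ ℚ.< q → p ℚ.≤ p ℚ.+ q
p≤p+q p {q} 0<q = subst (ℚ._≤ p ℚ.+ q) (ℚ.+-identityʳ p) (ℚ.+-monoʳ-≤ p (ℚ.<⇒≤ 0<q))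

precision : ∀ {ε} → 0ℚ ℚ.< ε → ∃[ L ] 0 < L × 1ℚ ℚ.≤ ε ℚ.* ι L
precision {ε} 0<ε with archimedean 1 0<ε
... | N , small = suc N , z<s , ℚ.≤-trans (ℚ.≤-reflexive (sym (/-*ι 1 (suc N))))
  (ℚ.*-monoʳ-≤-nonNeg (ι (suc N)) {{ℚ.nonNegative (ι-nonNeg (suc N))}} (ℚ.<⇒≤ (small N ≤-refl)))

module RelativeError (ε : ℚ) (L : ℕ) (0<L : 0 < L) (1≤εL : 1ℚ ℚ.≤ ε ℚ.* ι L)
  (M : ℕ) (3≤M : 3 ≤ M) (M≡ : suc M ≡ 6 + 6 * L) where

  -- Since E = r ρ (S π′ √′) and the approximation is r ρ times the power of 2, the relative error
  -- is that of S π′ √′ against the power, which becomes a comparison of natural numbers after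
  -- multiplication by q k.
  rational-estimate : ∀ (e s power p q t k : ℕ) (π′ √′ r ρ : ℚ) → 0 < q → 0 < k →
    π′ ℚ.* ι q ≡ ι p → √′ ℚ.* ι k ≡ ι t → r ℚ.* (π′ ℚ.* √′) ≡ 1ℚ → ρ ℚ.* ι s ≡ ι e →
    L * (s * p * t) ≤ L * (power * (q * k)) + power * (q * k) →
    L * (power * (q * k)) ≤ L * (s * p * t) + power * (q * k) →
    ℚ.∣ ι e ℚ.- ι power ℚ.* r ℚ.* ρ ∣ ℚ.≤ ε ℚ.* ℚ.∣ ι power ℚ.* r ℚ.* ρ ∣
  rational-estimate e s power p q t k π′ √′ r ρ 0<q 0<k π-eq √-eq r-eq ρ-eq le₁ le₂ = begin
    ℚ.∣ ι e ℚ.- b ℚ.* r ℚ.* ρ ∣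
      ≡⟨ cong ℚ.∣_∣ (trans (cong (ℚ._- b ℚ.* r ℚ.* ρ) e≡) (solve 4 (λ r ρ a b → r :* ρ :* a :- b :* r :* ρ := r :* ρ :* (a :- b)) refl r ρ a b)) ⟩
    ℚ.∣ r ℚ.* ρ ℚ.* (a ℚ.- b) ∣
      ≡⟨ ℚ.∣p*q∣≡∣p∣*∣q∣ (r ℚ.* ρ) (a ℚ.- b) ⟩
    ℚ.∣ r ℚ.* ρ ∣ ℚ.* ℚ.∣ a ℚ.- b ∣
      ≤⟨ ℚ.*-monoˡ-≤-nonNeg ℚ.∣ r ℚ.* ρ ∣ {{ℚ.nonNegative (ℚ.0≤∣p∣ (r ℚ.* ρ))}} error ⟩
    ℚ.∣ r ℚ.* ρ ∣ ℚ.* (ε ℚ.* b)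
      ≡⟨ solve 3 (λ u ε b → u :* (ε :* b) := ε :* (u :* b)) refl ℚ.∣ r ℚ.* ρ ∣ ε b ⟩
    ε ℚ.* (ℚ.∣ r ℚ.* ρ ∣ ℚ.* b)
      ≡⟨ cong (λ x → ε ℚ.* (ℚ.∣ r ℚ.* ρ ∣ ℚ.* x)) (ℚ.0≤p⇒∣p∣≡p (ι-nonNeg power)) ⟨
    ε ℚ.* (ℚ.∣ r ℚ.* ρ ∣ ℚ.* ℚ.∣ b ∣)
      ≡⟨ cong (ε ℚ.*_) (ℚ.∣p*q∣≡∣p∣*∣q∣ (r ℚ.* ρ) b) ⟨
    ε ℚ.* ℚ.∣ r ℚ.* ρ ℚ.* b ∣
      ≡⟨ cong (λ x → ε ℚ.* ℚ.∣ x ∣) (solve 3 (λ r ρ b → r :* ρ :* b := b :* r :* ρ) refl r ρ b) ⟩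
    ε ℚ.* ℚ.∣ b ℚ.* r ℚ.* ρ ∣ ∎
    where
    open ℚ.≤-Reasoning
    open +-*-Solver
    a b d : ℚ
    a = ι s ℚ.* (π′ ℚ.* √′)
    b = ι power
    d = ι (q * k)
    e≡ : ι e ≡ r ℚ.* ρ ℚ.* a
    e≡ = sym (≡.begin
      r ℚ.* ρ ℚ.* (ι s ℚ.* (π′ ℚ.* √′))
        ≡.≡⟨ solve 4 (λ r ρ s x → r :* ρ :* (s :* x) := r :* x :* (ρ :* s)) refl r ρ (ι s) (π′ ℚ.* √′) ⟩
      r ℚ.* (π′ ℚ.* √′) ℚ.* (ρ ℚ.* ι s)
        ≡.≡⟨ cong₂ ℚ._*_ r-eq ρ-eq ⟩
      1ℚ ℚ.* ι e
        ≡.≡⟨ ℚ.*-identityˡ (ι e) ⟩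
      ι e ≡.∎)
      where module ≡ = ≡-Reasoning
    da : ι (s * p * t) ≡ d ℚ.* a
    da = ≡.begin
      ι (s * p * t)                                         ≡.≡⟨ trans (ι-* (s * p) t) (cong (ℚ._* ι t) (ι-* s p)) ⟩
      ι s ℚ.* ι p ℚ.* ι t                                   ≡.≡⟨ cong₂ (λ x y → ι s ℚ.* x ℚ.* y) (sym π-eq) (sym √-eq) ⟩
      ι s ℚ.* (π′ ℚ.* ι q) ℚ.* (√′ ℚ.* ι k)                 ≡.≡⟨ solve 5 (λ s x q y k → s :* (x :* q) :* (y :* k) := q :* k :* (s :* (x :* y))) refl (ι s) π′ (ι q) √′ (ι k) ⟩
      ι q ℚ.* ι k ℚ.* a                                     ≡.≡⟨ cong (ℚ._* a) (ι-* q k) ⟨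
      d ℚ.* a                                               ≡.∎
      where module ≡ = ≡-Reasoning
    db : ι (power * (q * k)) ≡ d ℚ.* b
    db = trans (ι-* power (q * k)) (ℚ.*-comm b d)
    ι-≤ : ∀ x y z → L * x ≤ L * y + z → ι L ℚ.* ι x ℚ.≤ ι L ℚ.* ι y ℚ.+ ι z
    ι-≤ x y z le = subst₂ ℚ._≤_ (ι-* L x) (trans (ι-+ (L * y) z) (cong (ℚ._+ ι z) (ι-* L y))) (ι-mono-≤ le)
    error : ℚ.∣ a ℚ.- b ∣ ℚ.≤ ε ℚ.* b
    error = relative-error {b} {d} {ι L} {ε} (ι-pos (*-mono-≤ 0<q 0<k)) (ι-pos 0<L) (ι-nonNeg power) 1≤εL a
      (subst₂ (λ x y → ι L ℚ.* x ℚ.≤ ι L ℚ.* y ℚ.+ y) da db (ι-≤ (s * p * t) (power * (q * k)) (power * (q * k)) le₁))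
      (subst₂ (λ x y → ι L ℚ.* y ℚ.≤ ι L ℚ.* x ℚ.+ y) da db (ι-≤ (power * (q * k)) (s * p * t) (power * (q * k)) le₂))

  K : ℕ
  K = threshold M

  ≲⇒≤ : ∀ {a b} → (let open Approximate M in a ≲[ 6 ] b) → L * a ≤ suc L * b
  ≲⇒≤ a≲b = bernoulli-≤ 6 M L {{_}} {{>-nonZero (≤-trans (s≤s z≤n) 3≤M)}} M≡ (Approximate._≲[_]_.bound a≲b)

  -- In terms of x = a + b - c, y = a + c - b and z = b + c - a the discriminant is xy + yz + zx.
  -- The squares split off additively, so the truncated subtraction is exact.
  discriminant-split : ∀ e l m n → let x = l + e + l ; y = m + e + m ; z = n + e + n in
    discriminant (l + e + m) (l + e + n) (m + e + n) ≡ x * y + y * z + z * x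
  discriminant-split e l m n = trans (cong (_∸ squares) (re l m n e)) (m+n∸n≡m _ squares)
    where
    a = l + e + m
    b = l + e + n
    c = m + e + n
    squares = a * a + b * b + c * c
    re : ∀ l m n e → 2 * (l + e + m) * (l + e + n) + 2 * (l + e + m) * (m + e + n) + 2 * (l + e + n) * (m + e + n) ≡
      (l + e + l) * (m + e + m) + (m + e + m) * (n + e + n) + (n + e + n) * (l + e + l)
      + ((l + e + m) * (l + e + m) + (l + e + n) * (l + e + n) + (m + e + n) * (m + e + n))
    re = solve-∀

  module _ (e e′ : ℕ) (e+e′ : e + e′ ≡ 1) (l m n : ℕ)
    (X≥ : K ≤ order e l) (Y≥ : K ≤ order e m) (Z≥ : K ≤ order e n) where

    private
      a = l + e + m
      b = l + e + n
      c = m + e + n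
      x = l + e + l
      y = m + e + m
      z = n + e + n
      module Est = SumEstimate M 3≤M e e′ e+e′ l m n X≥ Y≥ Z≥
      s = Product.S e l m n e′

      side₁ : a + b ∸ c ≡ x
      side₁ = trans (cong (_∸ c) (re l e m n)) (m+n∸n≡m x c)
        where
        re : ∀ l e m n → l + e + m + (l + e + n) ≡ l + e + l + (m + e + n)
        re = solve-∀
      side₂ : a + c ∸ b ≡ y
      side₂ = trans (cong (_∸ b) (re l e m n)) (m+n∸n≡m y b)
        where
        re : ∀ l e m n → l + e + m + (m + e + n) ≡ m + e + m + (l + e + n)
        re = solve-∀
      side₃ : b + c ∸ a ≡ z
      side₃ = trans (cong (_∸ a) (re l e m n)) (m+n∸n≡m z a)
        where
        re : ∀ l e m n → l + e + n + (m + e + n) ≡ n + e + n + (l + e + m)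
        re = solve-∀

      perimeter : a + b + c + 1 ≡ x + y + z + 1
      perimeter = re l m n e
        where
        re : ∀ l m n e → l + e + m + (l + e + n) + (m + e + n) + 1 ≡ l + e + l + (m + e + m) + (n + e + n) + 1
        re = solve-∀

      factorialRatio-eq : factorialRatio a b c ℚ.* ι s ≡ ι (E (a ∷ b ∷ c ∷ []))
      factorialRatio-eq = *-cancelʳ-≡-pos (ι den) (ι-pos (>-nonZero⁻¹ den {{den≢0}})) (begin
        factorialRatio a b c ℚ.* ι s ℚ.* ι den     ≡⟨ solve 3 (λ f s d → f :* s :* d := f :* d :* s) refl (factorialRatio a b c) (ι s) (ι den) ⟩
        factorialRatio a b c ℚ.* ι den ℚ.* ι s     ≡⟨ cong (ℚ._* ι s) (/-*ι num den {{den≢0}}) ⟩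
        ι num ℚ.* ι s                              ≡⟨ ι-* num s ⟨
        ι (num * s)                                ≡⟨ cong ι (Closed.E-closed e e′ e+e′ l m n) ⟨
        ι (E (a ∷ b ∷ c ∷ []) * (x ! * y ! * z !)) ≡⟨ cong (λ d → ι (E (a ∷ b ∷ c ∷ []) * d)) (cong₂ _*_ (cong₂ (λ i j → i ! * j !) side₁ side₂) (cong _! side₃)) ⟨
        ι (E (a ∷ b ∷ c ∷ []) * den)               ≡⟨ ι-* (E (a ∷ b ∷ c ∷ [])) den ⟩
        ι (E (a ∷ b ∷ c ∷ [])) ℚ.* ι den           ∎)
        where
        open ≡-Reasoning
        open +-*-Solver
        num = a ! * b ! * c !
        den = (a + b ∸ c) ! * (a + c ∸ b) ! * (b + c ∸ a) !
        den≢0 : NonZero den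
        den≢0 = m*n≢0 _ _ {{m*n≢0 _ _ {{(a + b ∸ c) !≢0}} {{(a + c ∸ b) !≢0}}}} {{(b + c ∸ a) !≢0}}

    -- The order on reals is tested from some index on, and this index may depend on the sides:
    -- beyond it the reciprocal is an exact inverse and the estimate of the symmetric sum applies at
    -- k = j + 1, the j-th terms of π and √ being given with denominators (j+1)² and j + 1.
    split-estimate : (t : Triangle a b c) →
      ∣ fromℕ (E (a ∷ b ∷ c ∷ [])) -ᴿ approximation a b c t ∣ᴿ ≤ᴿ fromℚ ε *ᴿ ∣ approximation a b c t ∣ᴿ
    split-estimate t ε′ 0<ε′ = N + proj₁ Est.estimate , λ j le →
      ℚ.≤-trans (bound j le) (p≤p+q (ε ℚ.* ℚ.∣ ι P ℚ.* r j ℚ.* factorialRatio a b c ∣) 0<ε′)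
      where
      D = discriminant a b c
      positive = *ᴿ-pos π (√ D) π-pos (√-pos D (discriminant-pos t))
      inverse = recip-inverse (π *ᴿ √ D) positive
      N = proj₁ inverse
      r : ℕ → ℚ
      r = seq (recip (π *ᴿ √ D) positive)
      P = 2 ^ (a + b + c + 1)
      bound : ∀ j → N + proj₁ Est.estimate ≤ j →
        ℚ.∣ ι (E (a ∷ b ∷ c ∷ [])) ℚ.- ι P ℚ.* r j ℚ.* factorialRatio a b c ∣ ℚ.≤ ε ℚ.* ℚ.∣ ι P ℚ.* r j ℚ.* factorialRatio a b c ∣
      bound j le = rational-estimate (E (a ∷ b ∷ c ∷ [])) s P p q root k (π-seq j) (√-seq D j) (r j) (factorialRatio a b c)
          z<s z<s (/-*ι p q) (/-*ι root k) (proj₂ inverse j (≤-trans (m≤m+n N _) le)) factorialRatio-eq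
          (subst₂ (λ u w → L * (s * p * u) ≤ L * (w * (q * k)) + w * (q * k)) root≡ power≡ (≤-trans (≲⇒≤ (proj₂ est)) (≤-reflexive (+-comm (Est.power * (q * k)) (L * (Est.power * (q * k)))))))
          (subst₂ (λ u w → L * (w * (q * k)) ≤ L * (s * p * u) + w * (q * k)) root≡ power≡ (close L (≲⇒≤ (proj₁ est))))
        where
        k = suc j
        p = 4 * quarterCount k
        q = k * k
        root = ⌊√ D * (k * k) ⌋
        k≥ : proj₁ Est.estimate ≤ k
        k≥ = ≤-trans (≤-trans (m≤n+m _ N) le) (n≤1+n j)
        est : Est.Estimate k
        est = proj₂ Est.estimate k k≥
        root≡ : ⌊√ (x * y + y * z + z * x) * (k * k) ⌋ ≡ root
        root≡ = cong (λ d → ⌊√ d * (k * k) ⌋) (sym (discriminant-split e l m n))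
        power≡ : 2 ^ (x + y + z + 1) ≡ P
        power≡ = cong (2 ^_) (sym perimeter)

  estimate : ∀ {a b c} → Split a b c → (t : Triangle a b c) → K + a ≤ b + c → K + b ≤ a + c → K + c ≤ a + b →
    ∣ fromℕ (E (a ∷ b ∷ c ∷ [])) -ᴿ approximation a b c t ∣ᴿ ≤ᴿ fromℚ ε *ᴿ ∣ approximation a b c t ∣ᴿ
  estimate record { e = e ; e′ = e′ ; l = l ; m = m ; n = n ; e+e′ = e+e′ ; a≡ = refl ; b≡ = refl ; c≡ = refl } t Z≥ Y≥ X≥ =
    split-estimate e e′ e+e′ l m n
      (m≤n⇒m≤1+n (+-cancelʳ-≤ (m + e + n) K (l + e + l) (≤-trans X≥ (≤-reflexive (re₁ l e m n)))))
      (m≤n⇒m≤1+n (+-cancelʳ-≤ (l + e + n) K (m + e + m) (≤-trans Y≥ (≤-reflexive (re₂ l e m n)))))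
      (m≤n⇒m≤1+n (+-cancelʳ-≤ (l + e + m) K (n + e + n) (≤-trans Z≥ (≤-reflexive (re₃ l e m n))))) t
    where
    re₁ : ∀ l e m n → l + e + m + (l + e + n) ≡ l + e + l + (m + e + n)
    re₁ = solve-∀
    re₂ : ∀ l e m n → l + e + m + (m + e + n) ≡ m + e + m + (l + e + n)
    re₂ = solve-∀
    re₃ : ∀ l e m n → l + e + n + (m + e + n) ≡ n + e + n + (l + e + m)
    re₃ = solve-∀

-- Growth of the sides and passage to the limit

side-large : ∀ α β γ → α <ᴿ β +ᴿ γ → ∀ K → ∃[ Q ] ∀ Q′ n a b c → Q ℚ.≤ Q′ → fromℚ Q′ ≤ᴿ n →
  fromℕ a ≃ᴿ α *ᴿ n → fromℕ b ≃ᴿ β *ᴿ n → fromℕ c ≃ᴿ γ *ᴿ n → K + a ≤ b + c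
side-large (mkℝ α cα) (mkℝ β cβ) (mkℝ γ cγ) (δ , 0<δ , N₁ , gap) K = Q , bound
  where
  open ℚ.≤-Reasoning
  open +-*-Solver
  δ⁻¹ Q quarter : ℚ
  δ⁻¹ = (ℚ.1/ δ) {{ℚ.>-nonZero 0<δ}}
  -- The `½` absorbs the tolerance in `Q′ ≤ᴿ n`, leaving δ n ≥ K + 1 for the gap δ between α and β +
  -- γ. The approximations of a, b and c cost a quarter each, together less than the unit by which
  -- `suc K` exceeds `K`.
  Q = ι (suc K) ℚ.* δ⁻¹ ℚ.+ ½
  quarter = ½ ℚ.* ½
  0<½ : 0ℚ ℚ.< ½
  0<½ = ℚ.positive⁻¹ ½
  0<quarter : 0ℚ ℚ.< quarter
  0<quarter = ℚ.positive⁻¹ quarter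
  bound : ∀ Q′ n a b c → Q ℚ.≤ Q′ → fromℚ Q′ ≤ᴿ n →
    fromℕ a ≃ᴿ mkℝ α cα *ᴿ n → fromℕ b ≃ᴿ mkℝ β cβ *ᴿ n → fromℕ c ≃ᴿ mkℝ γ cγ *ᴿ n → K + a ≤ b + c
  bound Q′ (mkℝ n _) a b c Q≤Q′ Q′≤n a≃ b≃ c≃ = ≤-trans (n≤1+n (K + a)) (s≤s⁻¹ (≤-trans (/-cancel-< (suc K + a) (b + c + 1) main) (≤-reflexive (+-comm (b + c) 1))))
    where
    N₂ = proj₁ (Q′≤n ½ 0<½)
    Na = proj₁ (a≃ quarter 0<quarter)
    Nb = proj₁ (b≃ quarter 0<quarter)
    Nc = proj₁ (c≃ quarter 0<quarter)
    k = N₁ + (N₂ + (Na + (Nb + Nc)))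
    from₂ : N₂ + (Na + (Nb + Nc)) ≤ k
    from₂ = m≤n+m _ N₁
    from₃ : Na + (Nb + Nc) ≤ k
    from₃ = ≤-trans (m≤n+m _ N₂) from₂
    from₄ : Nb + Nc ≤ k
    from₄ = ≤-trans (m≤n+m _ Na) from₃
    a< = ∣-∣<⇒< {ι a} {α k ℚ.* n k} (proj₂ (a≃ quarter 0<quarter) k (≤-trans (m≤m+n Na _) from₃))
    b> = ∣-∣<⇒> {ι b} {β k ℚ.* n k} (proj₂ (b≃ quarter 0<quarter) k (≤-trans (m≤m+n Nb _) from₄))
    c> = ∣-∣<⇒> {ι c} {γ k ℚ.* n k} (proj₂ (c≃ quarter 0<quarter) k (≤-trans (m≤n+m Nc Nb) from₄))
    K≤n : ι (suc K) ℚ.* δ⁻¹ ℚ.≤ n k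
    K≤n = begin
      ι (suc K) ℚ.* δ⁻¹             ≡⟨ solve 1 (λ x → x := x :+ con ½ :- con ½) refl (ι (suc K) ℚ.* δ⁻¹) ⟩
      Q ℚ.- ½                       ≤⟨ ℚ.+-monoˡ-≤ (ℚ.- ½) (ℚ.≤-trans Q≤Q′ (proj₂ (Q′≤n ½ 0<½) k (≤-trans (m≤m+n N₂ _) from₂))) ⟩
      n k ℚ.+ ½ ℚ.- ½               ≡⟨ solve 1 (λ x → x :+ con ½ :- con ½ := x) refl (n k) ⟩
      n k                           ∎
    0≤n : 0ℚ ℚ.≤ n k
    0≤n = ℚ.≤-trans (ℚ.<⇒≤ (*-pos (ι-pos {suc K} z<s) (ℚ.positive⁻¹ δ⁻¹ {{ℚ.1/pos⇒pos δ {{ℚ.positive 0<δ}}}}))) K≤n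
    K≤δn : ι (suc K) ℚ.≤ n k ℚ.* δ
    K≤δn = begin
      ι (suc K)                     ≡⟨ trans (cong (ι (suc K) ℚ.*_) (ℚ.*-inverseˡ δ {{ℚ.>-nonZero 0<δ}})) (ℚ.*-identityʳ (ι (suc K))) ⟨
      ι (suc K) ℚ.* (δ⁻¹ ℚ.* δ)     ≡⟨ ℚ.*-assoc (ι (suc K)) δ⁻¹ δ ⟨
      ι (suc K) ℚ.* δ⁻¹ ℚ.* δ       ≤⟨ ℚ.*-monoʳ-≤-nonNeg δ {{ℚ.nonNegative (ℚ.<⇒≤ 0<δ)}} K≤n ⟩
      n k ℚ.* δ                     ∎
    main : ι (suc K + a) ℚ.< ι (b + c + 1)
    main = begin-strict
      ι (suc K + a)
        ≡⟨ ι-+ (suc K) a ⟩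
      ι (suc K) ℚ.+ ι a
        <⟨ ℚ.+-mono-≤-< K≤δn a< ⟩
      n k ℚ.* δ ℚ.+ (α k ℚ.* n k ℚ.+ quarter)
        ≡⟨ solve 3 (λ n δ α → n :* δ :+ (α :* n :+ con quarter) := (α :+ δ) :* n :+ con quarter) refl (n k) δ (α k) ⟩
      (α k ℚ.+ δ) ℚ.* n k ℚ.+ quarter
        ≤⟨ ℚ.+-monoˡ-≤ quarter (ℚ.*-monoʳ-≤-nonNeg (n k) {{ℚ.nonNegative 0≤n}} (gap k (m≤m+n N₁ _))) ⟩
      (β k ℚ.+ γ k) ℚ.* n k ℚ.+ quarter
        ≡⟨ cong (ℚ._+ quarter) (ℚ.*-distribʳ-+ (n k) (β k) (γ k)) ⟩
      β k ℚ.* n k ℚ.+ γ k ℚ.* n k ℚ.+ quarter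
        <⟨ ℚ.+-monoˡ-< quarter (ℚ.+-mono-< b> c>) ⟩
      (ι b ℚ.+ quarter) ℚ.+ (ι c ℚ.+ quarter) ℚ.+ quarter
        ≤⟨ p≤p+q ((ι b ℚ.+ quarter) ℚ.+ (ι c ℚ.+ quarter) ℚ.+ quarter) 0<quarter ⟩
      (ι b ℚ.+ quarter) ℚ.+ (ι c ℚ.+ quarter) ℚ.+ quarter ℚ.+ quarter
        ≡⟨ solve 2 (λ b c → (b :+ con quarter) :+ (c :+ con quarter) :+ con quarter :+ con quarter := b :+ c :+ con 1ℚ) refl (ι b) (ι c) ⟩
      ι b ℚ.+ ι c ℚ.+ 1ℚ
        ≡⟨ trans (ι-+ (b + c) 1) (cong (ℚ._+ 1ℚ) (ι-+ b c)) ⟨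
      ι (b + c + 1) ∎

mainTheorem15 : (α β γ : ℝ) → 0ᴿ <ᴿ α → 0ᴿ <ᴿ β → 0ᴿ <ᴿ γ →
    (α<β+γ : α <ᴿ β +ᴿ γ) (β<α+γ : β <ᴿ α +ᴿ γ) (γ<α+β : γ <ᴿ α +ᴿ β) →
    let open Admissible in
    (λ (i : Admissible α β γ) → fromℕ (E (a i ∷ b i ∷ c i ∷ []))) ∼
    (λ i → approximation (a i) (b i) (c i) (admissible⇒triangle α<β+γ β<α+γ γ<α+β i))
    as n →∞
mainTheorem15 α β γ _ _ _ α<β+γ β<α+γ γ<α+β ε 0<ε = fromℚ Q , λ i Q≤n →
  let open Admissible i in
  let t = admissible⇒triangle α<β+γ β<α+γ γ<α+β i in
  estimate (split t) t
    (proj₂ large₁ Q n a b c (ℚ.≤-trans (ℚ.p≤p⊔q Q₁ Q₂) (ℚ.p≤p⊔q (Q₁ ℚ.⊔ Q₂) Q₃)) Q≤n a≃αn b≃βn c≃γn)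
    (proj₂ large₂ Q n b a c (ℚ.≤-trans (ℚ.p≤q⊔p Q₁ Q₂) (ℚ.p≤p⊔q (Q₁ ℚ.⊔ Q₂) Q₃)) Q≤n b≃βn a≃αn c≃γn)
    (proj₂ large₃ Q n c a b (ℚ.p≤q⊔p (Q₁ ℚ.⊔ Q₂) Q₃) Q≤n c≃γn a≃αn b≃βn)
  where
  -- The order of the choices matters: ε determines L, then M and the threshold `K`, and `K`
  -- together with the gaps in the triangle inequalities determines `Q`, uniformly in i.
  accuracy = precision 0<ε
  M = tolerance (proj₁ accuracy)
  open RelativeError ε (proj₁ accuracy) (proj₁ (proj₂ accuracy)) (proj₂ (proj₂ accuracy))
    (proj₁ M) (proj₁ (proj₂ M)) (proj₂ (proj₂ M))
  large₁ = side-large α β γ α<β+γ K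
  large₂ = side-large β α γ β<α+γ K
  large₃ = side-large γ α β γ<α+β K
  Q₁ Q₂ Q₃ Q : ℚ
  Q₁ = proj₁ large₁
  Q₂ = proj₁ large₂
  Q₃ = proj₁ large₃
  Q = Q₁ ℚ.⊔ Q₂ ℚ.⊔ Q₃
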